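{- Let $f(X)\in\mathbb{Z}[X]\setminus\{0\}$ and $\varepsilon_0\in(0,1/100)$ be fixed, and let $C_0$ be the fixed constant depending only on $f$ described in the context. There exist constants $x_0>0$ and $K>0$, depending at most on $f$ and $\varepsilon_0$, such that the following holds for every integer $x\geqslant x_0$. Let $p$ be a prime number, let $t$ be an integer with \[ \left(\frac{10}{\varepsilon_0}\right)^{100} \leqslant t \leqslant C_0 x^{2/3}, \] and let $J$ be an interval with $J\subset[\varepsilon_0 x,\min\{x,p\})$. If $n_1,n_2,\ldots,n_t$ are distinct integers in $J$, then \[ \log p \sum_{t'=\left\lceil \left(\frac{1+\varepsilon_0}{2}\right)t\right\rceil}^{t}\ \min_{1\leqslant j\leqslant t'}\left\{\operatorname{ord}_p\left(n_j!+f(n_j)\right)\right\} \leqslant \frac{|J|}{2}\log t+\frac{x\log x}{t^{0.98}}+Kx. \]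
   Context: $\operatorname{ord}_p(m)$ is the $p$-adic order of a nonzero integer $m$; $|J|$ is the length of the interval $J$; $\log$ is the natural logarithm. For $n$ sufficiently large in terms of $f$ one has $n!+f(n)>1$, so for $x$ large the orders above are finite. The constant $C_0>0$ is a fixed constant depending only on $f$ with the following property (a known result of Luca and Shparlinski guarantees that such a constant exists): for any prime $p$ and any interval $J'\subset[1,p)$ of length $|J'|\geqslant 1$, \[ \#\{n\in\mathbb{N}: n\in J',\ p\mid (n!+f(n))\}\leqslant C_0|J'|^{2/3}. \] -}

module Defs where

open import Data.Nat.Base as ℕ using (ℕ; zero; suc; z≤n; s≤s; NonZero; _!)
import Data.Nat.Properties as ℕ
open import Data.Nat.Coprimality using (1-coprimeTo)
open import Data.Nat.Divisibility using (_∣?_)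
open import Data.Nat.Primality using (Prime)
open import Data.Integer.Base as ℤ using (ℤ; +_; +[1+_]; -[1+_])
import Data.Integer.Properties as ℤ
open import Data.Integer.Divisibility using (_∣_)
open import Data.Rational.Base as ℚ using (ℚ; mkℚ; 0ℚ; 1ℚ; ½; *≤*; *<*; ↥_)
import Data.Rational.Properties as ℚ
open import Data.Rational.Solver using (module +-*-Solver)
open import Data.Rational.Unnormalised.Base as ℚᵘ using (mkℚᵘ; *≡*)
import Data.Rational.Unnormalised.Properties as ℚᵘ
open import Data.Bool.Base using (if_then_else_)
open import Data.List.Base using (List; []; _∷_; length)
open import Data.List.Relation.Unary.All using (All)
open import Data.List.Relation.Unary.Any using (Any)
open import Data.List.Relation.Unary.Unique.Propositional using (Unique)
open import Data.Product.Base using (∃; _×_; _,_)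
open import Data.Sum.Base using (_⊎_; inj₁; inj₂; [_,_]′; map₁)
open import Relation.Binary.PropositionalEquality
open import Relation.Nullary using (¬_; yes; no; does)
open import Relation.Unary using (Decidable)

private module RS = +-*-Solver

infixr 8 _^ℚ_
_^ℚ_ : ℚ → ℕ → ℚ
q ^ℚ zero  = 1ℚ
q ^ℚ suc n = q ℚ.* q ^ℚ n

frac : ℕ → ℕ → ℚ
frac a n = + a ℚ./ suc n

frac-ᵘ : ∀ a n → ℚ.toℚᵘ (frac a n) ℚᵘ.≃ mkℚᵘ (+ a) n
frac-ᵘ a n = ℚ.toℚᵘ-fromℚᵘ (mkℚᵘ (+ a) n)

frac-mono : ∀ a m c n → a ℕ.* suc n ℕ.≤ c ℕ.* suc m → frac a m ℚ.≤ frac c n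
frac-mono a m c n h = ℚ.toℚᵘ-cancel-≤
  (ℚᵘ.≤-respˡ-≃ (ℚᵘ.≃-sym (frac-ᵘ a m))
    (ℚᵘ.≤-respʳ-≃ (ℚᵘ.≃-sym (frac-ᵘ c n))
      (ℚᵘ.*≤* (subst₂ ℤ._≤_ (ℤ.pos-* a (suc n)) (ℤ.pos-* c (suc m)) (ℤ.+≤+ h)))))

frac-suc : ∀ a n → frac (suc a) n ≡ frac a n ℚ.+ frac 1 n
frac-suc a n = ℚ.toℚᵘ-injective (ℚᵘ.≃-trans (frac-ᵘ (suc a) n)
  (ℚᵘ.≃-sym (ℚᵘ.≃-trans (ℚ.toℚᵘ-homo-+ (frac a n) (frac 1 n))
    (ℚᵘ.≃-trans (ℚᵘ.+-cong (frac-ᵘ a n) (frac-ᵘ 1 n)) (*≡* eq)))))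
  where
  s = suc n
  nat : (a ℕ.* s ℕ.+ 1 ℕ.* s) ℕ.* s ≡ suc a ℕ.* (s ℕ.* s)
  nat = trans (cong (ℕ._* s) (trans (sym (ℕ.*-distribʳ-+ s a 1)) (cong (ℕ._* s) (ℕ.+-comm a 1))))
              (ℕ.*-assoc (suc a) s s)
  eq : (+ a ℤ.* + s ℤ.+ + 1 ℤ.* + s) ℤ.* + s ≡ + suc a ℤ.* + (s ℕ.* s)
  eq rewrite sym (ℤ.pos-* a s) | sym (ℤ.pos-* 1 s) | sym (ℤ.pos-* (a ℕ.* s ℕ.+ 1 ℕ.* s) s)
     | sym (ℤ.pos-* (suc a) (s ℕ.* s)) = cong +_ nat

frac-nonneg : ∀ a n → 0ℚ ℚ.≤ frac a n
frac-nonneg a n = frac-mono 0 0 a n z≤n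

*-nonneg : ∀ {a b} → 0ℚ ℚ.≤ a → 0ℚ ℚ.≤ b → 0ℚ ℚ.≤ a ℚ.* b
*-nonneg {a} {b} 0≤a 0≤b =
  ℚ.nonNegative⁻¹ _ {{ℚ.nonNeg*nonNeg⇒nonNeg a {{ℚ.nonNegative 0≤a}} b {{ℚ.nonNegative 0≤b}}}}

*-pos : ∀ {a b} → 0ℚ ℚ.< a → 0ℚ ℚ.< b → 0ℚ ℚ.< a ℚ.* b
*-pos {a} {b} 0<a 0<b =
  ℚ.positive⁻¹ _ {{ℚ.pos*pos⇒pos a {{ℚ.positive 0<a}} b {{ℚ.positive 0<b}}}}

*-mono : ∀ {a b c d} → 0ℚ ℚ.≤ a → a ℚ.≤ b → 0ℚ ℚ.≤ c → c ℚ.≤ d → a ℚ.* c ℚ.≤ b ℚ.* d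
*-mono {a} {b} {c} {d} 0≤a a≤b 0≤c c≤d = ℚ.≤-trans
  (ℚ.*-monoʳ-≤-nonNeg c {{ℚ.nonNegative 0≤c}} a≤b)
  (ℚ.*-monoˡ-≤-nonNeg b {{ℚ.nonNegative (ℚ.≤-trans 0≤a a≤b)}} c≤d)

^ℚ-nonneg : ∀ {q} n → 0ℚ ℚ.≤ q → 0ℚ ℚ.≤ q ^ℚ n
^ℚ-nonneg zero    0≤q = frac-nonneg 1 0
^ℚ-nonneg (suc n) 0≤q = *-nonneg 0≤q (^ℚ-nonneg n 0≤q)

0<1ℚ : 0ℚ ℚ.< 1ℚ
0<1ℚ = ℚ.positive⁻¹ 1ℚ

0<½ : 0ℚ ℚ.< ½
0<½ = ℚ.positive⁻¹ ½

^ℚ-pos : ∀ {q} n → 0ℚ ℚ.< q → 0ℚ ℚ.< q ^ℚ n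
^ℚ-pos zero    0<q = 0<1ℚ
^ℚ-pos (suc n) 0<q = *-pos 0<q (^ℚ-pos n 0<q)

^ℚ-mono : ∀ {q r} n → 0ℚ ℚ.≤ q → q ℚ.≤ r → q ^ℚ n ℚ.≤ r ^ℚ n
^ℚ-mono zero    0≤q q≤r = ℚ.≤-refl
^ℚ-mono (suc n) 0≤q q≤r = *-mono 0≤q q≤r (^ℚ-nonneg n 0≤q) (^ℚ-mono n 0≤q q≤r)

≤-+ʳ : ∀ {a b} → 0ℚ ℚ.≤ b → a ℚ.≤ a ℚ.+ b
≤-+ʳ {a} {b} 0≤b = subst (ℚ._≤ a ℚ.+ b) (ℚ.+-identityʳ a) (ℚ.+-monoʳ-≤ a 0≤b)

≤-+ˡ : ∀ {a b} → 0ℚ ℚ.≤ a → b ℚ.≤ a ℚ.+ b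
≤-+ˡ {a} {b} 0≤a = subst (ℚ._≤ a ℚ.+ b) (ℚ.+-identityˡ b) (ℚ.+-monoˡ-≤ b 0≤a)

+-cancelʳ-≤ : ∀ c {a b} → a ℚ.+ c ℚ.≤ b ℚ.+ c → a ℚ.≤ b
+-cancelʳ-≤ c {a} {b} h = subst₂ ℚ._≤_ (undo a) (undo b) (ℚ.+-monoˡ-≤ (ℚ.- c) h)
  where
  undo : ∀ z → z ℚ.+ c ℚ.+ ℚ.- c ≡ z
  undo z = RS.solve 2 (λ z c → z RS.:+ c RS.:+ RS.:- c RS.:= z) refl z c

^ℚ-superadd : ∀ {s d} n .{{_ : NonZero n}} → 0ℚ ℚ.≤ s → 0ℚ ℚ.≤ d →
              s ^ℚ n ℚ.+ d ^ℚ n ℚ.≤ (s ℚ.+ d) ^ℚ n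
^ℚ-superadd {s} {d} 1 0≤s 0≤d = ℚ.≤-reflexive
  (RS.solve 2 (λ s d → s RS.:* RS.con 1ℚ RS.:+ d RS.:* RS.con 1ℚ RS.:= (s RS.:+ d) RS.:* RS.con 1ℚ)
    refl s d)
^ℚ-superadd {s} {d} (suc (suc n)) 0≤s 0≤d = begin
  s ℚ.* S ℚ.+ d ℚ.* D                                         ≤⟨ ≤-+ʳ 0≤cross ⟩
  s ℚ.* S ℚ.+ d ℚ.* D ℚ.+ (s ℚ.* D ℚ.+ d ℚ.* S)               ≡⟨ expand ⟩
  (s ℚ.+ d) ℚ.* (S ℚ.+ D)                                     ≤⟨ ℚ.*-monoˡ-≤-nonNeg (s ℚ.+ d)
                                                                  {{ℚ.nonNegative (ℚ.≤-trans 0≤s (≤-+ʳ 0≤d))}}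
                                                                  (^ℚ-superadd (suc n) 0≤s 0≤d) ⟩
  (s ℚ.+ d) ℚ.* (s ℚ.+ d) ^ℚ suc n                            ∎
  where
  open ℚ.≤-Reasoning
  S = s ^ℚ suc n
  D = d ^ℚ suc n
  0≤cross : 0ℚ ℚ.≤ s ℚ.* D ℚ.+ d ℚ.* S
  0≤cross = ℚ.≤-trans (*-nonneg 0≤s (^ℚ-nonneg (suc n) 0≤d))
                      (≤-+ʳ (*-nonneg 0≤d (^ℚ-nonneg (suc n) 0≤s)))
  expand : s ℚ.* S ℚ.+ d ℚ.* D ℚ.+ (s ℚ.* D ℚ.+ d ℚ.* S) ≡ (s ℚ.+ d) ℚ.* (S ℚ.+ D)
  expand = RS.solve 4 (λ s d S D → s RS.:* S RS.:+ d RS.:* D RS.:+ (s RS.:* D RS.:+ d RS.:* S)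
                         RS.:= (s RS.:+ d) RS.:* (S RS.:+ D)) refl s d S D

abs-intro : ∀ {a b ε} → a ℚ.≤ b ℚ.+ ε → b ℚ.≤ a ℚ.+ ε → ℚ.∣ a ℚ.- b ∣ ℚ.≤ ε
abs-intro {a} {b} {ε} h₁ h₂ with ℚ.∣p∣≡p∨∣p∣≡-p (a ℚ.- b)
... | inj₁ e = subst (ℚ._≤ ε) (sym e) (+-cancelʳ-≤ b (subst₂ ℚ._≤_
        (RS.solve 2 (λ a b → a RS.:= (a RS.:+ RS.:- b) RS.:+ b) refl a b) (ℚ.+-comm b ε) h₁))
... | inj₂ e = subst (ℚ._≤ ε) (sym e) (+-cancelʳ-≤ a (subst₂ ℚ._≤_
        (RS.solve 2 (λ a b → b RS.:= RS.:- (a RS.:+ RS.:- b) RS.:+ a) refl a b) (ℚ.+-comm a ε) h₂))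

p≤∣p∣ : ∀ p → p ℚ.≤ ℚ.∣ p ∣
p≤∣p∣ p with ℚ.≤-total 0ℚ p
... | inj₁ 0≤p = ℚ.≤-reflexive (sym (ℚ.0≤p⇒∣p∣≡p 0≤p))
... | inj₂ p≤0 = ℚ.≤-trans p≤0 (ℚ.nonNegative⁻¹ _ {{ℚ.∣-∣-nonNeg p}})

abs-elim : ∀ {a b ε} → ℚ.∣ a ℚ.- b ∣ ℚ.≤ ε → a ℚ.≤ b ℚ.+ ε
abs-elim {a} {b} {ε} h = subst₂ ℚ._≤_
  (RS.solve 2 (λ a b → (a RS.:+ RS.:- b) RS.:+ b RS.:= a) refl a b) (ℚ.+-comm ε b)
  (ℚ.+-monoˡ-≤ b (ℚ.≤-trans (p≤∣p∣ (a ℚ.- b)) h))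

half-sum : ∀ ε → ½ ℚ.* ε ℚ.+ ½ ℚ.* ε ≡ ε
half-sum ε = trans (sym (ℚ.*-distribʳ-+ ε ½ ½)) (ℚ.*-identityˡ ε)

half-pos : ∀ {ε} → 0ℚ ℚ.< ε → 0ℚ ℚ.< ½ ℚ.* ε
half-pos = *-pos 0<½

archimedean : ∀ {ε} → 0ℚ ℚ.< ε → ∃ λ N → ∀ n → N ℕ.≤ n → frac 1 n ℚ.≤ ε
archimedean {mkℚ +[1+ a ] d c} _ = d , λ n d≤n →
  subst (frac 1 n ℚ.≤_) (ℚ.↥p/↧p≡p (mkℚ +[1+ a ] d c))
    (frac-mono 1 n (suc a) d (subst (ℕ._≤ suc a ℕ.* suc n) (sym (ℕ.*-identityˡ (suc d)))
      (ℕ.≤-trans (s≤s d≤n) (ℕ.m≤m+n (suc n) (a ℕ.* suc n)))))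
archimedean {mkℚ (+ 0)    d c} 0<ε with record { pos = () } ← ℚ.positive 0<ε
archimedean {mkℚ -[1+ a ] d c} 0<ε with record { pos = () } ← ℚ.positive 0<ε

-- The largest k ≤ n satisfying P; 0 if there is none.
greatest : ∀ {ℓ} {P : ℕ → Set ℓ} → Decidable P → ℕ → ℕ
greatest P? zero    = zero
greatest P? (suc n) = if does (P? (suc n)) then suc n else greatest P? n

greatest-sat : ∀ {ℓ} {P : ℕ → Set ℓ} (P? : Decidable P) n →
               greatest P? n ≡ 0 ⊎ P (greatest P? n)
greatest-sat P? zero = inj₁ refl
greatest-sat P? (suc n) with P? (suc n)
... | yes p = inj₂ p
... | no  _ = greatest-sat P? n

greatest-max : ∀ {ℓ} {P : ℕ → Set ℓ} (P? : Decidable P) n {k} →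
               k ℕ.≤ n → P k → k ℕ.≤ greatest P? n
greatest-max P? zero k≤n _ = k≤n
greatest-max {P = P} P? (suc n) {k} k≤n pk with P? (suc n)
... | yes _ = k≤n
... | no ¬p = greatest-max P? n (ℕ.≤-pred (ℕ.≤∧≢⇒< k≤n λ e → ¬p (subst P e pk))) pk

-- Real numbers as Cauchy sequences of rationals.  Two sequences denote
-- the same real when each is ≤ the other in the sense of _≤_ below; no
-- quotient is taken.

IsCauchy : (ℕ → ℚ) → Set
IsCauchy s = ∀ ε → 0ℚ ℚ.< ε →
  ∃ λ N → ∀ m n → N ℕ.≤ m → N ℕ.≤ n → ℚ.∣ s m ℚ.- s n ∣ ℚ.≤ ε

record ℝ : Set where
  constructor mkℝ
  field
    seq    : ℕ → ℚ
    cauchy : IsCauchy seq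

open ℝ public

infix 4 _≤_ _<_

_≤_ : ℝ → ℝ → Set
x ≤ y = ∀ ε → 0ℚ ℚ.< ε → ∃ λ N → ∀ n → N ℕ.≤ n → seq x n ℚ.≤ seq y n ℚ.+ ε

_<_ : ℝ → ℝ → Set
x < y = ∃ λ ε → 0ℚ ℚ.< ε × ∃ λ N → ∀ n → N ℕ.≤ n → seq x n ℚ.+ ε ℚ.≤ seq y n

-- A one-sided bound suffices, since m and n may be exchanged.
one-sided⇒cauchy : ∀ {s} →
  (∀ ε → 0ℚ ℚ.< ε → ∃ λ N → ∀ m n → N ℕ.≤ m → N ℕ.≤ n → s m ℚ.≤ s n ℚ.+ ε) → IsCauchy s
one-sided⇒cauchy h ε 0<ε with h ε 0<ε
... | N , b = N , λ m n N≤m N≤n → abs-intro (b m n N≤m N≤n) (b n m N≤n N≤m)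

bounded : ∀ x → ∃ λ B → 0ℚ ℚ.< B × ∃ λ N → ∀ n → N ℕ.≤ n → ℚ.∣ seq x n ∣ ℚ.≤ B
bounded x with cauchy x 1ℚ 0<1ℚ
... | N , h = ℚ.∣ a ∣ ℚ.+ 1ℚ
            , ℚ.<-≤-trans 0<1ℚ (≤-+ˡ {ℚ.∣ a ∣} (ℚ.nonNegative⁻¹ _ {{ℚ.∣-∣-nonNeg a}}))
            , N , bound
  where
  a = seq x N
  bound : ∀ n → N ℕ.≤ n → ℚ.∣ seq x n ∣ ℚ.≤ ℚ.∣ a ∣ ℚ.+ 1ℚ
  bound n N≤n = begin
    ℚ.∣ seq x n ∣                       ≡⟨ cong ℚ.∣_∣ (RS.solve 2 (λ a b → b RS.:= a RS.:+ (b RS.:+ RS.:- a)) refl a (seq x n)) ⟩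
    ℚ.∣ a ℚ.+ (seq x n ℚ.- a) ∣         ≤⟨ ℚ.∣p+q∣≤∣p∣+∣q∣ a _ ⟩
    ℚ.∣ a ∣ ℚ.+ ℚ.∣ seq x n ℚ.- a ∣     ≤⟨ ℚ.+-monoʳ-≤ ℚ.∣ a ∣ (h n N N≤n ℕ.≤-refl) ⟩
    ℚ.∣ a ∣ ℚ.+ 1ℚ                      ∎
    where open ℚ.≤-Reasoning

fromℚ : ℚ → ℝ
fromℚ q = mkℝ (λ _ → q) λ ε 0<ε → 0 , λ _ _ _ _ →
  subst (ℚ._≤ ε) (sym (cong ℚ.∣_∣ (ℚ.+-inverseʳ q))) (ℚ.<⇒≤ 0<ε)

fromℕ : ℕ → ℝ
fromℕ n = fromℚ (frac n 0)

0ℝ 1ℝ : ℝ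
0ℝ = fromℚ 0ℚ
1ℝ = fromℚ 1ℚ

infixl 6 _+_ _-_
infixl 7 _*_
infix  8 -_
infixr 8 _^_

_+_ : ℝ → ℝ → ℝ
x + y = mkℝ (λ n → seq x n ℚ.+ seq y n) (one-sided⇒cauchy {λ n → seq x n ℚ.+ seq y n} λ ε 0<ε →
  let N , h = cauchy x (½ ℚ.* ε) (half-pos 0<ε)
      M , k = cauchy y (½ ℚ.* ε) (half-pos 0<ε)
  in N ℕ.⊔ M , λ m n l₁ l₂ → ℚ.≤-trans
       (ℚ.+-mono-≤ (abs-elim {seq x m} {seq x n} (h m n (ℕ.m⊔n≤o⇒m≤o N M l₁) (ℕ.m⊔n≤o⇒m≤o N M l₂)))
                   (abs-elim {seq y m} {seq y n} (k m n (ℕ.m⊔n≤o⇒n≤o N M l₁) (ℕ.m⊔n≤o⇒n≤o N M l₂))))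
       (ℚ.≤-reflexive (trans
         (RS.solve 3 (λ a b e → (a RS.:+ e) RS.:+ (b RS.:+ e) RS.:= (a RS.:+ b) RS.:+ (e RS.:+ e))
            refl (seq x n) (seq y n) (½ ℚ.* ε))
         (cong (seq x n ℚ.+ seq y n ℚ.+_) (half-sum ε)))))

-_ : ℝ → ℝ
- x = mkℝ (λ n → ℚ.- seq x n) λ ε 0<ε →
  let N , h = cauchy x ε 0<ε
  in N , λ m n l₁ l₂ → subst (ℚ._≤ ε)
       (cong ℚ.∣_∣ (RS.solve 2 (λ a b → b RS.:+ RS.:- a RS.:= RS.:- a RS.:+ RS.:- (RS.:- b))
          refl (seq x m) (seq x n)))
       (h n m l₂ l₁)

_-_ : ℝ → ℝ → ℝ
x - y = x + - y

1/pos : ∀ δ → 0ℚ ℚ.< δ → ℚ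
1/pos δ 0<δ = (ℚ.1/ δ) {{ℚ.>-nonZero 0<δ}}

1/pos-pos : ∀ δ (0<δ : 0ℚ ℚ.< δ) → 0ℚ ℚ.< 1/pos δ 0<δ
1/pos-pos δ 0<δ = ℚ.positive⁻¹ _ {{ℚ.1/pos⇒pos δ {{ℚ.positive 0<δ}}}}

1/pos-inv : ∀ δ (0<δ : 0ℚ ℚ.< δ) → δ ℚ.* 1/pos δ 0<δ ≡ 1ℚ
1/pos-inv δ 0<δ = ℚ.*-inverseʳ δ {{ℚ.>-nonZero 0<δ}}

abs≥0 : ∀ q → 0ℚ ℚ.≤ ℚ.∣ q ∣
abs≥0 q = ℚ.nonNegative⁻¹ _ {{ℚ.∣-∣-nonNeg q}}

product-split : ∀ a b c d → a ℚ.* b ℚ.- c ℚ.* d ≡ a ℚ.* (b ℚ.- d) ℚ.+ d ℚ.* (a ℚ.- c)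
product-split = RS.solve 4 (λ a b c d → a RS.:* b RS.:+ RS.:- (c RS.:* d)
                  RS.:= a RS.:* (b RS.:+ RS.:- d) RS.:+ d RS.:* (a RS.:+ RS.:- c)) refl

*-1/pos-cancel : ∀ D (0<D : 0ℚ ℚ.< D) η → D ℚ.* (η ℚ.* 1/pos D 0<D) ≡ η
*-1/pos-cancel D 0<D η = trans
  (RS.solve 3 (λ d h i → d RS.:* (h RS.:* i) RS.:= h RS.:* (d RS.:* i)) refl D η (1/pos D 0<D))
  (trans (cong (η ℚ.*_) (1/pos-inv D 0<D)) (ℚ.*-identityʳ η))

product-bound : ∀ {a b c d B C ε} (0<B : 0ℚ ℚ.< B) (0<C : 0ℚ ℚ.< C) →
  ℚ.∣ a ∣ ℚ.≤ B → ℚ.∣ d ∣ ℚ.≤ C →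
  ℚ.∣ b ℚ.- d ∣ ℚ.≤ ½ ℚ.* ε ℚ.* 1/pos B 0<B → ℚ.∣ a ℚ.- c ∣ ℚ.≤ ½ ℚ.* ε ℚ.* 1/pos C 0<C →
  ℚ.∣ a ℚ.* b ℚ.- c ℚ.* d ∣ ℚ.≤ ε
product-bound {a} {b} {c} {d} {B} {C} {ε} 0<B 0<C a≤B d≤C hb ha = begin
  ℚ.∣ a ℚ.* b ℚ.- c ℚ.* d ∣
    ≡⟨ cong ℚ.∣_∣ (product-split a b c d) ⟩
  ℚ.∣ a ℚ.* (b ℚ.- d) ℚ.+ d ℚ.* (a ℚ.- c) ∣
    ≤⟨ ℚ.∣p+q∣≤∣p∣+∣q∣ (a ℚ.* (b ℚ.- d)) (d ℚ.* (a ℚ.- c)) ⟩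
  ℚ.∣ a ℚ.* (b ℚ.- d) ∣ ℚ.+ ℚ.∣ d ℚ.* (a ℚ.- c) ∣
    ≡⟨ cong₂ ℚ._+_ (ℚ.∣p*q∣≡∣p∣*∣q∣ a (b ℚ.- d)) (ℚ.∣p*q∣≡∣p∣*∣q∣ d (a ℚ.- c)) ⟩
  ℚ.∣ a ∣ ℚ.* ℚ.∣ b ℚ.- d ∣ ℚ.+ ℚ.∣ d ∣ ℚ.* ℚ.∣ a ℚ.- c ∣
    ≤⟨ ℚ.+-mono-≤ (*-mono (abs≥0 a) a≤B (abs≥0 (b ℚ.- d)) hb)
                  (*-mono (abs≥0 d) d≤C (abs≥0 (a ℚ.- c)) ha) ⟩
  B ℚ.* (½ ℚ.* ε ℚ.* 1/pos B 0<B) ℚ.+ C ℚ.* (½ ℚ.* ε ℚ.* 1/pos C 0<C)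
    ≡⟨ cong₂ ℚ._+_ (*-1/pos-cancel B 0<B (½ ℚ.* ε)) (*-1/pos-cancel C 0<C (½ ℚ.* ε)) ⟩
  ½ ℚ.* ε ℚ.+ ½ ℚ.* ε
    ≡⟨ half-sum ε ⟩
  ε ∎
  where open ℚ.≤-Reasoning

_*_ : ℝ → ℝ → ℝ
x * y = mkℝ (λ n → seq x n ℚ.* seq y n) λ ε 0<ε →
  let B , 0<B , N₁ , b = bounded x
      C , 0<C , N₂ , c = bounded y
      N₃ , hy = cauchy y (½ ℚ.* ε ℚ.* 1/pos B 0<B) (*-pos (half-pos 0<ε) (1/pos-pos B 0<B))
      N₄ , hx = cauchy x (½ ℚ.* ε ℚ.* 1/pos C 0<C) (*-pos (half-pos 0<ε) (1/pos-pos C 0<C))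
      l₁₂ : ∀ {n} → (N₁ ℕ.⊔ N₂) ℕ.⊔ (N₃ ℕ.⊔ N₄) ℕ.≤ n → N₁ ℕ.⊔ N₂ ℕ.≤ n
      l₁₂ l = ℕ.m⊔n≤o⇒m≤o (N₁ ℕ.⊔ N₂) (N₃ ℕ.⊔ N₄) l
      l₃₄ : ∀ {n} → (N₁ ℕ.⊔ N₂) ℕ.⊔ (N₃ ℕ.⊔ N₄) ℕ.≤ n → N₃ ℕ.⊔ N₄ ℕ.≤ n
      l₃₄ l = ℕ.m⊔n≤o⇒n≤o (N₁ ℕ.⊔ N₂) (N₃ ℕ.⊔ N₄) l
  in (N₁ ℕ.⊔ N₂) ℕ.⊔ (N₃ ℕ.⊔ N₄) , λ m n lm ln →
     product-bound {a = seq x m} {b = seq y m} {c = seq x n} {d = seq y n} 0<B 0<C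
       (b m (ℕ.m⊔n≤o⇒m≤o N₁ N₂ (l₁₂ lm))) (c n (ℕ.m⊔n≤o⇒n≤o N₁ N₂ (l₁₂ ln)))
       (hy m n (ℕ.m⊔n≤o⇒m≤o N₃ N₄ (l₃₄ lm)) (ℕ.m⊔n≤o⇒m≤o N₃ N₄ (l₃₄ ln)))
       (hx m n (ℕ.m⊔n≤o⇒n≤o N₃ N₄ (l₃₄ lm)) (ℕ.m⊔n≤o⇒n≤o N₃ N₄ (l₃₄ ln)))

_^_ : ℝ → ℕ → ℝ
x ^ zero  = 1ℝ
x ^ suc n = x * x ^ n

-- If seq x n ≥ δ > 0 from some index on, then 1 / (δ ⊔ seq x n) is
-- eventually 1 / seq x n; the maximum only repairs the initial terms.
inv : (x : ℝ) → 0ℝ < x → ℝ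
inv x (δ , 0<δ , _) = mkℝ (λ n → 1/pos (g n) (g-pos n)) (one-sided⇒cauchy go)
  where
  g : ℕ → ℚ
  g n = δ ℚ.⊔ seq x n
  δ≤g : ∀ n → δ ℚ.≤ g n
  δ≤g n = ℚ.p≤p⊔q δ (seq x n)
  g-pos : ∀ n → 0ℚ ℚ.< g n
  g-pos n = ℚ.<-≤-trans 0<δ (δ≤g n)
  go : ∀ ε → 0ℚ ℚ.< ε → ∃ λ N → ∀ m n → N ℕ.≤ m → N ℕ.≤ n →
       1/pos (g m) (g-pos m) ℚ.≤ 1/pos (g n) (g-pos n) ℚ.+ ε
  go ε 0<ε with cauchy x (ε ℚ.* (δ ℚ.* δ)) (*-pos 0<ε (*-pos 0<δ 0<δ))
  ... | N , h = N , bound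
    where
    bound : ∀ m n → N ℕ.≤ m → N ℕ.≤ n →
            1/pos (g m) (g-pos m) ℚ.≤ 1/pos (g n) (g-pos n) ℚ.+ ε
    bound m n lm ln = ℚ.*-cancelˡ-≤-pos (u ℚ.* v) {{ℚ.positive 0<uv}} (begin
      u ℚ.* v ℚ.* i               ≡⟨ RS.solve 3 (λ u v i → u RS.:* v RS.:* i RS.:= v RS.:* (u RS.:* i)) refl u v i ⟩
      v ℚ.* (u ℚ.* i)             ≡⟨ trans (cong (v ℚ.*_) (1/pos-inv u (g-pos m))) (ℚ.*-identityʳ v) ⟩
      v                           ≤⟨ v≤ ⟩
      u ℚ.+ ε ℚ.* (δ ℚ.* δ)       ≤⟨ ℚ.+-monoʳ-≤ u (ℚ.*-monoˡ-≤-nonNeg ε {{ℚ.nonNegative (ℚ.<⇒≤ 0<ε)}}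
                                       (*-mono (ℚ.<⇒≤ 0<δ) (δ≤g m) (ℚ.<⇒≤ 0<δ) (δ≤g n))) ⟩
      u ℚ.+ ε ℚ.* (u ℚ.* v)       ≡⟨ cong (ℚ._+ ε ℚ.* (u ℚ.* v)) (trans (sym (ℚ.*-identityʳ u)) (cong (u ℚ.*_) (sym (1/pos-inv v (g-pos n))))) ⟩
      u ℚ.* (v ℚ.* j) ℚ.+ ε ℚ.* (u ℚ.* v)
                                  ≡⟨ RS.solve 4 (λ u v j e → u RS.:* (v RS.:* j) RS.:+ e RS.:* (u RS.:* v)
                                       RS.:= u RS.:* v RS.:* (j RS.:+ e)) refl u v j ε ⟩
      u ℚ.* v ℚ.* (j ℚ.+ ε)       ∎)
      where
      open ℚ.≤-Reasoning
      u = g m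
      v = g n
      i = 1/pos u (g-pos m)
      j = 1/pos v (g-pos n)
      0<uv = *-pos (g-pos m) (g-pos n)
      0≤e : 0ℚ ℚ.≤ ε ℚ.* (δ ℚ.* δ)
      0≤e = ℚ.<⇒≤ (*-pos 0<ε (*-pos 0<δ 0<δ))
      v≤ : v ℚ.≤ u ℚ.+ ε ℚ.* (δ ℚ.* δ)
      v≤ = ℚ.⊔-lub (ℚ.≤-trans (δ≤g m) (≤-+ʳ 0≤e))
                   (ℚ.≤-trans (abs-elim (h n m ln lm))
                              (ℚ.+-monoˡ-≤ _ (ℚ.p≤q⊔p δ (seq x m))))

-- The largest multiple k / (n + 1), k ≥ 0, whose b-th power is ≤ q.  As
-- q ≤ ∣ ↥ q ∣, the bound on the search does not exclude any candidate.
rootNumerator : ℕ → ℚ → ℕ → ℕ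
rootNumerator b q n =
  greatest (λ k → frac k n ^ℚ b ℚ.≤? q) (suc n ℕ.* suc ℤ.∣ ↥ q ∣)

rootApprox : ℕ → ℚ → ℕ → ℚ
rootApprox b q n = frac (rootNumerator b q n) n

rootApprox-lower : ∀ b q n → rootApprox b q n ≡ 0ℚ ⊎ rootApprox b q n ^ℚ b ℚ.≤ q
rootApprox-lower b q n = map₁
  (λ e → trans (cong (λ k → frac k n) e)
           (ℚ.≤-antisym (frac-mono 0 n 0 0 z≤n) (frac-nonneg 0 n)))
  (greatest-sat (λ k → frac k n ^ℚ b ℚ.≤? q) (suc n ℕ.* suc ℤ.∣ ↥ q ∣))

q≤^ : ∀ {q} b .{{_ : NonZero b}} → 1ℚ ℚ.≤ q → q ℚ.≤ q ^ℚ b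
q≤^ {q} (suc b) 1≤q = subst (ℚ._≤ q ^ℚ suc b) (ℚ.*-identityʳ q)
  (ℚ.*-monoˡ-≤-nonNeg q {{ℚ.nonNegative (ℚ.≤-trans (frac-nonneg 1 0) 1≤q)}} (1≤^ b))
  where
  1≤^ : ∀ b → 1ℚ ℚ.≤ q ^ℚ b
  1≤^ zero    = ℚ.≤-refl
  1≤^ (suc b) = subst (ℚ._≤ q ^ℚ suc b) (ℚ.*-identityʳ 1ℚ)
    (*-mono (frac-nonneg 1 0) 1≤q (frac-nonneg 1 0) (1≤^ b))

q<suc∣↥q∣ : ∀ q → q ℚ.< frac (suc ℤ.∣ ↥ q ∣) 0
q<suc∣↥q∣ q@(mkℚ z d c) = ℚ.≤-<-trans q≤ (subst (frac ℤ.∣ z ∣ 0 ℚ.<_) (sym (frac-suc ℤ.∣ z ∣ 0))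
    (subst (ℚ._< frac ℤ.∣ z ∣ 0 ℚ.+ 1ℚ) (ℚ.+-identityʳ _) (ℚ.+-monoʳ-< (frac ℤ.∣ z ∣ 0) 0<1ℚ)))
  where
  q≤ : q ℚ.≤ frac ℤ.∣ z ∣ 0
  q≤ = ℚ.≤-trans (p≤∣p∣ q) (subst (ℚ._≤ frac ℤ.∣ z ∣ 0) (ℚ.↥p/↧p≡p ℚ.∣ q ∣)
         (frac-mono ℤ.∣ z ∣ d ℤ.∣ z ∣ 0 (ℕ.*-monoʳ-≤ ℤ.∣ z ∣ (s≤s z≤n))))

^-exceeds : ∀ b .{{_ : NonZero b}} q n k → suc n ℕ.* suc ℤ.∣ ↥ q ∣ ℕ.≤ k → q ℚ.< frac k n ^ℚ b
^-exceeds b q n k l = ℚ.<-≤-trans (q<suc∣↥q∣ q) (ℚ.≤-trans M≤r (q≤^ b 1≤r))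
  where
  M = suc ℤ.∣ ↥ q ∣
  M≤r : frac M 0 ℚ.≤ frac k n
  M≤r = frac-mono M 0 k n
    (subst₂ ℕ._≤_ (ℕ.*-comm (suc n) M) (sym (ℕ.*-identityʳ k)) l)
  1≤r : 1ℚ ℚ.≤ frac k n
  1≤r = ℚ.≤-trans (frac-mono 1 0 M 0 (s≤s z≤n)) M≤r

greatest-next : ∀ {ℓ} {P : ℕ → Set ℓ} (P? : Decidable P) n →
                (∀ k → n ℕ.≤ k → ¬ P k) → ¬ P (suc (greatest P? n))
greatest-next P? n beyond p with ℕ.≤-<-connex (suc (greatest P? n)) n
... | inj₁ l = ℕ.<-irrefl refl (greatest-max P? n l p)
... | inj₂ l = beyond _ (ℕ.<⇒≤ l) p

rootApprox-upper : ∀ b .{{_ : NonZero b}} q n → q ℚ.< (rootApprox b q n ℚ.+ frac 1 n) ^ℚ b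
rootApprox-upper b q n = subst (λ r → q ℚ.< r ^ℚ b) (frac-suc (rootNumerator b q n) n)
  (ℚ.≰⇒> (greatest-next (λ k → frac k n ^ℚ b ℚ.≤? q) (suc n ℕ.* suc ℤ.∣ ↥ q ∣)
    λ k l h → ℚ.<-irrefl refl (ℚ.<-≤-trans (^-exceeds b q n k l) h)))

root-compare : ∀ b .{{_ : NonZero b}} {r s u p q η} →
  0ℚ ℚ.≤ s → 0ℚ ℚ.≤ u → u ℚ.≤ η →
  r ≡ 0ℚ ⊎ r ^ℚ b ℚ.≤ p → q ℚ.< (s ℚ.+ u) ^ℚ b → p ℚ.≤ q ℚ.+ η ^ℚ b →
  r ℚ.≤ s ℚ.+ (η ℚ.+ η)
root-compare b {r} {s} {u} {p} {q} {η} 0≤s 0≤u u≤η (inj₁ r≡0) _ _ =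
  subst (ℚ._≤ s ℚ.+ (η ℚ.+ η)) (sym r≡0)
    (ℚ.≤-trans 0≤s (≤-+ʳ (ℚ.≤-trans (ℚ.≤-trans 0≤u u≤η) (≤-+ʳ (ℚ.≤-trans 0≤u u≤η)))))
root-compare b {r} {s} {u} {p} {q} {η} 0≤s 0≤u u≤η (inj₂ lower) upper p≤q =
  ℚ.≮⇒≥ λ lt → ℚ.<-irrefl refl (begin-strict
    q ℚ.+ η ^ℚ b                  <⟨ ℚ.+-monoˡ-< (η ^ℚ b) upper ⟩
    (s ℚ.+ u) ^ℚ b ℚ.+ η ^ℚ b     ≤⟨ ^ℚ-superadd b 0≤su 0≤η ⟩
    (s ℚ.+ u ℚ.+ η) ^ℚ b          ≤⟨ ^ℚ-mono b (ℚ.≤-trans 0≤su (≤-+ʳ 0≤η)) (ℚ.≤-trans su+η≤ (ℚ.<⇒≤ lt)) ⟩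
    r ^ℚ b                        ≤⟨ lower ⟩
    p                             ≤⟨ p≤q ⟩
    q ℚ.+ η ^ℚ b                  ∎)
  where
  open ℚ.≤-Reasoning
  0≤η : 0ℚ ℚ.≤ η
  0≤η = ℚ.≤-trans 0≤u u≤η
  0≤su : 0ℚ ℚ.≤ s ℚ.+ u
  0≤su = ℚ.≤-trans 0≤s (≤-+ʳ 0≤u)
  su+η≤ : s ℚ.+ u ℚ.+ η ℚ.≤ s ℚ.+ (η ℚ.+ η)
  su+η≤ = ℚ.≤-trans (ℚ.+-monoˡ-≤ η (ℚ.+-monoʳ-≤ s u≤η)) (ℚ.≤-reflexive (ℚ.+-assoc s η η))

-- The b-th root of a nonnegative real (0 for a negative one).
root : (b : ℕ) .{{_ : NonZero b}} → ℝ → ℝ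
root b x = mkℝ (λ n → rootApprox b (seq x n) n) (one-sided⇒cauchy λ ε 0<ε →
  let N , h = archimedean (half-pos 0<ε)
      M , k = cauchy x ((½ ℚ.* ε) ^ℚ b) (^ℚ-pos b (half-pos 0<ε))
  in N ℕ.⊔ M , λ m n lm ln →
     subst (λ e → rootApprox b (seq x m) m ℚ.≤ rootApprox b (seq x n) n ℚ.+ e) (half-sum ε)
       (root-compare b
         (frac-nonneg (rootNumerator b (seq x n) n) n) (frac-nonneg 1 n)
         (h n (ℕ.m⊔n≤o⇒m≤o N M ln))
         (rootApprox-lower b (seq x m) m) (rootApprox-upper b (seq x n) n)
         (abs-elim (k m n (ℕ.m⊔n≤o⇒n≤o N M lm) (ℕ.m⊔n≤o⇒n≤o N M ln)))))

-- x ^⟨ a / b ⟩ is x^(a/b), for x ≥ 0.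
infix 9 _^⟨_/_⟩
_^⟨_/_⟩ : ℝ → (a b : ℕ) .{{_ : NonZero b}} → ℝ
x ^⟨ a / b ⟩ = root b (x ^ a)

fromℕ-pos : ∀ n .{{_ : NonZero n}} → 0ℝ < fromℕ n
fromℕ-pos (suc n) = 1ℚ , 0<1ℚ , 0 , λ _ _ → subst (ℚ._≤ frac (suc n) 0) (sym (ℚ.+-identityˡ 1ℚ))
                      (frac-mono 1 0 (suc n) 0 (s≤s z≤n))

^-pos : ∀ {x} n → 0ℝ < x → 0ℝ < x ^ n
^-pos zero _ = 1ℚ , 0<1ℚ , 0 , λ _ _ → ℚ.≤-reflexive (ℚ.+-identityˡ 1ℚ)
^-pos {x} (suc n) 0<x@(δ , 0<δ , N , h) with ^-pos {x} n 0<x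
... | η , 0<η , M , k = δ ℚ.* η , *-pos 0<δ 0<η , N ℕ.⊔ M , λ i l →
  subst (ℚ._≤ seq x i ℚ.* seq (x ^ n) i) (sym (ℚ.+-identityˡ (δ ℚ.* η)))
    (*-mono (ℚ.<⇒≤ 0<δ) (subst (ℚ._≤ seq x i) (ℚ.+-identityˡ δ) (h i (ℕ.m⊔n≤o⇒m≤o N M l)))
            (ℚ.<⇒≤ 0<η) (subst (ℚ._≤ seq (x ^ n) i) (ℚ.+-identityˡ η) (k i (ℕ.m⊔n≤o⇒n≤o N M l))))

root-lower-bound : ∀ b .{{_ : NonZero b}} {r u q δ κ} → 0ℚ ℚ.< κ → κ ℚ.≤ δ → κ ℚ.≤ 1ℚ →
  0ℚ ℚ.≤ r → 0ℚ ℚ.≤ u → u ℚ.≤ ½ ℚ.* κ → δ ℚ.≤ q → q ℚ.< (r ℚ.+ u) ^ℚ b → ½ ℚ.* κ ℚ.≤ r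
root-lower-bound (suc b) {r} {u} {q} {δ} {κ} 0<κ κ≤δ κ≤1 0≤r 0≤u u≤ δ≤q upper =
  ℚ.≮⇒≥ λ lt → ℚ.<-irrefl refl (begin-strict
    δ                                 ≤⟨ δ≤q ⟩
    q                                 <⟨ upper ⟩
    (r ℚ.+ u) ^ℚ suc b                ≤⟨ ^ℚ-mono (suc b) (ℚ.≤-trans 0≤r (≤-+ʳ 0≤u)) (ℚ.+-mono-≤ (ℚ.<⇒≤ lt) u≤) ⟩
    (½ ℚ.* κ ℚ.+ ½ ℚ.* κ) ^ℚ suc b    ≡⟨ cong (_^ℚ suc b) (half-sum κ) ⟩
    κ ℚ.* κ ^ℚ b                      ≤⟨ ℚ.*-monoˡ-≤-nonNeg κ {{ℚ.nonNegative 0≤κ}} (^≤1 b) ⟩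
    κ ℚ.* 1ℚ                          ≡⟨ ℚ.*-identityʳ κ ⟩
    κ                                 ≤⟨ κ≤δ ⟩
    δ                                 ∎)
  where
  open ℚ.≤-Reasoning
  0≤κ = ℚ.<⇒≤ 0<κ
  ^≤1 : ∀ n → κ ^ℚ n ℚ.≤ 1ℚ
  ^≤1 zero    = ℚ.≤-refl
  ^≤1 (suc n) = subst (κ ^ℚ suc n ℚ.≤_) (ℚ.*-identityʳ 1ℚ)
                  (*-mono 0≤κ κ≤1 (^ℚ-nonneg n 0≤κ) (^≤1 n))

⊓1-pos : ∀ {δ} → 0ℚ ℚ.< δ → 0ℚ ℚ.< δ ℚ.⊓ 1ℚ
⊓1-pos {δ} 0<δ =
  [ (λ e → subst (0ℚ ℚ.<_) (sym e) 0<δ) , (λ e → subst (0ℚ ℚ.<_) (sym e) 0<1ℚ) ]′ (ℚ.⊓-sel δ 1ℚ)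

root-pos : ∀ {x} b .{{_ : NonZero b}} → 0ℝ < x → 0ℝ < root b x
root-pos {x} b (δ , 0<δ , N , h) =
  let 0<κ   = ⊓1-pos 0<δ
      M , k = archimedean (half-pos 0<κ)
  in ½ ℚ.* (δ ℚ.⊓ 1ℚ) , half-pos 0<κ , N ℕ.⊔ M , λ n l →
     subst (ℚ._≤ rootApprox b (seq x n) n) (sym (ℚ.+-identityˡ (½ ℚ.* (δ ℚ.⊓ 1ℚ))))
       (root-lower-bound b 0<κ (ℚ.p⊓q≤p δ 1ℚ) (ℚ.p⊓q≤q δ 1ℚ)
         (frac-nonneg (rootNumerator b (seq x n) n) n) (frac-nonneg 1 n)
         (k n (ℕ.m⊔n≤o⇒n≤o N M l))
         (subst (ℚ._≤ seq x n) (ℚ.+-identityˡ δ) (h n (ℕ.m⊔n≤o⇒m≤o N M l)))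
         (rootApprox-upper b (seq x n) n))

^⟨/⟩-pos : ∀ {x} a b .{{_ : NonZero b}} → 0ℝ < x → 0ℝ < x ^⟨ a / b ⟩
^⟨/⟩-pos {x} a b 0<x = root-pos {x ^ a} b (^-pos {x} a 0<x)

-- 1 / (a + 1) + 1 / (a + 2) + ⋯ + 1 / (a + c)
harmonic : ℕ → ℕ → ℚ
harmonic a zero    = 0ℚ
harmonic a (suc c) = harmonic a c ℚ.+ frac 1 (a ℕ.+ c)

harmonic-++ : ∀ a c d → harmonic a (c ℕ.+ d) ≡ harmonic a c ℚ.+ harmonic (a ℕ.+ c) d
harmonic-++ a c zero = trans (cong (harmonic a) (ℕ.+-identityʳ c)) (sym (ℚ.+-identityʳ _))
harmonic-++ a c (suc d) = begin
  harmonic a (c ℕ.+ suc d)                                        ≡⟨ cong (harmonic a) (ℕ.+-suc c d) ⟩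
  harmonic a (c ℕ.+ d) ℚ.+ frac 1 (a ℕ.+ (c ℕ.+ d))               ≡⟨ cong₂ ℚ._+_ (harmonic-++ a c d)
                                                                       (cong (frac 1) (sym (ℕ.+-assoc a c d))) ⟩
  harmonic a c ℚ.+ harmonic (a ℕ.+ c) d ℚ.+ frac 1 (a ℕ.+ c ℕ.+ d) ≡⟨ ℚ.+-assoc (harmonic a c) _ _ ⟩
  harmonic a c ℚ.+ harmonic (a ℕ.+ c) (suc d)                     ∎
  where open ≡-Reasoning

multiple : ℕ → ℚ → ℚ
multiple zero    q = 0ℚ
multiple (suc c) q = multiple c q ℚ.+ q

multiple-frac : ∀ c n → multiple c (frac 1 n) ≡ frac c n
multiple-frac zero n = ℚ.≤-antisym (frac-nonneg 0 n) (frac-mono 0 n 0 0 z≤n)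
multiple-frac (suc c) n = trans (cong (ℚ._+ frac 1 n) (multiple-frac c n)) (sym (frac-suc c n))

harmonic-≥ : ∀ a c u → (∀ i → i ℕ.< c → u ℚ.≤ frac 1 (a ℕ.+ i)) → multiple c u ℚ.≤ harmonic a c
harmonic-≥ a zero    u h = ℚ.≤-refl
harmonic-≥ a (suc c) u h =
  ℚ.+-mono-≤ (harmonic-≥ a c u λ i l → h i (ℕ.<-trans l ℕ.≤-refl)) (h c ℕ.≤-refl)

harmonic-≤ : ∀ a c u → (∀ i → i ℕ.< c → frac 1 (a ℕ.+ i) ℚ.≤ u) → harmonic a c ℚ.≤ multiple c u
harmonic-≤ a zero    u h = ℚ.≤-refl
harmonic-≤ a (suc c) u h =
  ℚ.+-mono-≤ (harmonic-≤ a c u λ i l → h i (ℕ.<-trans l ℕ.≤-refl)) (h c ℕ.≤-refl)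

unit-antitone : ∀ {m n} → m ℕ.≤ n → frac 1 n ℚ.≤ frac 1 m
unit-antitone {m} {n} m≤n = frac-mono 1 n 1 m (ℕ.*-monoʳ-≤ 1 (s≤s m≤n))

block-≥ : ∀ k M' → frac 1 k ℚ.≤ harmonic (k ℕ.* suc M') (suc M')
block-≥ k M' = ℚ.≤-trans (frac-mono 1 k M e (ℕ.≤-reflexive eq))
  (ℚ.≤-trans (ℚ.≤-reflexive (sym (multiple-frac M e)))
    (harmonic-≥ (k ℕ.* M) M (frac 1 e) λ i l →
      unit-antitone (ℕ.≤-trans (ℕ.+-monoʳ-≤ (k ℕ.* M) (ℕ.≤-pred l)) (ℕ.≤-reflexive (ℕ.+-comm (k ℕ.* M) M')))))
  where
  M = suc M'
  e = M' ℕ.+ k ℕ.* M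
  eq : 1 ℕ.* (suc k ℕ.* M) ≡ M ℕ.* suc k
  eq = trans (ℕ.*-identityˡ _) (ℕ.*-comm (suc k) M)

block-≤ : ∀ k M' → harmonic (suc k ℕ.* suc M') (suc M') ℚ.≤ frac 1 k
block-≤ k M' = ℚ.≤-trans
  (harmonic-≤ (suc k ℕ.* M) M (frac 1 e) λ i l →
      unit-antitone (ℕ.≤-trans (ℕ.n≤1+n e) (ℕ.m≤m+n (suc e) i)))
  (ℚ.≤-trans (ℚ.≤-reflexive (multiple-frac M e)) (frac-mono M e 1 k (ℕ.≤-reflexive eq)))
  where
  M = suc M'
  e = M' ℕ.+ k ℕ.* M
  eq : M ℕ.* suc k ≡ 1 ℕ.* (suc k ℕ.* M)
  eq = trans (ℕ.*-comm M (suc k)) (sym (ℕ.*-identityˡ _))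

refine : ∀ a c M → harmonic (a ℕ.* M) (suc c ℕ.* M) ≡
         harmonic (a ℕ.* M) (c ℕ.* M) ℚ.+ harmonic ((a ℕ.+ c) ℕ.* M) M
refine a c M = begin
  harmonic (a ℕ.* M) (M ℕ.+ c ℕ.* M)  ≡⟨ cong (harmonic (a ℕ.* M)) (ℕ.+-comm M (c ℕ.* M)) ⟩
  harmonic (a ℕ.* M) (c ℕ.* M ℕ.+ M)  ≡⟨ harmonic-++ (a ℕ.* M) (c ℕ.* M) M ⟩
  harmonic (a ℕ.* M) (c ℕ.* M) ℚ.+ harmonic (a ℕ.* M ℕ.+ c ℕ.* M) M
    ≡⟨ cong (λ z → harmonic (a ℕ.* M) (c ℕ.* M) ℚ.+ harmonic z M) (sym (ℕ.*-distribʳ-+ M a c)) ⟩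
  harmonic (a ℕ.* M) (c ℕ.* M) ℚ.+ harmonic ((a ℕ.+ c) ℕ.* M) M ∎
  where open ≡-Reasoning

refine-≥ : ∀ a c M' → harmonic a c ℚ.≤ harmonic (a ℕ.* suc M') (c ℕ.* suc M')
refine-≥ a zero    M' = ℚ.≤-refl
refine-≥ a (suc c) M' = ℚ.≤-trans
  (ℚ.+-mono-≤ (refine-≥ a c M') (block-≥ (a ℕ.+ c) M'))
  (ℚ.≤-reflexive (sym (refine a c (suc M'))))

refine-≤ : ∀ a c M' → harmonic (suc a ℕ.* suc M') (c ℕ.* suc M') ℚ.+ frac 1 (a ℕ.+ c)
                      ℚ.≤ harmonic (suc a) c ℚ.+ frac 1 a
refine-≤ a zero    M' = ℚ.≤-reflexive (cong (λ z → 0ℚ ℚ.+ frac 1 z) (ℕ.+-identityʳ a))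
refine-≤ a (suc c) M' = begin
  H₁ ℚ.+ frac 1 (a ℕ.+ suc c)                     ≡⟨ cong₂ ℚ._+_ (refine (suc a) c (suc M')) (cong (frac 1) (ℕ.+-suc a c)) ⟩
  H₀ ℚ.+ blk ℚ.+ u                                ≤⟨ ℚ.+-monoˡ-≤ u (ℚ.+-monoʳ-≤ H₀ (block-≤ (a ℕ.+ c) M')) ⟩
  H₀ ℚ.+ frac 1 (a ℕ.+ c) ℚ.+ u                   ≤⟨ ℚ.+-monoˡ-≤ u (refine-≤ a c M') ⟩
  harmonic (suc a) c ℚ.+ frac 1 a ℚ.+ u           ≡⟨ RS.solve 3 (λ h f u → h RS.:+ f RS.:+ u RS.:= h RS.:+ u RS.:+ f)
                                                       refl (harmonic (suc a) c) (frac 1 a) u ⟩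
  harmonic (suc a) c ℚ.+ u ℚ.+ frac 1 a           ∎
  where
  open ℚ.≤-Reasoning
  H₁  = harmonic (suc a ℕ.* suc M') (suc c ℕ.* suc M')
  H₀  = harmonic (suc a ℕ.* suc M') (c ℕ.* suc M')
  blk = harmonic ((suc a ℕ.+ c) ℕ.* suc M') (suc M')
  u   = frac 1 (suc (a ℕ.+ c))

-- For m ≥ 1, log m = ∫₁ᵐ du/u, as the limit over N = n + 1 of the lower Riemann sums
-- of mesh 1/N, namely ∑_{N < k ≤ mN} 1/k.  The value at m = 0 is 0.
log : ℕ → ℝ
log m = mkℝ s (one-sided⇒cauchy go)
  where
  d = m ℕ.∸ 1
  s : ℕ → ℚ
  s n = harmonic (suc n) (d ℕ.* suc n)
  compare : ∀ i j → s i ℚ.≤ s j ℚ.+ frac 1 j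
  compare i j = begin
    harmonic (suc i) (d ℕ.* suc i)                          ≤⟨ refine-≥ (suc i) (d ℕ.* suc i) j ⟩
    harmonic (suc i ℕ.* suc j) (d ℕ.* suc i ℕ.* suc j)      ≡⟨ cong₂ harmonic (ℕ.*-comm (suc i) (suc j)) swap ⟩
    harmonic (suc j ℕ.* suc i) (d ℕ.* suc j ℕ.* suc i)      ≤⟨ ≤-+ʳ (frac-nonneg 1 (j ℕ.+ d ℕ.* suc j)) ⟩
    harmonic (suc j ℕ.* suc i) (d ℕ.* suc j ℕ.* suc i) ℚ.+ frac 1 (j ℕ.+ d ℕ.* suc j)
                                                            ≤⟨ refine-≤ j (d ℕ.* suc j) i ⟩
    harmonic (suc j) (d ℕ.* suc j) ℚ.+ frac 1 j             ∎
    where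
    open ℚ.≤-Reasoning
    swap : d ℕ.* suc i ℕ.* suc j ≡ d ℕ.* suc j ℕ.* suc i
    swap = trans (ℕ.*-assoc d (suc i) (suc j))
             (trans (cong (d ℕ.*_) (ℕ.*-comm (suc i) (suc j))) (sym (ℕ.*-assoc d (suc j) (suc i))))
  go : ∀ ε → 0ℚ ℚ.< ε → ∃ λ N → ∀ i j → N ℕ.≤ i → N ℕ.≤ j → s i ℚ.≤ s j ℚ.+ ε
  go ε 0<ε with archimedean 0<ε
  ... | N , h = N , λ i j _ N≤j → ℚ.≤-trans (compare i j) (ℚ.+-monoʳ-≤ (s j) (h j N≤j))

IsCeiling : ℝ → ℕ → Set
IsCeiling y T = y ≤ fromℕ T × fromℕ T < y + 1ℝ

data Boundary : Set where
  open-end closed-end : Boundary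

below : Boundary → ℝ → ℝ → Set
below open-end   x y = x < y
below closed-end x y = x ≤ y

record Interval : Set where
  field
    left right   : ℝ
    leftBoundary rightBoundary : Boundary
    left≤right   : left ≤ right

open Interval public

infix 4 _∈_ _⊆[_,_⟩

_∈_ : ℝ → Interval → Set
y ∈ J = below (leftBoundary J) (left J) y × below (rightBoundary J) y (right J)

∣_∣ : Interval → ℝ
∣ J ∣ = right J - left J

_⊆[_,_⟩ : Interval → ℝ → ℝ → Set
J ⊆[ a , b ⟩ = ∀ y → y ∈ J → a ≤ y × y < b

-- Integer polynomials as coefficient lists, constant term first; trailing
-- zeros are permitted.
ℤ[X] : Set
ℤ[X] = List ℤ

NonZeroPoly : ℤ[X] → Set
NonZeroPoly f = Any (_≢ + 0) f

eval : ℤ[X] → ℤ → ℤ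
eval []       z = + 0
eval (c ∷ cs) z = c ℤ.+ z ℤ.* eval cs z

shiftedFactorial : ℤ[X] → ℕ → ℤ
shiftedFactorial f n = + (n !) ℤ.+ eval f (+ n)

-- For p ≥ 2 and m ≠ 0, p ^ k ∣ m forces k < ∣ m ∣, so this is the exponent of
-- p in m.  The value at m = 0 is 0.
ord : ℕ → ℤ → ℕ
ord p m = greatest (λ k → p ℕ.^ k ∣? ℤ.∣ m ∣) ℤ.∣ m ∣

-- min[1‥ k ] a = min { a 1 , … , a k } for k ≥ 1; min[1‥ 0 ] a = 0.
min[1‥_] : ℕ → (ℕ → ℕ) → ℕ
min[1‥ 0 ]           a = 0
min[1‥ 1 ]           a = a 1
min[1‥ suc (suc k) ] a = min[1‥ suc k ] a ℕ.⊓ a (suc (suc k))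

sumFrom : ℕ → ℕ → (ℕ → ℕ) → ℕ
sumFrom lo zero    a = 0
sumFrom lo (suc c) a = a lo ℕ.+ sumFrom (suc lo) c a

∑[_‥_] : ℕ → ℕ → (ℕ → ℕ) → ℕ
∑[ lo ‥ hi ] a = sumFrom lo (suc hi ℕ.∸ lo) a

-- #{ n ∈ J : p ∣ n! + f(n) } ≤ C ∣J∣^(2/3) for all primes p and all intervals
-- J ⊆ [1,p) of length ≥ 1.  The cardinality bound says that every list of
-- distinct elements of the set is that short: membership of an integer in an
-- interval with real endpoints is not decidable.
CountBound : ℤ[X] → ℝ → Set
CountBound f C =
  (p : ℕ) → Prime p →
  (J : Interval) → J ⊆[ 1ℝ , fromℕ p ⟩ → 1ℝ ≤ ∣ J ∣ →
  (ns : List ℕ) → Unique ns →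
  All (λ n → fromℕ n ∈ J × + p ∣ shiftedFactorial f n) ns →
  fromℕ (length ns) ≤ C * ∣ J ∣ ^⟨ 2 / 3 ⟩

{-# OPTIONS --safe #-}
module Submission where

-- Sort the points n₁, …, n_t and consider the gaps between neighbours.  At most 2(t − t′) of them
-- have an end outside n₁, …, n_{t′}; hence for each t′ the shortest 2(t − t′) + MH + 1 gaps contain
-- MH + 1 gaps of this subset, two of which, (a , a + d] and (b , b + d + s], have nearly the same
-- length: M s ≤ G, where G is the longest length considered.  Since the index 2(t − t′) advances in
-- steps of two, the sum of G over t′ is at most half the sum of all gaps, which is where |J| / 2
-- comes from.
--
-- If pᵉ divides n! + f(n) at the four ends, then (a+d)! = (a+1)⋯(a+d) a! gives
--   pᵉ ∣ C(a+d , d) f(a) f(b+d+s) − C(b+d , d) (b+d+1)⋯(b+d+s) f(a+d) f(b),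
-- the common factor d! being prime to p.  As C(n , d) tˣ ≤ tᵈ (t + 1)ˣ for n ≤ x, a nonzero difference
-- yields pᵉ ≤ tᵈ (1 + 1/t)ˣ x^(s + O(1)).  The product over the at most t/2 values of t′ is the
-- exponential of the claim, with t^|J|/2 for the first term and x^(x / 2M) for the second.
--
-- The difference does not vanish when s = 0 and d exceeds a constant, as (a+1)⋯(a+d) then varies with
-- a more than f(a+d) / f(a) does, nor when s exceeds a multiple of log x, because the 2-adic valuation
-- of n! is n + O(log n).  Windows of H ≍ log x consecutive gaps therefore contain a good pair.  If t is too
-- small for that, H = 1 suffices: a vanishing difference with 0 ≤ s ≪ log x forces d ≪ √x log x by
-- size, and then the relation pᵉ ∣ (a+1)⋯(a+d) f(a) − f(a+d) of a single gap is good enough.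

-- The exponent 0.98 is 1 - 1/100 - 1/100. From t ≥ (10/ε₀)^100 it follows that ε₀t ≥ 10 t^0.99, and
-- even for the smallest t′ about ε₀t gaps remain after 2(t - t′) of them are given up. If a window
-- takes H ≤ t^0.01 gaps, then M ≥ t^0.98 / 2 windows fit; if windows of length ≍ log x are longer
-- than t^0.01, then t is less than a fixed power of log x. Cancelling d! is the essential gain. A
-- single gap only gives pᵉ ≤ x^(d + O(1)), which would put log x in place of log t. The products of
-- two gaps share the divisor d!, and what remains are binomial coefficients. Their bound τᵈ(1 +
-- 1/τ)ˣ holds for every τ; with τ = t the factors (1 + 1/t)ˣ, at most t/2 in number, multiply to at
-- most 2ˣ. The factors x^O(1), one for each t′, multiply to exp(O(t log x)), which is exp(O(x))
-- because t ≪ x^(2/3). All of this is done with products of natural numbers; real numbers enter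
-- only when a logarithm is taken at the end.

-- Elementary inequalities for powers and binomial coefficients

module Arithmetic where

  open import Data.Nat.Base
  open import Data.Nat.Properties
  open import Data.Nat.Combinatorics using (_C_; nCk+nC[k+1]≡[n+1]C[k+1])
  open import Data.Nat.Tactic.RingSolver using (solve-∀)
  open import Data.Product.Base using (∃; _×_; _,_)
  open import Data.Sum.Base using (inj₁; inj₂)
  open import Relation.Binary.PropositionalEquality

  ^-distribʳ-* : ∀ k m n → (m * n) ^ k ≡ m ^ k * n ^ k
  ^-distribʳ-* zero    m n = refl
  ^-distribʳ-* (suc k) m n = trans (cong (m * n *_) (^-distribʳ-* k m n)) (interchange m n (m ^ k) (n ^ k))
    where
    interchange : ∀ a b c d → a * b * (c * d) ≡ a * c * (b * d)
    interchange = solve-∀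

  ^-cancelˡ-≤ : ∀ k .{{_ : NonZero k}} {m n} → m ^ k ≤ n ^ k → m ≤ n
  ^-cancelˡ-≤ k h = ≮⇒≥ λ n<m → <⇒≱ (^-monoˡ-< k n<m) h

  -- Bernoulli's inequality (1 + y/x)ᵏ ≥ 1 + ky/x, multiplied by x^(k+1) to avoid division.
  bernoulli : ∀ x y k → x ^ k * (x + k * y) ≤ x * (x + y) ^ k
  bernoulli x y zero    = ≤-reflexive (base x)
    where
    base : ∀ x → 1 * (x + 0) ≡ x * 1
    base = solve-∀
  bernoulli x y (suc k) = begin
    x * x ^ k * (x + suc k * y)                  ≤⟨ m≤m+n _ (x ^ k * (k * y * y)) ⟩
    x * x ^ k * (x + suc k * y) + x ^ k * (k * y * y) ≡⟨ rearrange x y k (x ^ k) ⟩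
    (x + y) * (x ^ k * (x + k * y))              ≤⟨ *-monoʳ-≤ (x + y) (bernoulli x y k) ⟩
    (x + y) * (x * (x + y) ^ k)                  ≡⟨ swap (x + y) x ((x + y) ^ k) ⟩
    x * ((x + y) * (x + y) ^ k)                  ∎
    where
    open ≤-Reasoning
    rearrange : ∀ x y k p → x * p * (x + (1 + k) * y) + p * (k * y * y) ≡ (x + y) * (p * (x + k * y))
    rearrange = solve-∀
    swap : ∀ a b c → a * (b * c) ≡ b * (a * c)
    swap = solve-∀

  -- This is (1 + 1/t)ʲ ≤ 1/(1 - j/t) with k = t - j. Each step of the induction uses (t + 1)k ≤ t(k
  -- + 1), that is, k ≤ t.
  suc^-bound : ∀ t j k → j + k ≡ t → suc t ^ j * k ≤ t ^ j * t
  suc^-bound t zero    k eq = *-monoʳ-≤ 1 (≤-reflexive eq)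
  suc^-bound t (suc j) k eq = begin
    suc t * suc t ^ j * k        ≡⟨ swap (suc t) (suc t ^ j) k ⟩
    suc t ^ j * (k + t * k)      ≤⟨ *-monoʳ-≤ (suc t ^ j) (+-monoˡ-≤ (t * k) k≤t) ⟩
    suc t ^ j * (t + t * k)      ≡⟨ collect (suc t ^ j) t k ⟩
    t * (suc t ^ j * suc k)      ≤⟨ *-monoʳ-≤ t (suc^-bound t j (suc k) (trans (+-suc j k) eq)) ⟩
    t * (t ^ j * t)              ≡⟨ *-assoc t (t ^ j) t ⟨
    t * t ^ j * t                ∎
    where
    open ≤-Reasoning
    k≤t : k ≤ t
    k≤t = subst (k ≤_) eq (m≤n+m k (suc j))
    swap : ∀ a b c → a * b * c ≡ b * (a * c)
    swap = solve-∀
    collect : ∀ a t k → a * (t + t * k) ≡ t * (a * (1 + k))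
    collect = solve-∀

  suc^≤2*^ : ∀ t N .{{_ : NonZero t}} → 2 * N ≤ t → suc t ^ N ≤ 2 * t ^ N
  suc^≤2*^ t N 2N≤t = *-cancelʳ-≤ _ _ k {{>-nonZero 0<k}} (begin
    suc t ^ N * k        ≤⟨ suc^-bound t N k N+k≡t ⟩
    t ^ N * t            ≤⟨ *-monoʳ-≤ (t ^ N) t≤2k ⟩
    t ^ N * (2 * k)      ≡⟨ swap (t ^ N) k ⟩
    2 * t ^ N * k        ∎)
    where
    open ≤-Reasoning
    k = t ∸ N
    N≤t : N ≤ t
    N≤t = ≤-trans (m≤m+n N (N + 0)) 2N≤t
    N+k≡t : N + k ≡ t
    N+k≡t = m+[n∸m]≡n N≤t
    t≤2k : t ≤ 2 * k
    t≤2k = +-cancelˡ-≤ t t (2 * k) (begin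
      t + t                ≡⟨ cong₂ _+_ N+k≡t N+k≡t ⟨
      (N + k) + (N + k)    ≡⟨ regroup N k ⟩
      2 * N + 2 * k        ≤⟨ +-monoˡ-≤ (2 * k) 2N≤t ⟩
      t + 2 * k            ∎)
      where
      regroup : ∀ N k → (N + k) + (N + k) ≡ 2 * N + 2 * k
      regroup = solve-∀
    0<k : 0 < k
    0<k = *-cancelˡ-< 2 0 k (<-≤-trans (>-nonZero⁻¹ t) t≤2k)
    swap : ∀ a k → a * (2 * k) ≡ 2 * a * k
    swap = solve-∀

  -- One term of the binomial expansion of (t + 1)ⁿ.
  C*t^n≤ : ∀ t n k → (n C k) * t ^ n ≤ t ^ k * suc t ^ n
  C*t^n≤ t zero    zero    = ≤-refl
  C*t^n≤ t zero    (suc k) = z≤n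
  C*t^n≤ t (suc n) zero    = *-monoʳ-≤ 1 (^-monoˡ-≤ (suc n) (n≤1+n t))
  C*t^n≤ t (suc n) (suc k) = begin
    (suc n C suc k) * (t * t ^ n)                            ≡⟨ cong (_* (t * t ^ n)) (sym (nCk+nC[k+1]≡[n+1]C[k+1] n k)) ⟩
    ((n C k) + (n C suc k)) * (t * t ^ n)                    ≡⟨ expand (n C k) (n C suc k) t (t ^ n) ⟩
    t * ((n C k) * t ^ n) + t * ((n C suc k) * t ^ n)        ≤⟨ +-mono-≤ (*-monoʳ-≤ t (C*t^n≤ t n k)) (*-monoʳ-≤ t (C*t^n≤ t n (suc k))) ⟩
    t * (t ^ k * suc t ^ n) + t * (t * t ^ k * suc t ^ n)    ≡⟨ collect t (t ^ k) (suc t ^ n) ⟩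
    t * t ^ k * (suc t * suc t ^ n)                          ∎
    where
    open ≤-Reasoning
    expand : ∀ a b t p → (a + b) * (t * p) ≡ t * (a * p) + t * (b * p)
    expand = solve-∀
    collect : ∀ t p q → t * (p * q) + t * (t * p * q) ≡ t * p * ((1 + t) * q)
    collect = solve-∀

  n<2^n : ∀ n → n < 2 ^ n
  n<2^n zero    = s≤s z≤n
  n<2^n (suc n) = begin-strict
    suc n            <⟨ +-mono-≤-< (m^n>0 2 n) (n<2^n n) ⟩
    2 ^ n + 2 ^ n    ≡⟨ cong (2 ^ n +_) (+-identityʳ (2 ^ n)) ⟨
    2 * 2 ^ n        ∎
    where open ≤-Reasoning

  -- With q = ⌊L/2⌋ one has L ≤ 3q and 2ᴸ ≥ 2^q · 2^q. By induction one factor 2^q absorbs q to the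
  -- power k with the enlarged constant, and the other absorbs the last factor q.
  polynomial≤2^ : ∀ k c → ∃ λ N → ∀ L → N ≤ L → c * L ^ k ≤ 2 ^ L
  polynomial≤2^ zero    c = c , λ L c≤L → begin
    c * 1    ≡⟨ *-identityʳ c ⟩
    c        ≤⟨ c≤L ⟩
    L        <⟨ n<2^n L ⟩
    2 ^ L    ∎
    where open ≤-Reasoning
  polynomial≤2^ (suc k) c with polynomial≤2^ k (c * 3 ^ suc k)
  ... | N , h = suc (2 * suc N) , λ L N≤L → let q = ⌊ L /2⌋ ; 1+N≤q = half-bound L N≤L in begin
    c * L ^ suc k                      ≤⟨ *-monoʳ-≤ c (^-monoˡ-≤ (suc k) (≤-trans (split L) (3q q (≤-trans (s≤s z≤n) 1+N≤q)))) ⟩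
    c * (3 * q) ^ suc k                ≡⟨ cong (c *_) (^-distribʳ-* (suc k) 3 q) ⟩
    c * (3 ^ suc k * q ^ suc k)        ≡⟨ regroup c (3 ^ suc k) q (q ^ k) ⟩
    c * 3 ^ suc k * q ^ k * q          ≤⟨ *-mono-≤ (h q (≤-trans (n≤1+n N) 1+N≤q)) (<⇒≤ (n<2^n q)) ⟩
    2 ^ q * 2 ^ q                      ≡⟨ ^-distribˡ-+-* 2 q q ⟨
    2 ^ (q + q)                        ≤⟨ ^-monoʳ-≤ 2 (double L) ⟩
    2 ^ L                              ∎
    where
    open ≤-Reasoning
    regroup : ∀ c a q p → c * (a * (q * p)) ≡ c * a * p * q
    regroup = solve-∀
    split : ∀ L → L ≤ suc (⌊ L /2⌋ + ⌊ L /2⌋)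
    split zero          = z≤n
    split (suc zero)    = ≤-refl
    split (suc (suc L)) = s≤s (s≤s (≤-trans (split L) (≤-reflexive (sym (+-suc _ _)))))
    double : ∀ L → ⌊ L /2⌋ + ⌊ L /2⌋ ≤ L
    double zero          = z≤n
    double (suc zero)    = z≤n
    double (suc (suc L)) = s≤s (≤-trans (≤-reflexive (+-suc _ _)) (s≤s (double L)))
    3q : ∀ q → 1 ≤ q → suc (q + q) ≤ 3 * q
    3q q 1≤q = ≤-trans (+-monoˡ-≤ (q + q) 1≤q) (≤-reflexive (triple q))
      where
      triple : ∀ q → q + (q + q) ≡ 3 * q
      triple = solve-∀
    half-bound : ∀ L → suc (2 * suc N) ≤ L → suc N ≤ ⌊ L /2⌋
    half-bound L l = *-cancelˡ-≤ 2 (≤-pred (≤-trans l (≤-trans (split L) (≤-reflexive (cong suc (twice ⌊ L /2⌋))))))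
      where
      twice : ∀ q → q + q ≡ 2 * q
      twice = solve-∀

  -- L replaces log₂ x. Because 2ᴸ ≤ 2x, a bound by 2ᴸ is also a bound by a multiple of x, so
  -- polynomials in L are at most x for large x.
  bit-length : ∀ x .{{_ : NonZero x}} → ∃ λ L → x < 2 ^ L × 2 ^ L ≤ 2 * x
  bit-length (suc zero)          = 1 , ≤-refl , ≤-refl
  bit-length (suc x@(suc _)) with bit-length x
  ... | L , x<2^L , 2^L≤2x with m≤n⇒m<n∨m≡n x<2^L
  ...   | inj₁ 1+x<2^L = L , 1+x<2^L , ≤-trans 2^L≤2x (*-monoʳ-≤ 2 (n≤1+n x))
  ...   | inj₂ 1+x≡2^L = suc L , subst (suc x <_) (cong (2 *_) 1+x≡2^L) (m<m+n (suc x) (s≤s z≤n))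
                               , ≤-reflexive (cong (2 *_) (sym 1+x≡2^L))

-- Growth of f at large arguments

module PolynomialGrowth where

  open import Defs using (ℤ[X]; NonZeroPoly; eval)
  open import Data.Nat.Base
  open import Data.Nat.Properties
  open import Data.Integer.Base as ℤ using (ℤ; +_; ∣_∣)
  import Data.Integer.Properties as ℤ
  import Data.Integer.Tactic.RingSolver as ℤ-Solver
  open import Data.Nat.Tactic.RingSolver using (solve-∀)
  open import Data.List.Base using ([]; _∷_)
  open import Data.List.Relation.Unary.All as All using (All; []; _∷_)
  open import Data.List.Relation.Unary.All.Properties using (All¬⇒¬Any)
  open import Data.Sum.Base using (_⊎_; inj₁; inj₂)
  open import Relation.Nullary using (yes; no; contradiction)
  open import Relation.Binary.PropositionalEquality

  evalℕ : ℤ[X] → ℕ → ℤ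
  evalℕ f n = eval f (+ n)

  -- The Lipschitz bound is the estimate O(m^(degree - 1)) for the derivative, with m = n + d,
  -- multiplied by m so that degree 0 needs no separate form. It controls how far f(a + d) / f(a) is
  -- from 1 when two gaps of equal length are compared.
  record Growth (f : ℤ[X]) : Set where
    field
      degree scale threshold : ℕ
      lower     : ∀ n → threshold ≤ n → n ^ degree ≤ scale * ∣ evalℕ f n ∣
      upper     : ∀ n → threshold ≤ n → ∣ evalℕ f n ∣ ≤ scale * n ^ degree
      lipschitz : ∀ n d → threshold ≤ n →
                  (n + d) * ∣ evalℕ f (n + d) ℤ.- evalℕ f n ∣ ≤ scale * d * (n + d) ^ degree

  private
    eval-zeros : ∀ {f} → All (_≡ + 0) f → ∀ z → eval f z ≡ + 0
    eval-zeros []          z = refl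
    eval-zeros (refl ∷ zs) z = trans (cong (λ e → + 0 ℤ.+ z ℤ.* e) (eval-zeros zs z))
                                     (trans (ℤ.+-identityˡ _) (ℤ.*-zeroʳ z))

    constant-growth : ∀ {c cs} → c ≢ + 0 → All (_≡ + 0) cs → Growth (c ∷ cs)
    constant-growth {c} {cs} c≢0 zs = record
      { degree    = 0
      ; scale     = ∣ c ∣
      ; threshold = 0
      ; lower     = λ n _ → subst (λ e → 1 ≤ ∣ c ∣ * ∣ e ∣) (sym (const n)) (*-mono-≤ 1≤∣c∣ 1≤∣c∣)
      ; upper     = λ n _ → subst (λ e → ∣ e ∣ ≤ ∣ c ∣ * 1) (sym (const n)) (≤-reflexive (sym (*-identityʳ ∣ c ∣)))
      ; lipschitz = λ n d _ → subst (_≤ ∣ c ∣ * d * 1)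
          (sym (trans (cong (λ e → (n + d) * ∣ e ∣) (ℤ.i≡j⇒i-j≡0 {evalℕ (c ∷ cs) (n + d)} {evalℕ (c ∷ cs) n}
                 (trans (const (n + d)) (sym (const n))))) (*-zeroʳ (n + d)))) z≤n
      }
      where
      const : ∀ n → evalℕ (c ∷ cs) n ≡ c
      const n = trans (cong (λ e → c ℤ.+ + n ℤ.* e) (eval-zeros zs (+ n)))
                      (trans (cong (λ e → c ℤ.+ e) (ℤ.*-zeroʳ (+ n))) (ℤ.+-identityʳ c))
      1≤∣c∣ : 1 ≤ ∣ c ∣
      1≤∣c∣ = n≢0⇒n>0 (λ e → c≢0 (ℤ.∣i∣≡0⇒i≡0 e))

    -- A Horner step c + X f(X). Beyond the new threshold 2Q∣c∣ ≤ n, so c can cancel at most half of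
    -- the lower bound for n ∣f(n)∣.
    cons-growth : ∀ c {f} → Growth f → Growth (c ∷ f)
    cons-growth c {f} g = record
      { degree    = suc D
      ; scale     = Q₁
      ; threshold = N₁
      ; lower     = low
      ; upper     = up
      ; lipschitz = lip
      }
      where
      open Growth g renaming (degree to D; scale to Q; threshold to N)
      Q₁ = 2 * Q + ∣ c ∣
      N₁ = N + suc (2 * Q * ∣ c ∣)
      F = evalℕ (c ∷ f)
      module _ {n : ℕ} (N₁≤n : N₁ ≤ n) where
        N≤n : N ≤ n
        N≤n = ≤-trans (m≤m+n N _) N₁≤n
        1≤n : 1 ≤ n
        1≤n = ≤-trans (≤-trans (s≤s z≤n) (m≤n+m _ N)) N₁≤n
        2Qc≤n : 2 * Q * ∣ c ∣ ≤ n
        2Qc≤n = ≤-trans (n≤1+n _) (≤-trans (m≤n+m _ N) N₁≤n)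
        n≤n^ : n ≤ n ^ suc D
        n≤n^ = m≤m*n n (n ^ D) {{m^n≢0 n D {{>-nonZero 1≤n}}}}
      open ≤-Reasoning
      low : ∀ n → N₁ ≤ n → n ^ suc D ≤ Q₁ * ∣ F n ∣
      low n l = +-cancelʳ-≤ (n ^ suc D) (n ^ suc D) (Q₁ * ∣ F n ∣) (begin
        n * n ^ D + n * n ^ D                            ≡⟨ double (n * n ^ D) ⟩
        2 * (n * n ^ D)                                  ≤⟨ *-monoʳ-≤ 2 (*-monoʳ-≤ n (lower n (N≤n l))) ⟩
        2 * (n * (Q * ∣ e ∣))                            ≡⟨ regroup n Q ∣ e ∣ ⟩
        2 * Q * (n * ∣ e ∣)                              ≡⟨ cong (2 * Q *_) (ℤ.abs-* (+ n) e) ⟨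
        2 * Q * ∣ + n ℤ.* e ∣                            ≤⟨ *-monoʳ-≤ (2 * Q) tail≤ ⟩
        2 * Q * (∣ F n ∣ + ∣ c ∣)                        ≡⟨ *-distribˡ-+ (2 * Q) ∣ F n ∣ ∣ c ∣ ⟩
        2 * Q * ∣ F n ∣ + 2 * Q * ∣ c ∣                  ≤⟨ +-mono-≤ (*-monoˡ-≤ ∣ F n ∣ (m≤m+n (2 * Q) ∣ c ∣)) (≤-trans (2Qc≤n l) (n≤n^ l)) ⟩
        Q₁ * ∣ F n ∣ + n ^ suc D                         ∎)
        where
        e = evalℕ f n
        double : ∀ a → a + a ≡ 2 * a
        double = solve-∀
        regroup : ∀ n Q e → 2 * (n * (Q * e)) ≡ 2 * Q * (n * e)
        regroup = solve-∀
        cancel : ∀ c y → y ≡ c ℤ.+ y ℤ.- c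
        cancel = ℤ-Solver.solve-∀
        tail≤ : ∣ + n ℤ.* e ∣ ≤ ∣ F n ∣ + ∣ c ∣
        tail≤ = begin
          ∣ + n ℤ.* e ∣               ≡⟨ cong ∣_∣ (cancel c (+ n ℤ.* e)) ⟩
          ∣ F n ℤ.- c ∣               ≤⟨ ℤ.∣i-j∣≤∣i∣+∣j∣ (F n) c ⟩
          ∣ F n ∣ + ∣ c ∣             ∎
      up : ∀ n → N₁ ≤ n → ∣ F n ∣ ≤ Q₁ * n ^ suc D
      up n l = begin
        ∣ c ℤ.+ + n ℤ.* e ∣                       ≤⟨ ℤ.∣i+j∣≤∣i∣+∣j∣ c (+ n ℤ.* e) ⟩
        ∣ c ∣ + ∣ + n ℤ.* e ∣                     ≡⟨ cong (λ e → ∣ c ∣ + e) (ℤ.abs-* (+ n) e) ⟩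
        ∣ c ∣ + n * ∣ e ∣                         ≤⟨ +-mono-≤ (m≤m*n ∣ c ∣ (n ^ suc D) {{m^n≢0 n (suc D) {{>-nonZero (1≤n l)}}}})
                                                             (*-monoʳ-≤ n (upper n (N≤n l))) ⟩
        ∣ c ∣ * (n * n ^ D) + n * (Q * n ^ D)     ≤⟨ m≤m+n _ (Q * (n * n ^ D)) ⟩
        ∣ c ∣ * (n * n ^ D) + n * (Q * n ^ D) + Q * (n * n ^ D) ≡⟨ collect ∣ c ∣ Q n (n ^ D) ⟩
        Q₁ * n ^ suc D                            ∎
        where
        e = evalℕ f n
        collect : ∀ c Q n p → c * (n * p) + n * (Q * p) + Q * (n * p) ≡ (2 * Q + c) * (n * p)
        collect = solve-∀
      lip : ∀ n d → N₁ ≤ n → (n + d) * ∣ F (n + d) ℤ.- F n ∣ ≤ Q₁ * d * (n + d) ^ suc D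
      lip n d l = begin
        m * ∣ F m ℤ.- F n ∣                                 ≡⟨ cong (λ z → m * ∣ z ∣) (difference (+ n) (+ d) c e′ e) ⟩
        m * ∣ + d ℤ.* e′ ℤ.+ + n ℤ.* (e′ ℤ.- e) ∣           ≤⟨ *-monoʳ-≤ m (ℤ.∣i+j∣≤∣i∣+∣j∣ (+ d ℤ.* e′) _) ⟩
        m * (∣ + d ℤ.* e′ ∣ + ∣ + n ℤ.* (e′ ℤ.- e) ∣)       ≡⟨ cong (m *_) (cong₂ _+_ (ℤ.abs-* (+ d) e′) (ℤ.abs-* (+ n) (e′ ℤ.- e))) ⟩
        m * (d * ∣ e′ ∣ + n * ∣ e′ ℤ.- e ∣)                 ≡⟨ distribute m d n ∣ e′ ∣ ∣ e′ ℤ.- e ∣ ⟩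
        m * d * ∣ e′ ∣ + n * (m * ∣ e′ ℤ.- e ∣)             ≤⟨ +-mono-≤ (*-monoʳ-≤ (m * d) (upper m (≤-trans (N≤n l) (m≤m+n n d))))
                                                                         (*-mono-≤ (m≤m+n n d) (lipschitz n d (N≤n l))) ⟩
        m * d * (Q * m ^ D) + m * (Q * d * m ^ D)           ≤⟨ m≤m+n _ (∣ c ∣ * d * (m * m ^ D)) ⟩
        m * d * (Q * m ^ D) + m * (Q * d * m ^ D) + ∣ c ∣ * d * (m * m ^ D) ≡⟨ collect ∣ c ∣ Q m d (m ^ D) ⟩
        Q₁ * d * m ^ suc D                                  ∎
        where
        m = n + d
        e  = evalℕ f n
        e′ = evalℕ f m
        difference : ∀ n d c e′ e → c ℤ.+ (n ℤ.+ d) ℤ.* e′ ℤ.- (c ℤ.+ n ℤ.* e) ≡ d ℤ.* e′ ℤ.+ n ℤ.* (e′ ℤ.- e)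
        difference = ℤ-Solver.solve-∀
        distribute : ∀ m d n a b → m * (d * a + n * b) ≡ m * d * a + n * (m * b)
        distribute = solve-∀
        collect : ∀ c Q m d p → m * d * (Q * p) + m * (Q * d * p) + c * d * (m * p) ≡ (2 * Q + c) * d * (m * p)
        collect = solve-∀

    -- The list may end in zeros, so the leading coefficient is found from the far end: the zero
    -- case is carried along until a nonzero coefficient appears.
    zero-or-growth : ∀ f → All (_≡ + 0) f ⊎ Growth f
    zero-or-growth []      = inj₁ []
    zero-or-growth (c ∷ f) with zero-or-growth f | c ℤ.≟ + 0
    ... | inj₁ zs | yes c≡0 = inj₁ (c≡0 ∷ zs)
    ... | inj₁ zs | no  c≢0 = inj₂ (constant-growth c≢0 zs)
    ... | inj₂ g  | _       = inj₂ (cons-growth c g)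

  growth : ∀ f → NonZeroPoly f → Growth f
  growth f f≢0 with zero-or-growth f
  ... | inj₁ zs = contradiction f≢0 (All¬⇒¬Any (All.map (λ z≡0 z≢0 → z≢0 z≡0) zs))
  ... | inj₂ g  = g

-- Products of consecutive integers and the 2-adic valuation of factorials

module RisingFactorials where

  open import Data.Nat.Base
  open import Data.Nat.Properties
  open import Data.Nat.DivMod using (m/n*n≡m)
  open import Data.Nat.Divisibility
  open import Data.Nat.Primality using (Prime; euclidsLemma; prime[2]; prime⇒nonZero; prime⇒nonTrivial)
  open import Data.Nat.Combinatorics using (_C_; nCk≡n!/k![n-k]!; k![n∸k]!∣n!)
  open import Data.Nat.Tactic.RingSolver using (solve-∀)
  open import Data.Product.Base using (∃; _×_; _,_)
  open import Data.Sum.Base using (_⊎_; inj₁; inj₂)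
  open import Relation.Nullary using (¬_; contradiction)
  open import Relation.Binary.PropositionalEquality
  open Arithmetic

  rise : ℕ → ℕ → ℕ
  rise a zero    = 1
  rise a (suc d) = rise a d * suc (a + d)

  rise-! : ∀ a d → rise a d * a ! ≡ (a + d) !
  rise-! a zero    = trans (*-identityˡ (a !)) (cong _! (sym (+-identityʳ a)))
  rise-! a (suc d) = begin
    rise a d * suc (a + d) * a !      ≡⟨ swap (rise a d) (suc (a + d)) (a !) ⟩
    suc (a + d) * (rise a d * a !)    ≡⟨ cong (suc (a + d) *_) (rise-! a d) ⟩
    suc (a + d) !                     ≡⟨ cong _! (+-suc a d) ⟨
    (a + suc d) !                     ∎
    where
    open ≡-Reasoning
    swap : ∀ p q r → p * q * r ≡ q * (p * r)
    swap = solve-∀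

  rise-+ : ∀ a d s → rise a (d + s) ≡ rise a d * rise (a + d) s
  rise-+ a d zero    = trans (cong (rise a) (+-identityʳ d)) (sym (*-identityʳ (rise a d)))
  rise-+ a d (suc s) = begin
    rise a (d + suc s)                              ≡⟨ cong (rise a) (+-suc d s) ⟩
    rise a (d + s) * suc (a + (d + s))              ≡⟨ cong₂ _*_ (rise-+ a d s) (cong suc (sym (+-assoc a d s))) ⟩
    rise a d * rise (a + d) s * suc (a + d + s)     ≡⟨ *-assoc (rise a d) _ _ ⟩
    rise a d * rise (a + d) (suc s)                 ∎
    where open ≡-Reasoning

  rise-nonZero : ∀ a d → NonZero (rise a d)
  rise-nonZero a zero    = _
  rise-nonZero a (suc d) = m*n≢0 (rise a d) _ {{rise-nonZero a d}}

  rise≤^ : ∀ {x} a d → a + d ≤ x → rise a d ≤ x ^ d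
  rise≤^ a zero    _ = ≤-refl
  rise≤^ {x} a (suc d) a+1+d≤x = begin
    rise a d * suc (a + d)    ≤⟨ *-mono-≤ (rise≤^ a d (≤-trans (n≤1+n _) l)) l ⟩
    x ^ d * x                 ≡⟨ *-comm (x ^ d) x ⟩
    x * x ^ d                 ∎
    where
    open ≤-Reasoning
    l : suc (a + d) ≤ x
    l = subst (_≤ x) (+-suc a d) a+1+d≤x

  C*!≡rise : ∀ a d → ((a + d) C d) * d ! ≡ rise a d
  C*!≡rise a d = *-cancelʳ-≡ _ _ (a !) {{a !≢0}} (begin
    ((a + d) C d) * d ! * a !                       ≡⟨ *-assoc ((a + d) C d) _ _ ⟩
    ((a + d) C d) * (d ! * a !)                     ≡⟨ cong (λ k → ((a + d) C d) * (d ! * k !)) (m+n∸n≡m a d) ⟨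
    ((a + d) C d) * (d ! * (a + d ∸ d) !)           ≡⟨ cong (_* (d ! * (a + d ∸ d) !)) (nCk≡n!/k![n-k]! d≤a+d) ⟩
    ((a + d) ! / (d ! * (a + d ∸ d) !)) * (d ! * (a + d ∸ d) !) ≡⟨ m/n*n≡m (k![n∸k]!∣n! d≤a+d) ⟩
    (a + d) !                                       ≡⟨ rise-! a d ⟨
    rise a d * a !                                  ∎)
    where
    open ≡-Reasoning
    d≤a+d = m≤n+m d a
    instance
      nz : NonZero (d ! * (a + d ∸ d) !)
      nz = d !* (a + d ∸ d) !≢0

  -- Factor by factor, (a + i)/(b + i) ≥ 1 + g/(b + i) ≥ 1 + g/x for 1 ≤ i ≤ d: a shift by g
  -- multiplies the product by at least (1 + g/x)ᵈ.
  rise-compare : ∀ {x a b g} d → b + g ≤ a → b + d ≤ x → rise b d * (x + g) ^ d ≤ rise a d * x ^ d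
  rise-compare zero _ _ = ≤-refl
  rise-compare {x} {a} {b} {g} (suc d) b+g≤a b+1+d≤x = begin
    rise b d * suc (b + d) * ((x + g) * (x + g) ^ d)      ≡⟨ interchange (rise b d) _ _ _ ⟩
    rise b d * (x + g) ^ d * (suc (b + d) * (x + g))      ≤⟨ *-mono-≤ (rise-compare d b+g≤a (≤-trans (n≤1+n _) l)) factor ⟩
    rise a d * x ^ d * (suc (a + d) * x)                  ≡⟨ interchange (rise a d) _ _ _ ⟨
    rise a d * suc (a + d) * (x * x ^ d)                  ∎
    where
    open ≤-Reasoning
    l : suc (b + d) ≤ x
    l = subst (_≤ x) (+-suc b d) b+1+d≤x
    interchange : ∀ p q r s → p * q * (r * s) ≡ p * s * (q * r)
    interchange = solve-∀
    factor : suc (b + d) * (x + g) ≤ suc (a + d) * x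
    factor = begin
      suc (b + d) * (x + g)            ≡⟨ *-distribˡ-+ (suc (b + d)) x g ⟩
      suc (b + d) * x + suc (b + d) * g ≤⟨ +-monoʳ-≤ (suc (b + d) * x) (*-monoˡ-≤ g l) ⟩
      suc (b + d) * x + x * g          ≡⟨ collect b d x g ⟩
      suc (b + g + d) * x              ≤⟨ *-monoˡ-≤ x (s≤s (+-monoˡ-≤ d b+g≤a)) ⟩
      suc (a + d) * x                  ∎
      where
      collect : ∀ b d x g → (1 + (b + d)) * x + x * g ≡ (1 + (b + g + d)) * x
      collect = solve-∀

  prime-power-cancelˡ : ∀ {p c z} e → Prime p → ¬ p ∣ c → p ^ e ∣ c * z → p ^ e ∣ z
  prime-power-cancelˡ zero    _  _   _ = 1∣ _
  prime-power-cancelˡ {p} {c} {z} (suc e) pr p∤c p^∣cz with euclidsLemma c z pr (∣-trans (m∣m*n (p ^ e)) p^∣cz)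
  ... | inj₁ p∣c = contradiction p∣c p∤c
  ... | inj₂ (divides z′ refl) = subst (p * p ^ e ∣_) (*-comm p z′)
    (*-monoʳ-∣ p (prime-power-cancelˡ e pr p∤c
      (*-cancelˡ-∣ p {{prime⇒nonZero pr}} (subst (p * p ^ e ∣_) (regroup c z′ p) p^∣cz))))
    where
    regroup : ∀ c z p → c * (z * p) ≡ p * (c * z)
    regroup = solve-∀

  prime∤! : ∀ {p} d → Prime p → d < p → ¬ p ∣ d !
  prime∤! zero    pr 0<p p∣1 = <⇒≱ 1<p (∣⇒≤ p∣1)
    where
    1<p = nonTrivial⇒n>1 _ {{prime⇒nonTrivial pr}}
  prime∤! (suc d) pr d<p p∣! with euclidsLemma (suc d) (d !) pr p∣!
  ... | inj₁ p∣1+d = <⇒≱ d<p (∣⇒≤ p∣1+d)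
  ... | inj₂ p∣d!  = prime∤! d pr (<-trans (n<1+n d) d<p) p∣d!

  -- By Legendre's formula the 2-adic valuation of n! is n minus the binary digit sum of n, and n <
  -- 2ᴸ has at most L digits.
  record TwoPart (L n : ℕ) : Set where
    field
      valuation odd-part : ℕ
      factorization : n ! ≡ 2 ^ valuation * odd-part
      odd           : ¬ 2 ∣ odd-part
      valuation≤    : valuation ≤ n
      ≤valuation    : n ≤ valuation + L

  private
    2∤1+2q : ∀ q → ¬ 2 ∣ suc (q + q)
    2∤1+2q q 2∣ = contradiction (∣m+n∣m⇒∣n (subst (2 ∣_) (+-comm 1 (q + q)) 2∣) (subst (2 ∣_) (cong (q +_) (+-identityʳ q)) (m∣m*n q)))
                    (λ 2∣1 → contradiction (∣⇒≤ 2∣1) λ { (s≤s ()) })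

    2∤* : ∀ {m n} → ¬ 2 ∣ m → ¬ 2 ∣ n → ¬ 2 ∣ m * n
    2∤* {m} {n} 2∤m 2∤n 2∣mn with euclidsLemma m n prime[2] 2∣mn
    ... | inj₁ h = 2∤m h
    ... | inj₂ h = 2∤n h

    -- The odd cofactor is 1 · 3 ⋯ (2q - 1).
    even-factorial : ∀ q → ∃ λ o → (q + q) ! ≡ 2 ^ q * q ! * o × ¬ 2 ∣ o
    even-factorial zero = 1 , refl , 2∤1+2q 0
    even-factorial (suc q) with even-factorial q
    ... | o , eq , 2∤o = o * suc (q + q) , eq′ , 2∤* 2∤o (2∤1+2q q)
      where
      open ≡-Reasoning
      regroup : ∀ q a f o → (1 + (1 + (q + q))) * ((1 + (q + q)) * (a * f * o)) ≡ 2 * a * ((1 + q) * f) * (o * (1 + (q + q)))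
      regroup = solve-∀
      eq′ : (suc q + suc q) ! ≡ 2 ^ suc q * suc q ! * (o * suc (q + q))
      eq′ = begin
        (suc q + suc q) !                                             ≡⟨ cong (λ n → suc n !) (+-suc q q) ⟩
        suc (suc (q + q)) * (suc (q + q) * (q + q) !)                 ≡⟨ cong (λ n → suc (suc (q + q)) * (suc (q + q) * n)) eq ⟩
        suc (suc (q + q)) * (suc (q + q) * (2 ^ q * q ! * o))         ≡⟨ regroup q (2 ^ q) (q !) o ⟩
        2 ^ suc q * suc q ! * (o * suc (q + q))                       ∎

    halve : ∀ n → ∃ λ q → n ≡ q + q ⊎ n ≡ suc (q + q)
    halve zero = 0 , inj₁ refl
    halve (suc n) with halve n
    ... | q , inj₁ eq = q , inj₂ (cong suc eq)
    ... | q , inj₂ eq = suc q , inj₁ (trans (cong suc eq) (cong suc (sym (+-suc q q))))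

  -- For q = ⌊n/2⌋ the valuation of n! is q plus that of q!. Since n ≤ 2q + 1, each halving loses at
  -- most 1, and there are L halvings.
  two-part : ∀ L n → n < 2 ^ L → TwoPart L n
  two-part zero    zero    _ = record
    { valuation = 0 ; odd-part = 1 ; factorization = refl ; odd = 2∤1+2q 0 ; valuation≤ = z≤n ; ≤valuation = z≤n }
  two-part zero    (suc n) (s≤s ())
  two-part (suc L) n n<2^ with halve n
  ... | q , parity = step parity
    where
    open ≤-Reasoning
    q+q≤n : n ≡ q + q ⊎ n ≡ suc (q + q) → q + q ≤ n
    q+q≤n (inj₁ refl) = ≤-refl
    q+q≤n (inj₂ refl) = n≤1+n _
    n≤1+q+q : n ≡ q + q ⊎ n ≡ suc (q + q) → n ≤ suc (q + q)
    n≤1+q+q (inj₁ refl) = n≤1+n _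
    n≤1+q+q (inj₂ refl) = ≤-refl
    q<2^L : q < 2 ^ L
    q<2^L = *-cancelˡ-< 2 q (2 ^ L) (≤-<-trans (subst (_≤ n) (cong (q +_) (sym (+-identityʳ q))) (q+q≤n parity)) n<2^)
    open TwoPart (two-part L q q<2^L)
    v = q + valuation
    v≤n : v ≤ n
    v≤n = ≤-trans (+-monoʳ-≤ q valuation≤) (q+q≤n parity)
    n≤v+ : n ≤ v + suc L
    n≤v+ = begin
      n                           ≤⟨ n≤1+q+q parity ⟩
      suc (q + q)                 ≤⟨ s≤s (+-monoʳ-≤ q ≤valuation) ⟩
      suc (q + (valuation + L))   ≡⟨ regroup q valuation L ⟩
      v + suc L                   ∎
      where
      regroup : ∀ q v L → 1 + (q + (v + L)) ≡ q + v + (1 + L)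
      regroup = solve-∀
    even-part : ∃ λ o → (q + q) ! ≡ 2 ^ v * o × ¬ 2 ∣ o
    even-part with even-factorial q
    ... | o , eq , 2∤o = odd-part * o , eq′ , 2∤* odd 2∤o
      where
      regroup : ∀ a b c o → a * (b * c) * o ≡ a * b * (c * o)
      regroup = solve-∀
      eq′ : (q + q) ! ≡ 2 ^ v * (odd-part * o)
      eq′ = trans eq (trans (cong (λ z → 2 ^ q * z * o) factorization)
              (trans (regroup (2 ^ q) (2 ^ valuation) odd-part o) (cong (_* (odd-part * o)) (sym (^-distribˡ-+-* 2 q valuation)))))
    step : n ≡ q + q ⊎ n ≡ suc (q + q) → TwoPart (suc L) n
    step (inj₁ n≡) with even-part
    ... | o , eq , 2∤o = record
      { valuation = v ; odd-part = o ; factorization = trans (cong _! n≡) eq ; odd = 2∤o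
      ; valuation≤ = v≤n ; ≤valuation = n≤v+ }
    step (inj₂ n≡) with even-part
    ... | o , eq , 2∤o = record
      { valuation = v ; odd-part = suc (q + q) * o
      ; factorization = trans (cong _! n≡) (trans (cong (suc (q + q) *_) eq) (swap (suc (q + q)) (2 ^ v) o))
      ; odd = 2∤* (2∤1+2q q) 2∤o
      ; valuation≤ = v≤n ; ≤valuation = n≤v+ }
      where
      swap : ∀ a b c → a * (b * c) ≡ b * (a * c)
      swap = solve-∀

  -- The 2-adic valuation of n! is n up to O(log n), so the relation pins s down up to O(log n).
  valuation-gap : ∀ L V {a b d s u w} → a + d < 2 ^ L → b + (d + s) < 2 ^ L → 1 ≤ u → u < 2 ^ V →
                  (a + d) ! * b ! * u ≡ a ! * (b + (d + s)) ! * w → s ≤ 2 * L + V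
  valuation-gap L V {a} {b} {d} {s} {u} {w} a+d< b+d+s< 1≤u u<2^V eq =
    ≮⇒≥ λ s> → <⇒≱ u<2^V (∣⇒≤ {{>-nonZero 1≤u}} (2^V∣u s>))
    where
    open ≤-Reasoning
    open TwoPart
    A₁ = two-part L (a + d) a+d<
    B₁ = two-part L b (≤-<-trans (m≤m+n b (d + s)) b+d+s<)
    A₀ = two-part L a (≤-<-trans (m≤m+n a d) a+d<)
    B₀ = two-part L (b + (d + s)) b+d+s<
    v = valuation A₁ + valuation B₁
    o = odd-part A₁ * odd-part B₁
    regroup : ∀ p q r s → p * q * (r * s) ≡ p * r * (q * s)
    regroup = solve-∀
    lhs : (a + d) ! * b ! * u ≡ 2 ^ v * (o * u)
    lhs = trans (cong₂ (λ m n → m * n * u) (factorization A₁) (factorization B₁))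
            (trans (cong (_* u) (trans (regroup (2 ^ valuation A₁) _ _ _) (cong (_* o) (sym (^-distribˡ-+-* 2 (valuation A₁) (valuation B₁))))))
                   (*-assoc (2 ^ v) o u))
    rhs∣ : 2 ^ (valuation A₀ + valuation B₀) ∣ a ! * (b + (d + s)) ! * w
    rhs∣ = ∣m⇒∣m*n w (subst (_∣ a ! * (b + (d + s)) !) (sym (^-distribˡ-+-* 2 (valuation A₀) (valuation B₀)))
      (*-pres-∣ {o = 2 ^ valuation A₀} {p = 2 ^ valuation B₀} (divides (odd-part A₀) (trans (factorization A₀) (*-comm _ (odd-part A₀))))
                (divides (odd-part B₀) (trans (factorization B₀) (*-comm _ (odd-part B₀))))))
    -- If s exceeded 2L + V, the right side would contain V more factors 2 than the two factorials
    -- on the left. Then 2ⱽ would divide u, although 1 ≤ u < 2ⱽ.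
    exponent : 2 * L + V < s → v + V ≤ valuation A₀ + valuation B₀
    exponent s> = +-cancelʳ-≤ (2 * L) _ _ (begin
      v + V + 2 * L                                          ≤⟨ +-monoˡ-≤ (2 * L) (+-monoˡ-≤ V (+-mono-≤ (valuation≤ A₁) (valuation≤ B₁))) ⟩
      a + d + b + V + 2 * L                                  ≡⟨ gather a d b V L ⟩
      a + (b + (d + (2 * L + V)))                            ≤⟨ +-monoʳ-≤ a (+-monoʳ-≤ b (+-monoʳ-≤ d (<⇒≤ s>))) ⟩
      a + (b + (d + s))                                      ≤⟨ +-mono-≤ (≤valuation A₀) (≤valuation B₀) ⟩
      valuation A₀ + L + (valuation B₀ + L)                  ≡⟨ spread (valuation A₀) (valuation B₀) L ⟩
      valuation A₀ + valuation B₀ + 2 * L                    ∎)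
      where
      gather : ∀ a d b V L → a + d + b + V + 2 * L ≡ a + (b + (d + (2 * L + V)))
      gather = solve-∀
      spread : ∀ v w L → v + L + (w + L) ≡ v + w + 2 * L
      spread = solve-∀
    2^V∣u : 2 * L + V < s → 2 ^ V ∣ u
    2^V∣u s> = prime-power-cancelˡ V prime[2] (2∤* (odd A₁) (odd B₁))
      (*-cancelˡ-∣ (2 ^ v) {{m^n≢0 2 v}} (subst₂ _∣_ (^-distribˡ-+-* 2 v V) (trans (sym eq) lhs)
        (∣-trans (m≤n⇒m^a∣m^b (exponent s>)) rhs∣)))
      where
      m≤n⇒m^a∣m^b : ∀ {m n} → m ≤ n → 2 ^ m ∣ 2 ^ n
      m≤n⇒m^a∣m^b {m} {n} m≤n = divides (2 ^ (n ∸ m))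
        (trans (cong (2 ^_) (sym (m∸n+n≡m m≤n))) (^-distribˡ-+-* 2 (n ∸ m) m))

  -- Disjointness puts the two products at distance at least d, so by `rise-compare` the one further
  -- right is larger by a factor (1 + d/x)ᵈ. The equation leaves room only for x^(s + c): the s
  -- additional factors and one of the cofactors u, w.
  size-gap : ∀ {x a b d s u w} .{{_ : NonZero x}} c → 1 ≤ u → u ≤ x ^ c → 1 ≤ w → w ≤ x ^ c →
             a + d ≤ x → b + (d + s) ≤ x → b + (d + s) ≤ a ⊎ a + d ≤ b →
             rise a d * u ≡ rise b (d + s) * w → (x + d) ^ d ≤ x ^ (d + (s + c))
  size-gap {x} {a} {b} {d} {s} {u} {w} c 1≤u u≤ 1≤w w≤ a+d≤x b+d+s≤x disjoint eq = go disjoint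
    where
    open ≤-Reasoning
    instance
      _ = >-nonZero 1≤u
      _ = >-nonZero 1≤w
      _ = rise-nonZero a d
      _ = rise-nonZero b d
      _ = rise-nonZero (b + d) s
    b+d≤ : ∀ {y} → b + (d + s) ≤ y → b + d ≤ y
    b+d≤ = ≤-trans (≤-trans (m≤m+n (b + d) s) (≤-reflexive (+-assoc b d s)))
    d≤b+d = m≤n+m d b
    regroup : ∀ r p q v → r * p * q * v ≡ r * (v * (p * q))
    regroup = solve-∀
    go : b + (d + s) ≤ a ⊎ a + d ≤ b → (x + d) ^ d ≤ x ^ (d + (s + c))
    go (inj₁ b+d+s≤a) = *-cancelˡ-≤ (rise b d) (begin
      rise b d * (x + d) ^ d                ≤⟨ rise-compare d (b+d≤ b+d+s≤a) (b+d≤ b+d+s≤x) ⟩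
      rise a d * x ^ d                      ≤⟨ *-monoˡ-≤ (x ^ d) (m≤m*n (rise a d) u) ⟩
      rise a d * u * x ^ d                  ≡⟨ cong (_* x ^ d) (trans eq (cong (_* w) (rise-+ b d s))) ⟩
      rise b d * rise (b + d) s * w * x ^ d ≤⟨ *-monoˡ-≤ (x ^ d) (*-mono-≤ (*-monoʳ-≤ (rise b d) (rise≤^ (b + d) s (subst (_≤ x) (sym (+-assoc b d s)) b+d+s≤x))) w≤) ⟩
      rise b d * x ^ s * x ^ c * x ^ d      ≡⟨ regroup (rise b d) (x ^ s) (x ^ c) (x ^ d) ⟩
      rise b d * (x ^ d * (x ^ s * x ^ c))  ≡⟨ cong (rise b d *_) (trans (cong (x ^ d *_) (sym (^-distribˡ-+-* x s c))) (sym (^-distribˡ-+-* x d (s + c)))) ⟩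
      rise b d * x ^ (d + (s + c))          ∎)
    go (inj₂ a+d≤b) = *-cancelˡ-≤ (rise a d) (begin
      rise a d * (x + d) ^ d                ≤⟨ rise-compare d a+d≤b a+d≤x ⟩
      rise b d * x ^ d                      ≤⟨ *-monoˡ-≤ (x ^ d) (≤-trans (m≤m*n (rise b d) (rise (b + d) s)) (m≤m*n _ w)) ⟩
      rise b d * rise (b + d) s * w * x ^ d ≡⟨ cong (_* x ^ d) (trans (cong (_* w) (sym (rise-+ b d s))) (sym eq)) ⟩
      rise a d * u * x ^ d                  ≤⟨ *-monoˡ-≤ (x ^ d) (*-monoʳ-≤ (rise a d) u≤) ⟩
      rise a d * x ^ c * x ^ d              ≡⟨ *-assoc (rise a d) _ _ ⟩
      rise a d * (x ^ c * x ^ d)            ≡⟨ cong (rise a d *_) (sym (^-distribˡ-+-* x c d)) ⟩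
      rise a d * x ^ (c + d)                ≤⟨ *-monoʳ-≤ (rise a d) (^-monoʳ-≤ x (≤-trans (m≤n+m (c + d) s) (≤-reflexive (permute s c d)))) ⟩
      rise a d * x ^ (d + (s + c))          ∎)
      where
      permute : ∀ s c d → s + (c + d) ≡ d + (s + c)
      permute = solve-∀

-- Bounds for pᵉ from one gap and from a pair of gaps

module Relations where

  open import Defs using (ℤ[X]; shiftedFactorial)
  open import Data.Nat.Base
  open import Data.Nat.Properties
  open import Data.Nat.DivMod using (m≡m%n+[m/n]*n; m/n*n≤m; m%n<n)
  open import Data.Nat.Divisibility
  open import Data.Nat.Primality using (Prime)
  open import Data.Nat.Combinatorics using (_C_)
  open import Data.Nat.Tactic.RingSolver using (solve-∀)
  open import Data.Integer.Base as ℤ using (ℤ; +_; ∣_∣)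
  import Data.Integer.Properties as ℤ
  import Data.Integer.Divisibility.Signed as ℤ∣
  import Data.Integer.Tactic.RingSolver as ℤ-Solver
  open import Data.Sum.Base using (_⊎_; inj₁; inj₂)
  open import Relation.Binary.PropositionalEquality
  open Arithmetic
  open PolynomialGrowth
  open RisingFactorials

  -- Since (1 + d/x)^q ≥ 2 for q > x/d, the hypothesis implies 2^⌊d/q⌋ ≤ x^σ ≤ 2^(Lσ). This bounds d
  -- by q(1 + Lσ), and dq ≤ 2x for q = ⌊x/d⌋ + 1.
  size⇒length : ∀ {x d} L σ .{{_ : NonZero x}} .{{_ : NonZero d}} → d ≤ x → x < 2 ^ L →
                (x + d) ^ d ≤ x ^ (d + σ) → d * d ≤ 2 * x * suc (L * σ)
  size⇒length {x} {d} L σ d≤x x<2^L h = begin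
    d * d                          ≤⟨ *-monoʳ-≤ d (<⇒≤ d<q[1+k]) ⟩
    d * (q * suc k)                ≡⟨ *-assoc d q (suc k) ⟨
    d * q * suc k                  ≤⟨ *-mono-≤ dq≤2x (s≤s k≤Lσ) ⟩
    2 * x * suc (L * σ)            ∎
    where
    open ≤-Reasoning
    q = suc (x / d)
    k = d / q
    r = d % q
    dq≤2x : d * q ≤ 2 * x
    dq≤2x = begin
      d * suc (x / d)      ≡⟨ *-suc d (x / d) ⟩
      d + d * (x / d)      ≤⟨ +-mono-≤ d≤x (≤-trans (≤-reflexive (*-comm d (x / d))) (m/n*n≤m x d)) ⟩
      x + x                ≡⟨ cong (λ z → x + z) (+-identityʳ x) ⟨
      2 * x                ∎
    x≤qd : x ≤ q * d
    x≤qd = begin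
      x                        ≡⟨ m≡m%n+[m/n]*n x d ⟩
      x % d + x / d * d        ≤⟨ +-monoˡ-≤ (x / d * d) (<⇒≤ (m%n<n x d)) ⟩
      d + x / d * d            ∎
    d≡ : d ≡ r + k * q
    d≡ = m≡m%n+[m/n]*n d q
    d<q[1+k] : d < q * suc k
    d<q[1+k] = begin-strict
      d                ≡⟨ d≡ ⟩
      r + k * q        <⟨ +-monoˡ-< (k * q) (m%n<n d q) ⟩
      q + k * q        ≡⟨ *-comm (suc k) q ⟩
      q * suc k        ∎
    doubling : 2 * x ^ q ≤ (x + d) ^ q
    doubling = *-cancelˡ-≤ x (begin
      x * (2 * x ^ q)            ≡⟨ regroup x (x ^ q) ⟩
      x ^ q * (x + x)            ≤⟨ *-monoʳ-≤ (x ^ q) (+-monoʳ-≤ x x≤qd) ⟩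
      x ^ q * (x + q * d)        ≤⟨ bernoulli x d q ⟩
      x * (x + d) ^ q            ∎)
      where
      regroup : ∀ x p → x * (2 * p) ≡ p * (x + x)
      regroup = solve-∀
    power : ∀ y → y ^ r * (y ^ q) ^ k ≡ y ^ d
    power y = trans (cong (y ^ r *_) (trans (^-*-assoc y q k) (cong (y ^_) (*-comm q k))))
                (trans (sym (^-distribˡ-+-* y r (k * q))) (cong (y ^_) (sym d≡)))
    2^k≤ : 2 ^ k ≤ 2 ^ (L * σ)
    2^k≤ = *-cancelʳ-≤ _ _ (x ^ d) {{m^n≢0 x d}} (begin
      2 ^ k * x ^ d                        ≡⟨ cong (2 ^ k *_) (power x) ⟨
      2 ^ k * (x ^ r * (x ^ q) ^ k)        ≡⟨ rotate (2 ^ k) (x ^ r) ((x ^ q) ^ k) ⟩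
      x ^ r * (2 ^ k * (x ^ q) ^ k)        ≡⟨ cong (x ^ r *_) (^-distribʳ-* k 2 (x ^ q)) ⟨
      x ^ r * (2 * x ^ q) ^ k              ≤⟨ *-mono-≤ (^-monoˡ-≤ r (m≤m+n x d)) (^-monoˡ-≤ k doubling) ⟩
      (x + d) ^ r * ((x + d) ^ q) ^ k      ≡⟨ power (x + d) ⟩
      (x + d) ^ d                          ≤⟨ h ⟩
      x ^ (d + σ)                          ≡⟨ trans (^-distribˡ-+-* x d σ) (*-comm (x ^ d) (x ^ σ)) ⟩
      x ^ σ * x ^ d                        ≤⟨ *-monoˡ-≤ (x ^ d) (^-monoˡ-≤ σ (<⇒≤ x<2^L)) ⟩
      (2 ^ L) ^ σ * x ^ d                  ≡⟨ cong (_* x ^ d) (^-*-assoc 2 L σ) ⟩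
      2 ^ (L * σ) * x ^ d                  ∎)
      where
      rotate : ∀ a b c → a * (b * c) ≡ b * (a * c)
      rotate = solve-∀
    k≤Lσ : k ≤ L * σ
    k≤Lσ = ≮⇒≥ λ Lσ<k → <⇒≱ (^-monoʳ-< 2 (s≤s (s≤s z≤n)) Lσ<k) 2^k≤

  C*t^x≤ : ∀ {x n} t k → n ≤ x → (n C k) * t ^ x ≤ t ^ k * suc t ^ x
  C*t^x≤ {x} {n} t k n≤x = begin
    (n C k) * t ^ x                        ≡⟨ cong ((n C k) *_) (split t) ⟩
    (n C k) * (t ^ n * t ^ (x ∸ n))        ≡⟨ *-assoc (n C k) _ _ ⟨
    (n C k) * t ^ n * t ^ (x ∸ n)          ≤⟨ *-mono-≤ (C*t^n≤ t n k) (^-monoˡ-≤ (x ∸ n) (n≤1+n t)) ⟩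
    t ^ k * suc t ^ n * suc t ^ (x ∸ n)    ≡⟨ *-assoc (t ^ k) _ _ ⟩
    t ^ k * (suc t ^ n * suc t ^ (x ∸ n))  ≡⟨ cong (t ^ k *_) (split (suc t)) ⟨
    t ^ k * suc t ^ x                      ∎
    where
    open ≤-Reasoning
    split : ∀ y → y ^ x ≡ y ^ n * y ^ (x ∸ n)
    split y = trans (cong (y ^_) (sym (m+[n∸m]≡n n≤x))) (^-distribˡ-+-* y n (x ∸ n))

  ∣i∣≤∣j∣+∣i-j∣ : ∀ i j → ∣ i ∣ ≤ ∣ j ∣ + ∣ i ℤ.- j ∣
  ∣i∣≤∣j∣+∣i-j∣ i j = subst (λ k → ∣ k ∣ ≤ ∣ j ∣ + ∣ i ℤ.- j ∣) (rejoin i j) (ℤ.∣i+j∣≤∣i∣+∣j∣ j (i ℤ.- j))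
    where
    rejoin : ∀ i j → j ℤ.+ (i ℤ.- j) ≡ i
    rejoin = ℤ-Solver.solve-∀

  -- E is an integer in the role of 1/ε₀. The three size conditions on x serve, in this order, to
  -- apply the growth bounds at n ≥ x/E, to absorb the constant 2Q² in one factor x, and to make
  -- (a+1)⋯(a+d) f(a) dominate f(a+d).
  module Congruences
    {f : ℤ[X]} (g : Growth f) (E : ℕ) .{{_ : NonZero E}}
    (x L p : ℕ) .{{_ : NonZero x}} (x<2^L : x < 2 ^ L) (prime : Prime p)
    (x-large : E * Growth.threshold g ≤ x)
    (x-large′ : 2 * (Growth.scale g * Growth.scale g) ≤ x)
    (x-large″ : E * (Growth.scale g * (E ^ Growth.degree g * Growth.scale g)) ≤ x)
    where

    open Growth g renaming (degree to D; scale to Q; threshold to N)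
    open ≤-Reasoning

    F : ℕ → ℤ
    F = evalℕ f

    record Admissible (n : ℕ) : Set where
      constructor admissible
      field
        <x  : n < x
        <p  : n < p
        ≤E* : x ≤ E * n
    open Admissible

    -- Two values of f contribute x^(2D), and one more x pays for the constant 2Q².
    c : ℕ
    c = 2 * D + 1

    -- The constant that results in `distinct-equal-ordered` from comparing d² with the O(d)
    -- variation of f.
    κ : ℕ
    κ = 2 * (E * (Q * Q) * (E ^ D * Q * (E ^ D * Q)))

    module _ {n : ℕ} (adm : Admissible n) where
      N≤ : N ≤ n
      N≤ = *-cancelˡ-≤ E (≤-trans x-large (≤E* adm))

      1≤n : 1 ≤ n
      1≤n = n≢0⇒n>0 λ { refl → <⇒≱ (>-nonZero⁻¹ x) (≤-trans (≤E* adm) (≤-reflexive (*-zeroʳ E))) }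

      F≤ : ∣ F n ∣ ≤ Q * x ^ D
      F≤ = ≤-trans (upper n N≤) (*-monoʳ-≤ Q (^-monoˡ-≤ D (<⇒≤ (<x adm))))

      ≤F : x ^ D ≤ E ^ D * Q * ∣ F n ∣
      ≤F = begin
        x ^ D                      ≤⟨ ^-monoˡ-≤ D (≤E* adm) ⟩
        (E * n) ^ D                ≡⟨ ^-distribʳ-* D E n ⟩
        E ^ D * n ^ D              ≤⟨ *-monoʳ-≤ (E ^ D) (lower n N≤) ⟩
        E ^ D * (Q * ∣ F n ∣)      ≡⟨ *-assoc (E ^ D) Q ∣ F n ∣ ⟨
        E ^ D * Q * ∣ F n ∣        ∎

      1≤F : 1 ≤ ∣ F n ∣
      1≤F = n≢0⇒n>0 λ ∣F∣≡0 → <⇒≱ (m^n>0 n {{>-nonZero 1≤n}} D)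
        (≤-trans (lower n N≤) (≤-reflexive (trans (cong (Q *_) ∣F∣≡0) (*-zeroʳ Q))))

      F-lipschitz : ∀ {d} → Admissible (n + d) → x * ∣ F (n + d) ℤ.- F n ∣ ≤ E * Q * d * x ^ D
      F-lipschitz {d} adm′ = begin
        x * δ                        ≤⟨ *-monoˡ-≤ δ (≤E* adm′) ⟩
        E * (n + d) * δ              ≡⟨ *-assoc E (n + d) δ ⟩
        E * ((n + d) * δ)            ≤⟨ *-monoʳ-≤ E (lipschitz n d N≤) ⟩
        E * (Q * d * (n + d) ^ D)    ≤⟨ *-monoʳ-≤ E (*-monoʳ-≤ (Q * d) (^-monoˡ-≤ D (<⇒≤ (<x adm′)))) ⟩
        E * (Q * d * x ^ D)          ≡⟨ regroup E Q d (x ^ D) ⟩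
        E * Q * d * x ^ D            ∎
        where
        δ = ∣ F (n + d) ℤ.- F n ∣
        regroup : ∀ E Q d p → E * (Q * d * p) ≡ E * Q * d * p
        regroup = solve-∀

    2*F*F≤ : ∀ {m n} → Admissible m → Admissible n → 2 * (∣ F m ∣ * ∣ F n ∣) ≤ x ^ c
    2*F*F≤ {m} {n} am an = begin
      2 * (∣ F m ∣ * ∣ F n ∣)              ≤⟨ *-monoʳ-≤ 2 (*-mono-≤ (F≤ am) (F≤ an)) ⟩
      2 * (Q * x ^ D * (Q * x ^ D))        ≡⟨ regroup Q (x ^ D) ⟩
      2 * (Q * Q) * (x ^ D * x ^ D)        ≤⟨ *-monoˡ-≤ (x ^ D * x ^ D) x-large′ ⟩
      x * (x ^ D * x ^ D)                  ≡⟨ cong (x *_) (^-distribˡ-+-* x D D) ⟨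
      x ^ suc (D + D)                      ≡⟨ cong (x ^_) (exponent D) ⟩
      x ^ c                                ∎
      where
      regroup : ∀ Q p → 2 * (Q * p * (Q * p)) ≡ 2 * (Q * Q) * (p * p)
      regroup = solve-∀
      exponent : ∀ D → 1 + (D + D) ≡ 2 * D + 1
      exponent = solve-∀

    F*F≤ : ∀ {m n} → Admissible m → Admissible n → ∣ F m ∣ * ∣ F n ∣ ≤ x ^ c
    F*F≤ am an = ≤-trans (m≤m+n _ _) (2*F*F≤ am an)

    1≤F*F : ∀ {m n} → Admissible m → Admissible n → 1 ≤ ∣ F m ∣ * ∣ F n ∣
    1≤F*F am an = *-mono-≤ (1≤F am) (1≤F an)

    -- The difference of the overview, multiplied by d!, is nonzero if its two terms differ in
    -- absolute value. Without signs the question concerns natural numbers, to which valuations and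
    -- sizes apply.
    Distinct : ℕ → ℕ → ℕ → ℕ → Set
    Distinct a d b d′ = rise a d * (∣ F a ∣ * ∣ F (b + d′) ∣) ≢ rise b d′ * (∣ F (a + d) ∣ * ∣ F b ∣)

    module _ {a b d s : ℕ}
      (aa : Admissible a) (aad : Admissible (a + d)) (ab : Admissible b) (abd : Admissible (b + (d + s))) where

      -- Multiplied by a! b!, an equality would become a relation between factorials. The values of
      -- f in it are below 2^(Lc), hence account for fewer than Lc factors 2.
      distinct-lengths : 2 * L + L * c < s → Distinct a d b (d + s)
      distinct-lengths s> eq = <⇒≱ s> (valuation-gap L (L * c) {a} {b} {d} {s} {u} {w}
        (<-trans (<x aad) x<2^L) (<-trans (<x abd) x<2^L) (1≤F*F aa abd)
        (≤-<-trans (F*F≤ aa abd) (subst (x ^ c <_) (^-*-assoc 2 L c) (^-monoˡ-< c {{c≢0}} x<2^L)))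
        (begin-equality
          (a + d) ! * b ! * u                       ≡⟨ cong (λ z → z * b ! * u) (rise-! a d) ⟨
          rise a d * a ! * b ! * u                  ≡⟨ regroup (rise a d) (a !) (b !) u ⟩
          a ! * b ! * (rise a d * u)                ≡⟨ cong (a ! * b ! *_) eq ⟩
          a ! * b ! * (rise b (d + s) * w)          ≡⟨ regroup′ (rise b (d + s)) (a !) (b !) w ⟩
          a ! * (rise b (d + s) * b !) * w          ≡⟨ cong (λ z → a ! * z * w) (rise-! b (d + s)) ⟩
          a ! * (b + (d + s)) ! * w                 ∎))
        where
        u = ∣ F a ∣ * ∣ F (b + (d + s)) ∣
        w = ∣ F (a + d) ∣ * ∣ F b ∣
        c≢0 : NonZero c
        c≢0 = >-nonZero (m≤n+m 1 (2 * D))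
        regroup : ∀ r p q u → r * p * q * u ≡ p * q * (r * u)
        regroup = solve-∀
        regroup′ : ∀ r p q w → p * q * (r * w) ≡ p * (r * q) * w
        regroup′ = solve-∀

      distinct-long : .{{_ : NonZero d}} → b + (d + s) ≤ a ⊎ a + d ≤ b →
                      2 * x * suc (L * (s + c)) < d * d → Distinct a d b (d + s)
      distinct-long disjoint d-large eq = <⇒≱ d-large (size⇒length L (s + c)
        (≤-trans (m≤n+m d a) (<⇒≤ (<x aad))) x<2^L
        (size-gap c (1≤F*F aa abd) (F*F≤ aa abd) (1≤F*F aad ab) (F*F≤ aad ab)
          (<⇒≤ (<x aad)) (<⇒≤ (<x abd)) disjoint eq))

    private
      -- Equality would force W/U = A/B. By `rise-compare` and Bernoulli's inequality A/B ≥ (1 +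
      -- d/x)ᵈ ≥ 1 + d²/x, whereas the Lipschitz bound for f gives W/U ≤ 1 + κd/x. Hence d ≤ κ.
      distinct-equal-ordered : ∀ {a b d} → Admissible a → Admissible (a + d) → Admissible b → Admissible (b + d) →
                               b + d ≤ a → κ < d → Distinct a d b d
      distinct-equal-ordered {a} {b} {d} aa aad ab abd b+d≤a κ<d eq = <⇒≱ κ<d
        (*-cancelʳ-≤ d κ (d * U) {{m*n≢0 d U {{>-nonZero (≤-<-trans z≤n κ<d)}} {{>-nonZero (1≤F*F aa abd)}}}} (begin
          d * (d * U)                                                     ≡⟨ *-assoc d d U ⟨
          d * d * U                                                       ≤⟨ ddU≤ ⟩
          x * ∣ w ℤ.- u ∣                                                  ≤⟨ x*∣w-u∣≤ ⟩
          2 * (E * Q * d * y * (Q * y))                                   ≡⟨ regroup₁ E Q d y ⟩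
          2 * (E * (Q * Q)) * d * (y * y)                                 ≤⟨ *-monoʳ-≤ (2 * (E * (Q * Q)) * d) (*-mono-≤ (≤F aa) (≤F abd)) ⟩
          2 * (E * (Q * Q)) * d * (R * ∣ F a ∣ * (R * ∣ F (b + d) ∣))      ≡⟨ regroup₂ (E * (Q * Q)) d R ∣ F a ∣ ∣ F (b + d) ∣ ⟩
          κ * (d * U)                                                     ∎))
        where
        u = F a ℤ.* F (b + d)
        w = F (a + d) ℤ.* F b
        U = ∣ F a ∣ * ∣ F (b + d) ∣
        W = ∣ F (a + d) ∣ * ∣ F b ∣
        y = x ^ D
        R = E ^ D * Q
        A = rise a d
        B = rise b d
        regroup₁ : ∀ E Q d y → 2 * (E * Q * d * y * (Q * y)) ≡ 2 * (E * (Q * Q)) * d * (y * y)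
        regroup₁ = solve-∀
        regroup₂ : ∀ e d R s t → 2 * e * d * (R * s * (R * t)) ≡ 2 * (e * (R * R)) * (d * (s * t))
        regroup₂ = solve-∀
        ratio : B * (x + d * d) ≤ A * x
        ratio = *-cancelˡ-≤ (x ^ d) {{m^n≢0 x d}} (begin
          x ^ d * (B * (x + d * d))       ≡⟨ rotate (x ^ d) B (x + d * d) ⟩
          B * (x ^ d * (x + d * d))       ≤⟨ *-monoʳ-≤ B (bernoulli x d d) ⟩
          B * (x * (x + d) ^ d)           ≡⟨ rotate′ B x ((x + d) ^ d) ⟩
          B * (x + d) ^ d * x             ≤⟨ *-monoˡ-≤ x (rise-compare d b+d≤a (<⇒≤ (<x abd))) ⟩
          A * x ^ d * x                   ≡⟨ rotate″ A (x ^ d) x ⟩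
          x ^ d * (A * x)                 ∎)
          where
          rotate : ∀ p q r → p * (q * r) ≡ q * (p * r)
          rotate = solve-∀
          rotate′ : ∀ p q r → p * (q * r) ≡ p * r * q
          rotate′ = solve-∀
          rotate″ : ∀ p q r → p * q * r ≡ q * (p * r)
          rotate″ = solve-∀
        U-W : (x + d * d) * U ≤ x * W
        U-W = *-cancelˡ-≤ B {{rise-nonZero b d}} (begin
          B * ((x + d * d) * U)     ≡⟨ *-assoc B (x + d * d) U ⟨
          B * (x + d * d) * U       ≤⟨ *-monoˡ-≤ U ratio ⟩
          A * x * U                 ≡⟨ rotate A x U ⟩
          x * (A * U)               ≡⟨ cong (x *_) eq ⟩
          x * (B * W)               ≡⟨ rotate′ x B W ⟩
          B * (x * W)               ∎)
          where
          rotate : ∀ p q r → p * q * r ≡ q * (p * r)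
          rotate = solve-∀
          rotate′ : ∀ p q r → p * (q * r) ≡ q * (p * r)
          rotate′ = solve-∀
        ddU≤ : d * d * U ≤ x * ∣ w ℤ.- u ∣
        ddU≤ = +-cancelˡ-≤ (x * U) _ _ (begin
          x * U + d * d * U                     ≡⟨ *-distribʳ-+ U x (d * d) ⟨
          (x + d * d) * U                       ≤⟨ U-W ⟩
          x * W                                 ≡⟨ cong (x *_) (ℤ.abs-* (F (a + d)) (F b)) ⟨
          x * ∣ w ∣                             ≤⟨ *-monoʳ-≤ x (∣i∣≤∣j∣+∣i-j∣ w u) ⟩
          x * (∣ u ∣ + ∣ w ℤ.- u ∣)             ≡⟨ *-distribˡ-+ x ∣ u ∣ _ ⟩
          x * ∣ u ∣ + x * ∣ w ℤ.- u ∣           ≡⟨ cong (λ z → x * z + x * ∣ w ℤ.- u ∣) (ℤ.abs-* (F a) (F (b + d))) ⟩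
          x * U + x * ∣ w ℤ.- u ∣               ∎)
        x*∣w-u∣≤ : x * ∣ w ℤ.- u ∣ ≤ 2 * (E * Q * d * y * (Q * y))
        x*∣w-u∣≤ = begin
          x * ∣ w ℤ.- u ∣                                      ≡⟨ cong (λ z → x * ∣ z ∣) (split (F a) (F (a + d)) (F b) (F (b + d))) ⟩
          x * ∣ (F (a + d) ℤ.- F a) ℤ.* F b ℤ.- (F (b + d) ℤ.- F b) ℤ.* F a ∣
            ≤⟨ *-monoʳ-≤ x (ℤ.∣i-j∣≤∣i∣+∣j∣ ((F (a + d) ℤ.- F a) ℤ.* F b) _) ⟩
          x * (∣ (F (a + d) ℤ.- F a) ℤ.* F b ∣ + ∣ (F (b + d) ℤ.- F b) ℤ.* F a ∣)
            ≡⟨ cong (x *_) (cong₂ _+_ (ℤ.abs-* (F (a + d) ℤ.- F a) (F b)) (ℤ.abs-* (F (b + d) ℤ.- F b) (F a))) ⟩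
          x * (∣ F (a + d) ℤ.- F a ∣ * ∣ F b ∣ + ∣ F (b + d) ℤ.- F b ∣ * ∣ F a ∣)
            ≡⟨ distribute x ∣ F (a + d) ℤ.- F a ∣ _ _ _ ⟩
          x * ∣ F (a + d) ℤ.- F a ∣ * ∣ F b ∣ + x * ∣ F (b + d) ℤ.- F b ∣ * ∣ F a ∣
            ≤⟨ +-mono-≤ (*-mono-≤ (F-lipschitz aa aad) (F≤ ab)) (*-mono-≤ (F-lipschitz ab abd) (F≤ aa)) ⟩
          E * Q * d * y * (Q * y) + E * Q * d * y * (Q * y)    ≡⟨ double (E * Q * d * y * (Q * y)) ⟩
          2 * (E * Q * d * y * (Q * y))                        ∎
          where
          split : ∀ fa fad fb fbd → fad ℤ.* fb ℤ.- fa ℤ.* fbd ≡ (fad ℤ.- fa) ℤ.* fb ℤ.- (fbd ℤ.- fb) ℤ.* fa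
          split = ℤ-Solver.solve-∀
          distribute : ∀ x p q r s → x * (p * q + r * s) ≡ x * p * q + x * r * s
          distribute = solve-∀
          double : ∀ z → z + z ≡ 2 * z
          double = solve-∀

    distinct-equal : ∀ {a b d} → Admissible a → Admissible (a + d) → Admissible b → Admissible (b + d) →
                     b + d ≤ a ⊎ a + d ≤ b → κ < d → Distinct a d b d
    distinct-equal aa aad ab abd (inj₁ b+d≤a) κ<d eq = distinct-equal-ordered aa aad ab abd b+d≤a κ<d eq
    distinct-equal {a} {b} {d} aa aad ab abd (inj₂ a+d≤b) κ<d eq = distinct-equal-ordered ab abd aa aad a+d≤b κ<d
      (trans (cong (rise b d *_) (*-comm ∣ F b ∣ ∣ F (a + d) ∣)) (trans (sym eq) (cong (rise a d *_) (*-comm ∣ F a ∣ ∣ F (b + d) ∣))))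

    module _ (e : ℕ) where

      P : ℕ
      P = p ^ e

      Divides : ℕ → Set
      Divides n = P ∣ ∣ shiftedFactorial f n ∣

      private
        P∣shift : ∀ {n} → Divides n → + P ℤ∣.∣ (+ (n !) ℤ.+ F n)
        P∣shift = ℤ∣.∣ᵤ⇒∣

        link : ∀ {a d} → Divides a → Divides (a + d) → + P ℤ∣.∣ (+ (rise a d) ℤ.* F a ℤ.- F (a + d))
        link {a} {d} Pa Pad = subst (+ P ℤ∣.∣_)
          (trans (cong (λ z → + (rise a d) ℤ.* (+ (a !) ℤ.+ F a) ℤ.- (z ℤ.+ F (a + d)))
                   (trans (cong (λ n → + n) (sym (rise-! a d))) (ℤ.pos-* (rise a d) (a !))))
                 (cancel (+ (rise a d)) (+ (a !)) (F a) (F (a + d))))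
          (ℤ∣.∣m∣n⇒∣m-n (ℤ∣.∣n⇒∣m*n (+ (rise a d)) (P∣shift Pa)) (P∣shift Pad))
          where
          cancel : ∀ r m y z → r ℤ.* (m ℤ.+ y) ℤ.- (r ℤ.* m ℤ.+ z) ≡ r ℤ.* y ℤ.- z
          cancel = ℤ-Solver.solve-∀

        ∣⇒≤′ : ∀ {z} → + P ℤ∣.∣ z → z ≢ + 0 → P ≤ ∣ z ∣
        ∣⇒≤′ {z} P∣z z≢0 = ∣⇒≤ {{≢-nonZero (λ e → z≢0 (ℤ.∣i∣≡0⇒i≡0 e))}} (ℤ∣.∣⇒∣ᵤ P∣z)

      -- The relation of one gap never degenerates: (a+1)⋯(a+d) exceeds a ≥ x/E, and for large x
      -- this exceeds the bounded ratio of f(a+d) to f(a). With base x instead of t the estimate is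
      -- affordable only for short gaps.
      single-bound : ∀ {a d} → .{{_ : NonZero d}} → Admissible a → Admissible (a + d) → Divides a → Divides (a + d) →
                     P ≤ x ^ (d + c)
      single-bound {a} {d} aa aad Pa Pad = begin
        P                                              ≤⟨ ∣⇒≤′ (link Pa Pad) nonzero ⟩
        ∣ + (rise a d) ℤ.* F a ℤ.- F (a + d) ∣         ≤⟨ ℤ.∣i-j∣≤∣i∣+∣j∣ (+ (rise a d) ℤ.* F a) (F (a + d)) ⟩
        ∣ + (rise a d) ℤ.* F a ∣ + ∣ F (a + d) ∣       ≡⟨ cong (λ z → z + ∣ F (a + d) ∣) (ℤ.abs-* (+ (rise a d)) (F a)) ⟩
        rise a d * ∣ F a ∣ + ∣ F (a + d) ∣             ≤⟨ +-mono-≤ (*-mono-≤ (rise≤^ a d (<⇒≤ (<x aad))) Fa≤)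
                                                                (≤-trans Fad≤ (m≤n*m (∣ F a ∣ * ∣ F (a + d) ∣) (x ^ d) {{m^n≢0 x d}})) ⟩
        x ^ d * V + x ^ d * V                          ≡⟨ double (x ^ d) V ⟩
        x ^ d * (2 * V)                                ≤⟨ *-monoʳ-≤ (x ^ d) (2*F*F≤ aa aad) ⟩
        x ^ d * x ^ c                                  ≡⟨ ^-distribˡ-+-* x d c ⟨
        x ^ (d + c)                                    ∎
        where
        V = ∣ F a ∣ * ∣ F (a + d) ∣
        Fa≤ : ∣ F a ∣ ≤ V
        Fa≤ = m≤m*n ∣ F a ∣ ∣ F (a + d) ∣ {{>-nonZero (1≤F aad)}}
        Fad≤ : ∣ F (a + d) ∣ ≤ V
        Fad≤ = m≤n*m ∣ F (a + d) ∣ ∣ F a ∣ {{>-nonZero (1≤F aa)}}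
        double : ∀ p v → p * v + p * v ≡ p * (2 * v)
        double = solve-∀
        a<rise : ∀ d .{{_ : NonZero d}} → a < rise a d
        a<rise (suc d) = ≤-trans (s≤s (m≤m+n a d)) (m≤n*m (suc (a + d)) (rise a d) {{rise-nonZero a d}})
        dominates : ∣ F (a + d) ∣ < rise a d * ∣ F a ∣
        dominates = *-cancelˡ-< E _ _ (begin-strict
          E * ∣ F (a + d) ∣                            ≤⟨ *-monoʳ-≤ E (F≤ aad) ⟩
          E * (Q * x ^ D)                              ≤⟨ *-monoʳ-≤ E (*-monoʳ-≤ Q (≤F aa)) ⟩
          E * (Q * (E ^ D * Q * ∣ F a ∣))              ≡⟨ regroup E Q (E ^ D) ∣ F a ∣ ⟩
          E * (Q * (E ^ D * Q)) * ∣ F a ∣              ≤⟨ *-monoˡ-≤ ∣ F a ∣ (≤-trans x-large″ (≤E* aa)) ⟩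
          E * a * ∣ F a ∣                              <⟨ *-monoˡ-< ∣ F a ∣ {{>-nonZero (1≤F aa)}} (*-monoʳ-< E (a<rise d)) ⟩
          E * rise a d * ∣ F a ∣                       ≡⟨ *-assoc E (rise a d) ∣ F a ∣ ⟩
          E * (rise a d * ∣ F a ∣)                     ∎)
          where
          regroup : ∀ E Q r v → E * (Q * (r * Q * v)) ≡ E * (Q * (r * Q)) * v
          regroup = solve-∀
        nonzero : + (rise a d) ℤ.* F a ℤ.- F (a + d) ≢ + 0
        nonzero eq = <⇒≢ dominates (trans (cong ∣_∣ (sym (ℤ.i-j≡0⇒i≡j (+ (rise a d) ℤ.* F a) (F (a + d)) eq)))
                                          (ℤ.abs-* (+ (rise a d)) (F a)))

      -- Cross-multiplying the relations of the two gaps eliminates the term f(a+d) f(b+d+s) and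
      -- leaves d! Z. As d < p, the factor d! may be dropped. This replaces products of size up to
      -- xᵈ by binomial coefficients, while the excess length s is still paid for with xˢ.
      pair-bound : ∀ {a b d s} t → Admissible a → Admissible (a + d) → Admissible b → Admissible (b + (d + s)) →
                   Divides a → Divides (a + d) → Divides b → Divides (b + (d + s)) →
                   Distinct a d b (d + s) → P * t ^ x ≤ t ^ d * suc t ^ x * x ^ (s + c)
      pair-bound {a} {b} {d} {s} t aa aad ab abd Pa Pad Pb Pbd distinct = begin
        P * t ^ x                                                     ≤⟨ *-monoˡ-≤ (t ^ x) (∣⇒≤ {{≢-nonZero ∣Z∣≢0}} P∣Z) ⟩
        ∣ Z ∣ * t ^ x                                                 ≤⟨ *-monoˡ-≤ (t ^ x) ∣Z∣≤ ⟩
        (A * U + B * S * W) * t ^ x                                   ≡⟨ distribute A U B S W (t ^ x) ⟩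
        A * t ^ x * U + B * t ^ x * (S * W)                           ≤⟨ +-mono-≤ (*-mono-≤ (C*t^x≤ t d (<⇒≤ (<x aad))) (m≤n*m U (x ^ s) {{m^n≢0 x s}}))
                                                                                 (*-mono-≤ (C*t^x≤ t d b+d≤x) (*-monoˡ-≤ W (rise≤^ (b + d) s b+d+s≤x))) ⟩
        t ^ d * suc t ^ x * (x ^ s * U) + t ^ d * suc t ^ x * (x ^ s * W) ≡⟨ collect (t ^ d * suc t ^ x) (x ^ s) U W ⟩
        t ^ d * suc t ^ x * (x ^ s * (U + W))                         ≤⟨ *-monoʳ-≤ (t ^ d * suc t ^ x) (*-monoʳ-≤ (x ^ s) U+W≤) ⟩
        t ^ d * suc t ^ x * (x ^ s * x ^ c)                           ≡⟨ cong (t ^ d * suc t ^ x *_) (^-distribˡ-+-* x s c) ⟨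
        t ^ d * suc t ^ x * x ^ (s + c)                               ∎
        where
        A = (a + d) C d
        B = (b + d) C d
        S = rise (b + d) s
        fbd = F (b + (d + s))
        u = F a ℤ.* fbd
        w = F (a + d) ℤ.* F b
        U = ∣ F a ∣ * ∣ fbd ∣
        W = ∣ F (a + d) ∣ * ∣ F b ∣
        Z = + A ℤ.* u ℤ.- + (B * S) ℤ.* w
        b+d+s≤x : b + d + s ≤ x
        b+d+s≤x = subst (_≤ x) (sym (+-assoc b d s)) (<⇒≤ (<x abd))
        b+d≤x : b + d ≤ x
        b+d≤x = ≤-trans (m≤m+n (b + d) s) b+d+s≤x
        distribute : ∀ A U B S W τ → (A * U + B * S * W) * τ ≡ A * τ * U + B * τ * (S * W)
        distribute = solve-∀
        collect : ∀ r p U W → r * (p * U) + r * (p * W) ≡ r * (p * (U + W))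
        collect = solve-∀
        A-rise : A * d ! ≡ rise a d
        A-rise = C*!≡rise a d
        BS-rise : B * S * d ! ≡ rise b (d + s)
        BS-rise = trans (permute B S (d !)) (trans (cong (_* S) (C*!≡rise b d)) (sym (rise-+ b d s)))
          where
          permute : ∀ p q r → p * q * r ≡ p * r * q
          permute = solve-∀
        d!*Z : + (d !) ℤ.* Z ≡ + (rise a d) ℤ.* u ℤ.- + (rise b (d + s)) ℤ.* w
        d!*Z = trans (spread (+ (d !)) (+ A) (+ (B * S)) u w)
          (cong₂ (λ m n → m ℤ.* u ℤ.- n ℤ.* w)
            (trans (sym (ℤ.pos-* A (d !))) (cong (λ n → + n) A-rise))
            (trans (sym (ℤ.pos-* (B * S) (d !))) (cong (λ n → + n) BS-rise)))
          where
          spread : ∀ k A B u w → k ℤ.* (A ℤ.* u ℤ.- B ℤ.* w) ≡ A ℤ.* k ℤ.* u ℤ.- B ℤ.* k ℤ.* w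
          spread = ℤ-Solver.solve-∀
        combine : ∀ A B fa fad fb fbd → (A ℤ.* fa ℤ.- fad) ℤ.* fbd ℤ.- fad ℤ.* (B ℤ.* fb ℤ.- fbd)
                  ≡ A ℤ.* (fa ℤ.* fbd) ℤ.- B ℤ.* (fad ℤ.* fb)
        combine = ℤ-Solver.solve-∀
        P∣d!Z : P ∣ d ! * ∣ Z ∣
        P∣d!Z = subst (P ∣_) (ℤ.abs-* (+ (d !)) Z) (ℤ∣.∣⇒∣ᵤ (subst (+ P ℤ∣.∣_)
          (trans (combine (+ (rise a d)) (+ (rise b (d + s))) (F a) (F (a + d)) (F b) fbd) (sym d!*Z))
          (ℤ∣.∣m∣n⇒∣m-n (ℤ∣.∣m⇒∣m*n fbd (link Pa Pad)) (ℤ∣.∣n⇒∣m*n (F (a + d)) (link Pb Pbd)))))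
        P∣Z : P ∣ ∣ Z ∣
        P∣Z = prime-power-cancelˡ e prime (prime∤! d prime (≤-<-trans (m≤n+m d a) (<p aad))) P∣d!Z
        ∣Z∣≢0 : ∣ Z ∣ ≢ 0
        ∣Z∣≢0 ∣Z∣≡0 = distinct (begin-equality
          rise a d * U                              ≡⟨ cong (rise a d *_) (ℤ.abs-* (F a) fbd) ⟨
          rise a d * ∣ u ∣                          ≡⟨ ℤ.abs-* (+ (rise a d)) u ⟨
          ∣ + (rise a d) ℤ.* u ∣                    ≡⟨ cong ∣_∣ (ℤ.i-j≡0⇒i≡j (+ (rise a d) ℤ.* u) (+ (rise b (d + s)) ℤ.* w)
                                                         (trans (sym d!*Z) (trans (cong (+ (d !) ℤ.*_) (ℤ.∣i∣≡0⇒i≡0 ∣Z∣≡0)) (ℤ.*-zeroʳ (+ (d !)))))) ⟩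
          ∣ + (rise b (d + s)) ℤ.* w ∣              ≡⟨ ℤ.abs-* (+ (rise b (d + s))) w ⟩
          rise b (d + s) * ∣ w ∣                    ≡⟨ cong (rise b (d + s) *_) (ℤ.abs-* (F (a + d)) (F b)) ⟩
          rise b (d + s) * W                        ∎)
        ∣Z∣≤ : ∣ Z ∣ ≤ A * U + B * S * W
        ∣Z∣≤ = begin
          ∣ Z ∣                                     ≤⟨ ℤ.∣i-j∣≤∣i∣+∣j∣ (+ A ℤ.* u) _ ⟩
          ∣ + A ℤ.* u ∣ + ∣ + (B * S) ℤ.* w ∣        ≡⟨ cong₂ _+_ (trans (ℤ.abs-* (+ A) u) (cong (A *_) (ℤ.abs-* (F a) fbd)))
                                                                (trans (ℤ.abs-* (+ (B * S)) w) (cong (B * S *_) (ℤ.abs-* (F (a + d)) (F b)))) ⟩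
          A * U + B * S * W                         ∎
        U+W≤ : U + W ≤ x ^ c
        U+W≤ = *-cancelˡ-≤ 2 (begin
          2 * (U + W)          ≡⟨ *-distribˡ-+ 2 U W ⟩
          2 * U + 2 * W        ≤⟨ +-mono-≤ (2*F*F≤ aa abd) (2*F*F≤ aad ab) ⟩
          x ^ c + x ^ c        ≡⟨ cong (λ z → x ^ c + z) (+-identityʳ (x ^ c)) ⟨
          2 * x ^ c            ∎)

-- Gaps between neighbouring points and the choice of two of nearly equal length

module Gaps where

  open import Data.Nat.Base
  open import Data.Nat.Properties
  open import Data.Nat.ListAction using (sum)
  open import Data.Nat.ListAction.Properties using (sum-↭)
  open import Data.Nat.Tactic.RingSolver using (solve-∀)
  open import Data.List.Base using (List; []; _∷_; length; map; filter; take; applyUpTo)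
  open import Data.List.Properties using (filter-all; filter-accept; filter-reject; length-take; length-map; length-applyUpTo)
  open import Data.List.Relation.Unary.All as All using (All; []; _∷_)
  import Data.List.Relation.Unary.All.Properties as All
  open import Data.List.Relation.Unary.AllPairs as AllPairs using (AllPairs; []; _∷_)
  import Data.List.Relation.Unary.AllPairs.Properties as AllPairs
  open import Data.List.Relation.Unary.Any using (here; there)
  open import Data.List.Membership.Propositional using (_∈_; _∉_)
  open import Data.List.Membership.Propositional.Properties using (∈-applyUpTo⁺; ∈-applyUpTo⁻)
  open import Data.List.Relation.Unary.Unique.Propositional using (Unique)
  import Data.List.Relation.Unary.Unique.Propositional.Properties as Unique
  open import Data.List.Relation.Binary.Permutation.Propositional using (_↭_; ↭-sym; ↭⇒↭ₛ)
  open import Data.List.Relation.Binary.Permutation.Propositional.Properties using (All-resp-↭; ∈-resp-↭; ↭-length; map⁺)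
  import Data.List.Relation.Binary.Permutation.Setoid.Properties as Permutation
  open import Data.List.Relation.Unary.Sorted.TotalOrder.Properties using (Sorted⇒AllPairs)
  import Data.List.Sort as Sort
  import Relation.Binary.Construct.On as On
  open import Data.Product.Base using (∃; _×_; _,_; proj₁; proj₂)
  open import Data.Sum.Base using (_⊎_; inj₁; inj₂; swap)
  open import Function.Base using (_on_; _∘_)
  open import Relation.Nullary using (¬?; yes; no; contradiction)
  open import Relation.Binary.PropositionalEquality

  Gap : Set
  Gap = ℕ × ℕ

  left len right : Gap → ℕ
  left = proj₁
  len   = proj₂
  right g = left g + len g

  Disjoint : Gap → Gap → Set
  Disjoint g h = right h ≤ left g ⊎ right g ≤ left h

  gaps : List ℕ → List Gap
  gaps []           = []
  gaps (_ ∷ [])     = []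
  gaps (x ∷ y ∷ xs) = (x , y ∸ x) ∷ gaps (y ∷ xs)

  length-gaps : ∀ x xs → length (gaps (x ∷ xs)) ≡ length xs
  length-gaps x []       = refl
  length-gaps x (y ∷ xs) = cong suc (length-gaps y xs)

  EndsIn : List ℕ → Gap → Set
  EndsIn xs g = left g ∈ xs × right g ∈ xs × 1 ≤ len g

  gaps-ends : ∀ {xs} → AllPairs _<_ xs → All (EndsIn xs) (gaps xs)
  gaps-ends []               = []
  gaps-ends ([] ∷ [])        = []
  gaps-ends {x ∷ y ∷ _} ((x<y ∷ _) ∷ ps) =
    (here refl , there (here (m+[n∸m]≡n (<⇒≤ x<y))) , m<n⇒0<n∸m x<y)
    ∷ All.map (λ (s , e , p) → there s , there e , p) (gaps-ends ps)

  gaps-disjoint : ∀ {xs} → AllPairs _<_ xs → AllPairs Disjoint (gaps xs)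
  gaps-disjoint []        = []
  gaps-disjoint ([] ∷ []) = []
  gaps-disjoint {x ∷ y ∷ _} ((x<y ∷ _) ∷ ps@(y< ∷ _)) =
    All.map (λ (s , _) → inj₂ (≤-trans (≤-reflexive (m+[n∸m]≡n (<⇒≤ x<y))) (All.lookup y≤ s))) (gaps-ends ps)
    ∷ gaps-disjoint ps
    where
    y≤ = ≤-refl ∷ All.map <⇒≤ y<

  gaps-sum : ∀ {x xs} → AllPairs _<_ (x ∷ xs) → ∃ λ y → y ∈ x ∷ xs × y ≡ x + sum (map len (gaps (x ∷ xs)))
  gaps-sum {x} ([] ∷ []) = x , here refl , sym (+-identityʳ x)
  gaps-sum {x} {y ∷ xs} ((x<y ∷ _) ∷ ps) with gaps-sum ps
  ... | z , z∈ , z≡ = z , there z∈ , trans z≡ (trans (cong (λ l → l + sum (map len (gaps (y ∷ xs)))) (sym (m+[n∸m]≡n (<⇒≤ x<y)))) (+-assoc x (y ∸ x) _))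

  sort-strictly : ∀ {xs} → Unique xs → ∃ λ ys → ys ↭ xs × AllPairs _<_ ys
  sort-strictly {xs} xs! = sort xs , sort-↭ xs
    , AllPairs.zipWith (λ (x≤y , x≢y) → ≤∧≢⇒< x≤y x≢y)
        ( Sorted⇒AllPairs ≤-totalOrder (sort-↗ xs)
        , Permutation.Unique-resp-↭ (setoid ℕ) (↭⇒↭ₛ (↭-sym (sort-↭ xs))) xs!)
    where open Sort ≤-decTotalOrder

  Ordered : Gap → Gap → Set
  Ordered g h = Disjoint g h × len g ≤ len h

  sort-by-length : ∀ {gs} → AllPairs Disjoint gs → ∃ λ hs → hs ↭ gs × AllPairs Ordered hs
  sort-by-length {gs} disjoint = sort gs , sort-↭ gs
    , AllPairs.zip
        ( Permutation.AllPairs-resp-↭ (setoid Gap) swap ((λ { refl r → r }) , (λ { refl r → r })) (↭⇒↭ₛ (↭-sym (sort-↭ gs))) disjoint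
        , Sorted⇒AllPairs (On.totalOrder ≤-totalOrder len) (sort-↗ gs))
    where open Sort (On.decTotalOrder ≤-decTotalOrder len)

  module _ (key : Gap → ℕ) (v : ℕ) where
    private
      P? = λ g → ¬? (key g ≟ v)

    -- With distinct keys, once an entry with key v is met, the rest of the list passes the filter
    -- unchanged.
    length-filter-≢ : ∀ {gs} → AllPairs (_≢_ on key) gs → length gs ≤ suc (length (filter P? gs))
    length-filter-≢ [] = z≤n
    length-filter-≢ {g ∷ gs} (g≢ ∷ ps) with key g ≟ v
    ... | yes eq = s≤s (≤-reflexive (cong length (sym (trans (filter-reject P? (λ ne → ne eq))
                     (filter-all P? (All.map (λ ne e → ne (trans eq (sym e))) g≢))))))
    ... | no  ne = s≤s (≤-trans (length-filter-≢ ps) (≤-reflexive (cong length (sym (filter-accept P? ne)))))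

  avoid : ℕ → List Gap → List Gap
  avoid v gs = filter (λ g → ¬? (right g ≟ v)) (filter (λ g → ¬? (left g ≟ v)) gs)

  avoidAll : List ℕ → List Gap → List Gap
  avoidAll []       gs = gs
  avoidAll (v ∷ vs) gs = avoid v (avoidAll vs gs)

  module _ {ℓ} {Q : Gap → Set ℓ} where
    All-avoidAll : ∀ vs {gs} → All Q gs → All Q (avoidAll vs gs)
    All-avoidAll []       q = q
    All-avoidAll (v ∷ vs) q = All.filter⁺ (λ g → ¬? (right g ≟ v)) (All.filter⁺ (λ g → ¬? (left g ≟ v)) (All-avoidAll vs q))

  module _ {ℓ} {R : Gap → Gap → Set ℓ} where
    AllPairs-avoidAll : ∀ vs {gs} → AllPairs R gs → AllPairs R (avoidAll vs gs)
    AllPairs-avoidAll []       r = r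
    AllPairs-avoidAll (v ∷ vs) r = AllPairs.filter⁺ (λ g → ¬? (right g ≟ v)) (AllPairs.filter⁺ (λ g → ¬? (left g ≟ v)) (AllPairs-avoidAll vs r))

  Avoids : List ℕ → Gap → Set
  Avoids vs g = left g ∉ vs × right g ∉ vs

  avoidAll-avoids : ∀ vs gs → All (Avoids vs) (avoidAll vs gs)
  avoidAll-avoids []       gs = All.universal (λ _ → (λ ()) , (λ ())) gs
  avoidAll-avoids (v ∷ vs) gs = All.zipWith (λ { (e≢v , s≢v , s∉ , e∉) → ∉-∷ s≢v s∉ , ∉-∷ e≢v e∉ })
    ( All.all-filter (λ g → ¬? (right g ≟ v)) ks
    , All.filter⁺ (λ g → ¬? (right g ≟ v)) (All.zip
        ( All.all-filter (λ g → ¬? (left g ≟ v)) (avoidAll vs gs)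
        , All.filter⁺ (λ g → ¬? (left g ≟ v)) (avoidAll-avoids vs gs))))
    where
    ks = filter (λ g → ¬? (left g ≟ v)) (avoidAll vs gs)
    ∉-∷ : ∀ {y} → y ≢ v → y ∉ vs → y ∉ v ∷ vs
    ∉-∷ y≢v y∉ (here y≡v)  = y≢v y≡v
    ∉-∷ y≢v y∉ (there y∈)  = y∉ y∈

  -- Every point is the left end of at most one gap and the right end of at most one.
  length-avoidAll : ∀ vs {gs} → All (λ g → 1 ≤ len g) gs → AllPairs Disjoint gs →
                    length gs ≤ 2 * length vs + length (avoidAll vs gs)
  length-avoidAll []       _   _        = ≤-refl
  length-avoidAll (v ∷ vs) {gs} pos disjoint = begin
    length gs                                             ≤⟨ length-avoidAll vs pos disjoint ⟩
    2 * length vs + length hs                             ≤⟨ +-monoʳ-≤ (2 * length vs) (length-filter-≢ left v (distinct starts≢)) ⟩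
    2 * length vs + suc (length ks)                       ≤⟨ +-monoʳ-≤ (2 * length vs) (s≤s (length-filter-≢ right v (AllPairs.filter⁺ _ (distinct ends≢)))) ⟩
    2 * length vs + suc (suc (length (avoid v hs)))       ≡⟨ regroup (length vs) _ ⟩
    2 * suc (length vs) + length (avoid v hs)             ∎
    where
    open ≤-Reasoning
    hs = avoidAll vs gs
    ks = filter (λ g → ¬? (left g ≟ v)) hs
    regroup : ∀ a b → 2 * a + (1 + (1 + b)) ≡ 2 * (1 + a) + b
    regroup = solve-∀
    Positive : Gap → Set
    Positive g = 1 ≤ len g
    distinct : ∀ {key : Gap → ℕ} → (∀ {g h} → Positive g → Positive h → Disjoint g h → key g ≢ key h) →
               AllPairs (_≢_ on key) hs
    distinct {key} sep = go (All-avoidAll vs pos) (AllPairs-avoidAll vs disjoint)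
      where
      go : ∀ {js} → All Positive js → AllPairs Disjoint js → AllPairs (_≢_ on key) js
      go []       []       = []
      go (q ∷ qs) (d ∷ ds) = All.zipWith (λ (q′ , d′) → sep q q′ d′) (qs , d) ∷ go qs ds
    n<n+d : ∀ {n d} → 1 ≤ d → n < n + d
    n<n+d {n} 1≤d = m<m+n n 1≤d
    starts≢ : ∀ {g h} → Positive g → Positive h → Disjoint g h → left g ≢ left h
    starts≢ pg ph (inj₁ e≤s) eq = <⇒≱ (n<n+d ph) (≤-trans e≤s (≤-reflexive eq))
    starts≢ pg ph (inj₂ e≤s) eq = <⇒≱ (n<n+d pg) (≤-trans e≤s (≤-reflexive (sym eq)))
    ends≢ : ∀ {g h} → Positive g → Positive h → Disjoint g h → right g ≢ right h
    ends≢ pg ph (inj₁ e≤s) eq = <⇒≱ (n<n+d pg) (≤-trans (≤-reflexive eq) e≤s)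
    ends≢ pg ph (inj₂ e≤s) eq = <⇒≱ (n<n+d ph) (≤-trans (≤-reflexive (sym eq)) e≤s)

  -- nth xs i is 0 when i is out of range.
  nth : List ℕ → ℕ → ℕ
  nth []       _       = 0
  nth (x ∷ xs) zero    = x
  nth (x ∷ xs) (suc i) = nth xs i

  prefixSum : List ℕ → ℕ → ℕ
  prefixSum xs zero    = 0
  prefixSum xs (suc j) = prefixSum xs j + nth xs j

  prefixSum-∷ : ∀ x xs j → prefixSum (x ∷ xs) (suc j) ≡ x + prefixSum xs j
  prefixSum-∷ x xs zero    = +-comm 0 x
  prefixSum-∷ x xs (suc j) = trans (cong (_+ nth xs j) (prefixSum-∷ x xs j)) (+-assoc x (prefixSum xs j) (nth xs j))

  prefixSum≤sum : ∀ xs j → prefixSum xs j ≤ sum xs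
  prefixSum≤sum xs       zero    = z≤n
  prefixSum≤sum []       (suc j) = ≤-trans (≤-reflexive (+-identityʳ _)) (prefixSum≤sum [] j)
  prefixSum≤sum (x ∷ xs) (suc j) = ≤-trans (≤-reflexive (prefixSum-∷ x xs j)) (+-monoʳ-≤ x (prefixSum≤sum xs j))

  nth-All : ∀ {ℓ} {Q : ℕ → Set ℓ} {xs i} → All Q xs → i < length xs → Q (nth xs i)
  nth-All {i = zero}  (q ∷ _)  _       = q
  nth-All {i = suc i} (_ ∷ qs) (s≤s l) = nth-All qs l

  nth-suc-mono : ∀ {xs i} → AllPairs _≤_ xs → suc i < length xs → nth xs i ≤ nth xs (suc i)
  nth-suc-mono {i = zero}  (x≤ ∷ _) (s≤s l) = nth-All x≤ l
  nth-suc-mono {i = suc i} (_ ∷ ps) (s≤s l) = nth-suc-mono ps l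

  take-≤nth : ∀ {gs q} → AllPairs Ordered gs → q < length gs →
              All (λ g → len g ≤ nth (map len gs) q) (take (suc q) gs)
  take-≤nth {g ∷ gs} {zero}  _        _       = ≤-refl ∷ []
  take-≤nth {g ∷ gs} {suc q} (o ∷ os) (s≤s l) =
    nth-All (All.map⁺ (All.map proj₂ o)) (subst (q <_) (sym (length-map len gs)) l) ∷ take-≤nth os l

  everyOther : List ℕ → ℕ → ℕ → ℕ
  everyOther xs m k = nth xs (m + 2 * k)

  ΣN : ℕ → (ℕ → ℕ) → ℕ
  ΣN zero    F = 0
  ΣN (suc N) F = ΣN N F + F N

  -- Each selected length is at most its right neighbour, which is not selected, so the selected
  -- lengths may be counted twice. This is the origin of the factor 1/2 in the theorem.
  2*everyOther≤sum : ∀ {xs} m N → AllPairs _≤_ xs → m + 2 * N ≤ length xs → 2 * ΣN N (everyOther xs m) ≤ sum xs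
  2*everyOther≤sum {xs} m N sorted l = ≤-trans (go N l) (prefixSum≤sum xs (m + 2 * N))
    where
    open ≤-Reasoning
    next : ∀ N → m + 2 * suc N ≡ suc (suc (m + 2 * N))
    next N = shift m N
      where
      shift : ∀ m N → m + 2 * (1 + N) ≡ 1 + (1 + (m + 2 * N))
      shift = solve-∀
    go : ∀ N → m + 2 * N ≤ length xs → 2 * ΣN N (everyOther xs m) ≤ prefixSum xs (m + 2 * N)
    go zero    l = z≤n
    go (suc N) l = begin
      2 * (ΣN N (everyOther xs m) + y)                     ≡⟨ spread (ΣN N (everyOther xs m)) y ⟩
      2 * ΣN N (everyOther xs m) + y + y                   ≤⟨ +-mono-≤ (+-monoˡ-≤ y (go N (≤-trans (≤-trans (n≤1+n _) (n≤1+n _)) l′)))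
                                                                       (nth-suc-mono sorted l′) ⟩
      prefixSum xs (suc (suc (m + 2 * N)))                 ≡⟨ cong (prefixSum xs) (next N) ⟨
      prefixSum xs (m + 2 * suc N)                         ∎
      where
      y = nth xs (m + 2 * N)
      l′ : suc (suc (m + 2 * N)) ≤ length xs
      l′ = subst (_≤ length xs) (next N) l
      spread : ∀ s y → 2 * (s + y) ≡ 2 * s + y + y
      spread = solve-∀

  -- The alternative in `separated` matches the two criteria for nonvanishing: equal lengths, or
  -- lengths that differ by more than a multiple of log x. For H = 1 it is automatic.
  record ClosePair (M H G : ℕ) (gs : List Gap) : Set where
    constructor close-pair
    field
      {g h}     : Gap
      g∈        : g ∈ gs
      h∈        : h ∈ gs
      ordered   : Ordered g h
      close     : M * (len h ∸ len g) ≤ G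
      separated : len h ≡ len g ⊎ len g + H ≤ len h

  module _ (M H G : ℕ) where

    weaken : ∀ {gs gs′} → (∀ {g} → g ∈ gs → g ∈ gs′) → ClosePair M H G gs → ClosePair M H G gs′
    weaken sub (close-pair g∈ h∈ o c s) = close-pair (sub g∈) (sub h∈) o c s

    equal-pair : ∀ {g h gs} → g ∈ gs → h ∈ gs → Ordered g h → len h ≡ len g → ClosePair M H G gs
    equal-pair {g} {h} g∈ h∈ o eq =
      close-pair g∈ h∈ o (subst (_≤ G) (sym (trans (cong (M *_) (m≤n⇒m∸n≡0 (≤-reflexive eq))) (*-zeroʳ M))) z≤n) (inj₁ eq)

    -- Along the sorted list either two neighbouring lengths coincide, which is already a pair, or
    -- each of the k steps raises the length by at least 1.
    jump : ∀ {g gs} k → k ≤ length gs → AllPairs Ordered (g ∷ gs) →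
           ClosePair M H G (g ∷ gs) ⊎
           ∃ λ h → ∃ λ hs → AllPairs Ordered (h ∷ hs) × length gs ≡ k + length hs ×
             (∀ {j} → j ∈ h ∷ hs → j ∈ g ∷ gs) × (1 ≤ k → h ∈ gs) × len g + k ≤ len h
    jump {g} {gs} zero _ os = inj₂ (g , gs , os , refl , (λ j∈ → j∈) , (λ ()) , ≤-reflexive (+-identityʳ (len g)))
    jump {g} {h ∷ gs} (suc k) (s≤s l) ((o ∷ os′) ∷ os) with len h ≟ len g
    ... | yes eq = inj₁ (equal-pair (here refl) (there (here refl)) o eq)
    ... | no  ne with jump k l os
    ...   | inj₁ p = inj₁ (weaken there p)
    ...   | inj₂ (j , js , os″ , len≡ , sub , j∈ , l′) =
      inj₂ (j , js , os″ , cong suc len≡ , (λ i∈ → there (sub i∈)) , (λ _ → sub (here refl)) , (begin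
        len g + suc k     ≡⟨ +-suc (len g) k ⟩
        suc (len g) + k   ≤⟨ +-monoˡ-≤ k (≤∧≢⇒< (proj₂ o) (λ e → ne (sym e))) ⟩
        len h + k         ≤⟨ l′ ⟩
        len j             ∎))
      where open ≤-Reasoning

    -- A window of H gaps without equal lengths has ends that differ by at least H. If these ends
    -- are not a close pair, the window raises M times the length by at least G + 1.
    climb : ∀ {g gs} → 1 ≤ H → ∀ m → m * H ≤ length gs → AllPairs Ordered (g ∷ gs) →
            ClosePair M H G (g ∷ gs) ⊎ ∃ λ h → h ∈ g ∷ gs × M * len g + m * suc G ≤ M * len h
    climb {g} 1≤H zero _ _ = inj₂ (g , here refl , ≤-reflexive (+-identityʳ (M * len g)))
    climb {g} {gs} 1≤H (suc m) l os@(o ∷ _) with jump H (≤-trans (m≤m+n H (m * H)) l) os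
    ... | inj₁ p = inj₁ p
    ... | inj₂ (h , hs , os′ , len≡ , sub , h∈ , l′) with M * (len h ∸ len g) ≤? G
    ...   | yes c = inj₁ (close-pair (here refl) (there (h∈ 1≤H)) (All.lookup o (h∈ 1≤H)) c (inj₂ l′))
    ...   | no ¬c with climb 1≤H m (+-cancelˡ-≤ H (m * H) (length hs) (subst (H + m * H ≤_) len≡ l)) os′
    ...     | inj₁ p = inj₁ (weaken sub p)
    ...     | inj₂ (j , j∈ , l″) = inj₂ (j , sub j∈ , (begin
      M * len g + (suc G + m * suc G)                ≡⟨ +-assoc (M * len g) (suc G) (m * suc G) ⟨
      M * len g + suc G + m * suc G                  ≤⟨ +-monoˡ-≤ (m * suc G) (+-monoʳ-≤ (M * len g) (≰⇒> ¬c)) ⟩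
      M * len g + M * (len h ∸ len g) + m * suc G    ≡⟨ cong (_+ m * suc G) (trans (sym (*-distribˡ-+ M (len g) _)) (cong (M *_) (m+[n∸m]≡n (≤-trans (m≤m+n (len g) H) l′)))) ⟩
      M * len h + m * suc G                          ≤⟨ l″ ⟩
      M * len j                                      ∎))
      where open ≤-Reasoning

    -- If all M windows failed, `climb` would reach a length of at least G + 1.
    pigeonhole : ∀ {gs} → 1 ≤ M → 1 ≤ H → suc (M * H) ≤ length gs → AllPairs Ordered gs →
                 All (λ g → len g ≤ G) gs → ClosePair M H G gs
    pigeonhole {g ∷ gs} 1≤M 1≤H (s≤s l) os small with climb 1≤H M l os
    ... | inj₁ p = p
    ... | inj₂ (h , h∈ , l′) = contradiction
      (≤-trans (m≤n+m (M * suc G) (M * len g)) (≤-trans l′ (*-monoʳ-≤ M (All.lookup small h∈))))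
      (<⇒≱ (*-monoʳ-< M {{>-nonZero 1≤M}} (n<1+n G)))

  record ClosePairOf (n : ℕ → ℕ) (t′ M H G : ℕ) : Set where
    field
      {a d b s} : ℕ
      left₁    : ∃ λ i → 1 ≤ i × i ≤ t′ × a ≡ n i
      right₁      : ∃ λ i → 1 ≤ i × i ≤ t′ × a + d ≡ n i
      left₂    : ∃ λ i → 1 ≤ i × i ≤ t′ × b ≡ n i
      right₂      : ∃ λ i → 1 ≤ i × i ≤ t′ × b + (d + s) ≡ n i
      positive  : 1 ≤ d
      disjoint  : b + (d + s) ≤ a ⊎ a + d ≤ b
      short     : d ≤ G
      close     : M * s ≤ G
      separated : s ≡ 0 ⊎ H ≤ s

  module Selection (n : ℕ → ℕ) (t M H N : ℕ) (1≤M : 1 ≤ M) (1≤H : 1 ≤ H)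
    (enough : suc (M * H + 2 * N) ≤ t)
    (injective : ∀ i j → 1 ≤ i → i ≤ t → 1 ≤ j → j ≤ t → n i ≡ n j → i ≡ j)
    where

    open ≤-Reasoning

    private
      points : List ℕ
      points = applyUpTo (λ i → n (suc i)) t

      points! : Unique points
      points! = Unique.applyUpTo⁺₁ _ t λ {i} {j} i<j j<t eq →
        <⇒≢ i<j (suc-injective (injective (suc i) (suc j) (s≤s z≤n) (<-trans i<j j<t) (s≤s z≤n) j<t eq))

      sorted : List ℕ
      sorted = proj₁ (sort-strictly points!)

      sorted↭points : sorted ↭ points
      sorted↭points = proj₁ (proj₂ (sort-strictly points!))

      increasing : AllPairs _<_ sorted
      increasing = proj₂ (proj₂ (sort-strictly points!))

      length-sorted : length sorted ≡ t
      length-sorted = trans (↭-length sorted↭points) (length-applyUpTo _ t)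

      by-length = sort-by-length (gaps-disjoint increasing)

      gs : List Gap
      gs = proj₁ by-length

      gs↭ : gs ↭ gaps sorted
      gs↭ = proj₁ (proj₂ by-length)

      ordered : AllPairs Ordered gs
      ordered = proj₂ (proj₂ by-length)

      lens : List ℕ
      lens = map len gs

      suc-length-gs : suc (length gs) ≡ t
      suc-length-gs = trans (cong suc (↭-length gs↭)) (lemma sorted length-sorted (≤-trans (s≤s z≤n) enough))
        where
        lemma : ∀ xs → length xs ≡ t → 1 ≤ t → suc (length (gaps xs)) ≡ t
        lemma []       refl ()
        lemma (x ∷ xs) eq   _ = trans (cong suc (length-gaps x xs)) eq

      enough′ : M * H + 2 * N ≤ length gs
      enough′ = ≤-pred (subst (suc (M * H + 2 * N) ≤_) (sym suc-length-gs) enough)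

      point-index : ∀ {y} → y ∈ sorted → ∃ λ i → 1 ≤ i × i ≤ t × y ≡ n i
      point-index y∈ with ∈-applyUpTo⁻ (λ i → n (suc i)) (∈-resp-↭ sorted↭points y∈)
      ... | i , i<t , eq = suc i , s≤s z≤n , i<t , eq

      gs-ends : All (EndsIn sorted) gs
      gs-ends = All-resp-↭ (↭-sym gs↭) (gaps-ends increasing)

    G : ℕ → ℕ
    G = everyOther lens (M * H)

    -- The gap lengths add up to the distance between the extreme points. Recording these by their
    -- indices allows W to be compared with x as well as with the length of J.
    width : ∃ λ W → (∃ λ i → ∃ λ j → 1 ≤ i × i ≤ t × 1 ≤ j × j ≤ t × n j ≡ n i + W) × 2 * ΣN N G ≤ W
    width = sum lens , endpoints , 2*everyOther≤sum (M * H) N (AllPairs.map⁺ (AllPairs.map proj₂ ordered))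
                                     (subst (M * H + 2 * N ≤_) (sym (length-map len gs)) enough′)
      where
      sum-lens : sum lens ≡ sum (map len (gaps sorted))
      sum-lens = sum-↭ (map⁺ len gs↭)
      first-last : ∀ xs → length xs ≡ t → AllPairs _<_ xs → ∃ λ y → ∃ λ z → y ∈ xs × z ∈ xs × z ≡ y + sum (map len (gaps xs))
      first-last []       refl _   = contradiction enough (λ ())
      first-last (x ∷ xs) _    inc with gaps-sum inc
      ... | z , z∈ , z≡ = x , z , here refl , z∈ , z≡
      endpoints : ∃ λ i → ∃ λ j → 1 ≤ i × i ≤ t × 1 ≤ j × j ≤ t × n j ≡ n i + sum lens
      endpoints with first-last sorted length-sorted increasing
      ... | y , z , y∈ , z∈ , z≡ with point-index y∈ | point-index z∈
      ... | i , 1≤i , i≤t , y≡ | j , 1≤j , j≤t , z≡′ =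
        i , j , 1≤i , i≤t , 1≤j , j≤t , trans (sym z≡′) (trans z≡ (cong₂ _+_ y≡ (sym sum-lens)))

    select : ∀ k t′ → k < N → t′ + k ≡ t → ClosePairOf n t′ M H (G k)
    select k t′ k<N t′+k≡t = record
      { left₁ = surviving (proj₁ ge) (proj₁ ga)
      ; right₁   = surviving (proj₁ (proj₂ ge)) (proj₂ ga)
      ; left₂ = surviving (proj₁ he) (proj₁ ha)
      ; right₂   = subst (λ l → ∃ λ i → 1 ≤ i × i ≤ t′ × left h + l ≡ n i) (sym len-h) (surviving (proj₁ (proj₂ he)) (proj₂ ha))
      ; positive  = proj₂ (proj₂ ge)
      ; disjoint  = subst (λ l → left h + l ≤ left g ⊎ right g ≤ left h) (sym len-h) (proj₁ ordered-gh)
      ; short     = All.lookup short g∈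
      ; close     = ClosePair.close cp
      ; separated = separated′ (ClosePair.separated cp)
      }
      where
      -- Positions count from 0, so q + 1 gaps are taken. The k removed points spoil at most 2k of
      -- them, which leaves the MH + 1 that M windows require.
      q = M * H + 2 * k
      q<length : q < length gs
      q<length = <-≤-trans (+-monoʳ-< (M * H) (*-monoʳ-< 2 k<N)) enough′
      removed : List ℕ
      removed = applyUpTo (λ i → n (suc (t′ + i))) k
      alive : List Gap
      alive = avoidAll removed (take (suc q) gs)
      short : All (λ g → len g ≤ G k) alive
      short = All-avoidAll removed (take-≤nth ordered q<length)
      many : suc (M * H) ≤ length alive
      many = +-cancelˡ-≤ (2 * k) _ _ (begin
        2 * k + suc (M * H)                        ≡⟨ +-suc (2 * k) (M * H) ⟩
        suc (2 * k + M * H)                        ≡⟨ cong suc (+-comm (2 * k) (M * H)) ⟩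
        suc q                                      ≡⟨ m≤n⇒m⊓n≡m q<length ⟨
        suc q ⊓ length gs                          ≡⟨ length-take (suc q) gs ⟨
        length (take (suc q) gs)                   ≤⟨ length-avoidAll removed (All.take⁺ (suc q) (All.map (proj₂ ∘ proj₂) gs-ends))
                                                        (AllPairs.take⁺ (suc q) (AllPairs.map proj₁ ordered)) ⟩
        2 * length removed + length alive          ≡⟨ cong (λ l → 2 * l + length alive) (length-applyUpTo _ k) ⟩
        2 * k + length alive                       ∎)
      cp : ClosePair M H (G k) alive
      cp = pigeonhole M H (G k) 1≤M 1≤H many (AllPairs-avoidAll removed (AllPairs.take⁺ (suc q) ordered)) short
      open ClosePair cp using (g; h; g∈; h∈) renaming (ordered to ordered-gh)
      len-h : len g + (len h ∸ len g) ≡ len h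
      len-h = m+[n∸m]≡n (proj₂ ordered-gh)
      alive-ends : All (EndsIn sorted) alive
      alive-ends = All-avoidAll removed (All.take⁺ (suc q) gs-ends)
      avoids : All (Avoids removed) alive
      avoids = avoidAll-avoids removed (take (suc q) gs)
      ge = All.lookup alive-ends g∈
      he = All.lookup alive-ends h∈
      ga = All.lookup avoids g∈
      ha = All.lookup avoids h∈
      separated′ : len h ≡ len g ⊎ len g + H ≤ len h → len h ∸ len g ≡ 0 ⊎ H ≤ len h ∸ len g
      separated′ (inj₁ eq) = inj₁ (m≤n⇒m∸n≡0 (≤-reflexive eq))
      separated′ (inj₂ l)  = inj₂ (subst (_≤ len h ∸ len g) (m+n∸m≡n (len g) H) (∸-monoˡ-≤ (len g) l))
      surviving : ∀ {y} → y ∈ sorted → y ∉ removed → ∃ λ i → 1 ≤ i × i ≤ t′ × y ≡ n i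
      surviving {y} y∈ y∉ with point-index y∈
      ... | i , 1≤i , i≤t , y≡ with i ≤? t′
      ...   | yes i≤t′ = i , 1≤i , i≤t′ , y≡
      ...   | no  i≰t′ = contradiction (subst (_∈ removed) (sym y≡n) (∈-applyUpTo⁺ (λ i → n (suc (t′ + i))) j<k)) y∉
        where
        j = i ∸ suc t′
        i≡ : suc (t′ + j) ≡ i
        i≡ = m+[n∸m]≡n (≰⇒> i≰t′)
        y≡n : y ≡ n (suc (t′ + j))
        y≡n = trans y≡ (cong n (sym i≡))
        j<k : j < k
        j<k = +-cancelˡ-< t′ j k (subst₂ _≤_ (sym i≡) (sym t′+k≡t) i≤t)

-- The product over t′ in natural numbers

module Multiplicative where

  open import Defs using (ℤ[X]; NonZeroPoly; shiftedFactorial; sumFrom)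
  open import Data.Nat.Base
  open import Data.Nat.Properties
  open import Data.Nat.DivMod using (m≡m%n+[m/n]*n; m/n*n≤m; m%n<n)
  open import Data.Nat.Divisibility using (_∣_)
  open import Data.Nat.Primality using (Prime)
  open import Data.Nat.Tactic.RingSolver using (solve-∀)
  open import Data.Integer.Base using (∣_∣)
  open import Data.Product.Base using (∃; _×_; _,_; proj₁; proj₂)
  open import Data.Sum.Base using (_⊎_; inj₁; inj₂)
  open import Relation.Nullary using (yes; no; Dec)
  open import Relation.Binary.PropositionalEquality
  open import Function.Base using (it)
  open Arithmetic
  open PolynomialGrowth
  open RisingFactorials
  open Relations
  open Gaps

  -- For j = 49: H ≤ t^0.01 and y ≥ 9 t^0.99 imply y ≥ 9H t^0.98.
  halve-exponents : ∀ j H t y → H ^ (suc j * 2) ≤ t → 9 ^ (suc j * 2) * t ^ suc (j * 2) ≤ y ^ (suc j * 2) →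
                    (9 * H) ^ suc j * t ^ j ≤ y ^ suc j
  halve-exponents j H t y H≤t large = ^-cancelˡ-≤ 2 (begin
    ((9 * H) ^ suc j * t ^ j) ^ 2                    ≡⟨ ^-distribʳ-* 2 ((9 * H) ^ suc j) (t ^ j) ⟩
    ((9 * H) ^ suc j) ^ 2 * (t ^ j) ^ 2              ≡⟨ cong₂ _*_ (^-*-assoc (9 * H) (suc j) 2) (^-*-assoc t j 2) ⟩
    (9 * H) ^ (suc j * 2) * t ^ (j * 2)              ≡⟨ cong (_* t ^ (j * 2)) (^-distribʳ-* (suc j * 2) 9 H) ⟩
    9 ^ (suc j * 2) * H ^ (suc j * 2) * t ^ (j * 2)  ≤⟨ *-monoˡ-≤ (t ^ (j * 2)) (*-monoʳ-≤ (9 ^ (suc j * 2)) H≤t) ⟩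
    9 ^ (suc j * 2) * t * t ^ (j * 2)                ≡⟨ *-assoc (9 ^ (suc j * 2)) t (t ^ (j * 2)) ⟩
    9 ^ (suc j * 2) * t ^ suc (j * 2)                ≤⟨ large ⟩
    y ^ (suc j * 2)                                  ≡⟨ ^-*-assoc y (suc j) 2 ⟨
    (y ^ suc j) ^ 2                                  ∎)
    where open ≤-Reasoning

  module _ (t H R j : ℕ) .{{_ : NonZero t}} .{{_ : NonZero H}}
    (halved : (9 * H) ^ suc j * t ^ j ≤ suc R ^ suc j) where

    open ≤-Reasoning

    private
      -- The largest M with MH + 3 ≤ R. The 3 arises because MH + 2N + 1 ≤ t is required and 2N + R
      -- = t + 2.
      M = (R ∸ 3) / H

      9H≤1+R : 9 * H ≤ suc R
      9H≤1+R = ^-cancelˡ-≤ (suc j) (≤-trans (m≤m*n _ (t ^ j) {{m^n≢0 t j}}) halved)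

      2H+6≤R : 2 * H + 6 ≤ R
      2H+6≤R = ≤-pred (begin
        suc (2 * H + 6)     ≡⟨ shift (2 * H) ⟩
        2 * H + 7 * 1       ≤⟨ +-monoʳ-≤ (2 * H) (*-monoʳ-≤ 7 (>-nonZero⁻¹ H)) ⟩
        2 * H + 7 * H       ≡⟨ collect H ⟩
        9 * H               ≤⟨ 9H≤1+R ⟩
        suc R               ∎)
        where
        shift : ∀ a → 1 + (a + 6) ≡ a + 7 * 1
        shift = solve-∀
        collect : ∀ H → 2 * H + 7 * H ≡ 9 * H
        collect = solve-∀

      3≤R : 3 ≤ R
      3≤R = ≤-trans (≤-trans (s≤s (s≤s (s≤s z≤n))) (m≤n+m 6 (2 * H))) 2H+6≤R

      R<MH+H+3 : R < M * H + (H + 3)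
      R<MH+H+3 = begin-strict
        R                                    ≡⟨ m∸n+n≡m 3≤R ⟨
        R ∸ 3 + 3                            ≡⟨ cong (_+ 3) (m≡m%n+[m/n]*n (R ∸ 3) H) ⟩
        (R ∸ 3) % H + M * H + 3              <⟨ +-monoˡ-< 3 (+-monoˡ-< (M * H) (m%n<n (R ∸ 3) H)) ⟩
        H + M * H + 3                        ≡⟨ permute H (M * H) ⟩
        M * H + (H + 3)                      ∎
        where
        permute : ∀ a b → a + b + 3 ≡ b + (a + 3)
        permute = solve-∀

      H+3≤MH : H + 3 ≤ M * H
      H+3≤MH = +-cancelʳ-≤ (H + 3) _ _ (begin
        H + 3 + (H + 3)      ≡⟨ collect H ⟩
        2 * H + 6            ≤⟨ 2H+6≤R ⟩
        R                    ≤⟨ <⇒≤ R<MH+H+3 ⟩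
        M * H + (H + 3)      ∎)
        where
        collect : ∀ H → H + 3 + (H + 3) ≡ 2 * H + 6
        collect = solve-∀

      1+R≤2MH : suc R ≤ 2 * M * H
      1+R≤2MH = begin
        suc R                 ≤⟨ R<MH+H+3 ⟩
        M * H + (H + 3)       ≤⟨ +-monoʳ-≤ (M * H) H+3≤MH ⟩
        M * H + M * H         ≡⟨ collect M H ⟩
        2 * M * H             ∎
        where
        collect : ∀ M H → M * H + M * H ≡ 2 * M * H
        collect = solve-∀

    -- The constant 9 ensures R ≥ 2H + 6, so that rounding down to a multiple of H costs at most a
    -- factor 2 and R + 1 ≤ 2MH. Cancelling H then leaves 2M ≥ t^(j/(j+1)).
    window-count : ∃ λ M → 1 ≤ M × M * H + 3 ≤ R × t ^ j ≤ (2 * M) ^ suc j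
    window-count = M
      , n≢0⇒n>0 (λ M≡0 → <⇒≱ (≤-trans (m≤n+m 1 H) (≤-trans (+-monoʳ-≤ H (s≤s z≤n)) H+3≤MH)) (≤-reflexive (cong (_* H) M≡0)))
      , subst (M * H + 3 ≤_) (m∸n+n≡m 3≤R) (+-monoˡ-≤ 3 (m/n*n≤m (R ∸ 3) H))
      , *-cancelˡ-≤ (H ^ suc j) {{m^n≢0 H (suc j)}} (begin
          H ^ suc j * t ^ j               ≤⟨ *-monoˡ-≤ (t ^ j) (^-monoˡ-≤ (suc j) (m≤n*m H 9)) ⟩
          (9 * H) ^ suc j * t ^ j         ≤⟨ halved ⟩
          suc R ^ suc j                   ≤⟨ ^-monoˡ-≤ (suc j) 1+R≤2MH ⟩
          (2 * M * H) ^ suc j             ≡⟨ trans (^-distribʳ-* (suc j) (2 * M) H) (*-comm ((2 * M) ^ suc j) (H ^ suc j)) ⟩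
          H ^ suc j * (2 * M) ^ suc j     ∎)

  x^≤2^ : ∀ {x} L η → x < 2 ^ L → x ^ η ≤ 2 ^ (L * η)
  x^≤2^ L η x<2^L = ≤-trans (^-monoˡ-≤ η (<⇒≤ x<2^L)) (≤-reflexive (^-*-assoc 2 L η))

  -- The least s to which `distinct-lengths` applies.
  windowLength : ℕ → ℕ → ℕ
  windowLength c L = suc (2 * L + L * c)

  -- A bound for (tLd)²/x when t < hᵐ and d² ≤ 2x(1 + L(h + c)). If it is at most x, then tLd ≤ x.
  polylogarithm : ℕ → ℕ → ℕ → ℕ
  polylogarithm c m L = h ^ m * h ^ m * (L * L) * (2 * suc (L * (h + c)))
    where
    h = windowLength c L

  module Estimate
    {f : ℤ[X]} (g : Growth f) (E : ℕ) .{{_ : NonZero E}} (B : ℕ)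
    (x L p : ℕ) .{{_ : NonZero x}} (x<2^L : x < 2 ^ L) (prime : Prime p)
    (x-large : E * Growth.threshold g ≤ x)
    (x-large′ : 2 * (Growth.scale g * Growth.scale g) ≤ x)
    (x-large″ : E * (Growth.scale g * (E ^ Growth.degree g * Growth.scale g)) ≤ x)
    (m : ℕ)
    (polylog : polylogarithm (2 * Growth.degree g + 1) m L ≤ x)
    (t : ℕ) .{{_ : NonZero t}} (tL≤ : t * L ≤ B * x)
    (n : ℕ → ℕ)
    (<x  : ∀ j → 1 ≤ j → j ≤ t → n j < x)
    (<p  : ∀ j → 1 ≤ j → j ≤ t → n j < p)
    (≤E* : ∀ j → 1 ≤ j → j ≤ t → x ≤ E * n j)
    where

    open Congruences g E x L p x<2^L prime x-large x-large′ x-large″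
    open ≤-Reasoning

    -- Chosen so that tLη ≤ Kx for both kinds of loss x^η: for η ≤ κ + c because tL ≤ Bx, and for η
    -- = d + c with tLd ≤ x, where the summand 1 pays for d.
    K : ℕ
    K = B * (κ + c) + 1

    H₀ : ℕ
    H₀ = windowLength c L

    -- In the second case t is below a power of log x and H is not tied to log x; it will be 1.
    Scale : ℕ → Set
    Scale H = H ≡ H₀ ⊎ t < H₀ ^ m

    -- The powers of x are booked in two accounts. Those in s are paid for by the gap lengths and
    -- end up in x log x / t^0.98; those in η are small enough for t of them to fit into the term
    -- Kx.
    Bounded : ℕ → ℕ → ℕ → Set
    Bounded P M G = ∃ λ s → ∃ λ η → P * t ^ x ≤ t ^ G * suc t ^ x * x ^ (s + η) × M * s ≤ G × t * (L * η) ≤ K * x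

    private
      tLη≤ : ∀ {η} → η ≤ κ + c → t * (L * η) ≤ K * x
      tLη≤ {η} η≤ = begin
        t * (L * η)             ≡⟨ *-assoc t L η ⟨
        t * L * η               ≤⟨ *-mono-≤ tL≤ η≤ ⟩
        B * x * (κ + c)         ≤⟨ m≤m+n _ x ⟩
        B * x * (κ + c) + x     ≡⟨ collect B x (κ + c) ⟩
        K * x                   ∎
        where
        collect : ∀ B x k → B * x * k + x ≡ (B * k + 1) * x
        collect = solve-∀

      tLd≤ : ∀ {d} → t * (L * d) ≤ x → t * (L * (d + c)) ≤ K * x
      tLd≤ {d} l = begin
        t * (L * (d + c))             ≡⟨ spread t L d c ⟩
        t * (L * d) + t * L * c       ≤⟨ +-mono-≤ l (*-mono-≤ tL≤ (m≤n+m c κ)) ⟩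
        x + B * x * (κ + c)           ≡⟨ collect B x (κ + c) ⟩
        K * x                         ∎
        where
        spread : ∀ t L d c → t * (L * (d + c)) ≡ t * (L * d) + t * L * c
        spread = solve-∀
        collect : ∀ B x k → x + B * x * k ≡ (B * k + 1) * x
        collect = solve-∀

      via-single : ∀ {P M G d} → P ≤ x ^ (d + c) → t * (L * (d + c)) ≤ K * x → Bounded P M G
      via-single {P} {M} {G} {d} P≤ l = 0 , d + c , (begin
          P * t ^ x                                 ≤⟨ *-mono-≤ P≤ (^-monoˡ-≤ x (n≤1+n t)) ⟩
          x ^ (d + c) * suc t ^ x                   ≤⟨ m≤n*m _ (t ^ G) {{m^n≢0 t G}} ⟩
          t ^ G * (x ^ (d + c) * suc t ^ x)         ≡⟨ permute (t ^ G) (x ^ (d + c)) (suc t ^ x) ⟩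
          t ^ G * suc t ^ x * x ^ (d + c)           ∎)
        , ≤-trans (≤-reflexive (*-zeroʳ M)) z≤n , l
        where
        permute : ∀ p q r → p * (q * r) ≡ p * r * q
        permute = solve-∀

    -- Equal lengths: if d > κ the pair works, and if d ≤ κ the single gap costs O(1) powers of x.
    -- Different lengths: the 2-adic criterion works as soon as s ≥ H₀. Otherwise t is below a power
    -- of log x, and either d is so long that sizes exclude equality, or tLd ≤ x and the single gap
    -- is affordable.
    term : ∀ {M H G t′} e → t′ ≤ t → 1 ≤ H → Scale H → ClosePairOf n t′ M H G →
           (∀ i → 1 ≤ i → i ≤ t′ → p ^ e ∣ ∣ shiftedFactorial f (n i) ∣) → Bounded (p ^ e) M G
    term {M} {H} {G} {t′} e t′≤t 1≤H scale pair divides = decide scale separated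
      where
      open ClosePairOf pair
      instance
        d≢0 : NonZero d
        d≢0 = >-nonZero positive
      good : ∀ {y} → (∃ λ i → 1 ≤ i × i ≤ t′ × y ≡ n i) → Admissible y × Divides e y
      good (i , 1≤i , i≤t′ , refl) = admissible (<x i 1≤i i≤t) (<p i 1≤i i≤t) (≤E* i 1≤i i≤t) , divides i 1≤i i≤t′
        where
        i≤t = ≤-trans i≤t′ t′≤t
      aa  = proj₁ (good left₁)
      aad = proj₁ (good right₁)
      ab  = proj₁ (good left₂)
      abd = proj₁ (good right₂)
      via-pair : Distinct a d b (d + s) → Bounded (p ^ e) M G
      via-pair distinct = s , c , ≤-trans
        (pair-bound e t aa aad ab abd (proj₂ (good left₁)) (proj₂ (good right₁)) (proj₂ (good left₂)) (proj₂ (good right₂)) distinct)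
        (*-monoˡ-≤ (x ^ (s + c)) (*-monoˡ-≤ (suc t ^ x) (^-monoʳ-≤ t short)))
        , close , tLη≤ (m≤n+m c κ)
      single : t * (L * (d + c)) ≤ K * x → Bounded (p ^ e) M G
      single = via-single {M = M} {d = d} (single-bound e aa aad (proj₂ (good left₁)) (proj₂ (good right₁)))
      equal-lengths : s ≡ 0 → Bounded (p ^ e) M G
      equal-lengths s≡0 with κ <? d
      ... | no  κ≮d = single (tLη≤ (+-monoˡ-≤ c (≮⇒≥ κ≮d)))
      ... | yes κ<d = via-pair (subst (Distinct a d b) (sym d+s≡d)
          (distinct-equal aa aad ab (subst (λ l → Admissible (b + l)) d+s≡d abd)
            (subst (λ l → b + l ≤ a ⊎ a + d ≤ b) d+s≡d disjoint) κ<d))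
        where
        d+s≡d : d + s ≡ d
        d+s≡d = trans (cong (d +_) s≡0) (+-identityʳ d)
      polylogarithmic : t < H₀ ^ m → s < H₀ → d * d ≤ 2 * x * suc (L * (s + c)) → t * (L * d) ≤ x
      polylogarithmic t< s< dd≤ = ^-cancelˡ-≤ 2 (begin
        (t * (L * d)) ^ 2                                              ≡⟨ square t L d ⟩
        t * t * (L * L) * (d * d)                                      ≤⟨ *-mono-≤ (*-monoˡ-≤ (L * L) (*-mono-≤ (<⇒≤ t<) (<⇒≤ t<)))
                                                                          (≤-trans dd≤ (*-monoʳ-≤ (2 * x) (s≤s (*-monoʳ-≤ L (+-monoˡ-≤ c (<⇒≤ s<)))))) ⟩
        H₀ ^ m * H₀ ^ m * (L * L) * (2 * x * suc (L * (H₀ + c)))       ≡⟨ regroup (H₀ ^ m * H₀ ^ m * (L * L)) x (suc (L * (H₀ + c))) ⟩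
        H₀ ^ m * H₀ ^ m * (L * L) * (2 * suc (L * (H₀ + c))) * x       ≤⟨ *-monoˡ-≤ x polylog ⟩
        x * x                                                          ≡⟨ cong (x *_) (*-identityʳ x) ⟨
        x ^ 2                                                          ∎)
        where
        square : ∀ t L d → t * (L * d) * (t * (L * d) * 1) ≡ t * t * (L * L) * (d * d)
        square = solve-∀
        regroup : ∀ a x b → a * (2 * x * b) ≡ a * (2 * b) * x
        regroup = solve-∀
      decide : Scale H → s ≡ 0 ⊎ H ≤ s → Bounded (p ^ e) M G
      decide _           (inj₁ s≡0)  = equal-lengths s≡0
      decide (inj₁ refl) (inj₂ H₀≤s) = via-pair (distinct-lengths aa aad ab abd H₀≤s)
      decide (inj₂ t<)   (inj₂ _) with H₀ ≤? s
      ... | yes H₀≤s = via-pair (distinct-lengths aa aad ab abd H₀≤s)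
      ... | no  H₀≰s with 2 * x * suc (L * (s + c)) <? d * d
      ...   | yes long = via-pair (distinct-long aa aad ab abd disjoint long)
      ...   | no ¬long = single (tLd≤ (polylogarithmic t< (≰⇒> H₀≰s) (≮⇒≥ ¬long)))

    module _ (M H N : ℕ) (1≤M : 1 ≤ M) (1≤H : 1 ≤ H) (scale : Scale H) (enough : suc (M * H + 2 * N) ≤ t)
      (injective : ∀ i j → 1 ≤ i → i ≤ t → 1 ≤ j → j ≤ t → n i ≡ n j → i ≡ j)
      (e : ℕ → ℕ)
      (divides : ∀ t′ i → 1 ≤ i → i ≤ t′ → p ^ e t′ ∣ ∣ shiftedFactorial f (n i) ∣)
      where

      open Selection n t M H N 1≤M 1≤H enough injective

      -- The sum is built downwards from t′ = t, so that the term added to k others has t - t′ = k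
      -- and uses the length bound `G k`.
      sum-bound : ∀ lo k → k ≤ N → lo + k ≡ suc t →
        ∃ λ s → ∃ λ η → p ^ sumFrom lo k e * (t ^ x) ^ k ≤ t ^ ΣN k G * (suc t ^ x) ^ k * x ^ (s + η)
                        × M * s ≤ ΣN k G × t * (L * η) ≤ k * (K * x)
      sum-bound lo zero    _ _ = 0 , 0 , ≤-refl , ≤-reflexive (*-zeroʳ M)
        , ≤-reflexive (trans (cong (t *_) (*-zeroʳ L)) (*-zeroʳ t))
      sum-bound lo (suc k) k<N lo+1+k≡ with sum-bound (suc lo) k (≤-trans (n≤1+n k) k<N) (trans (sym (+-suc lo k)) lo+1+k≡)
                                         | term (e lo) lo≤t 1≤H scale (select k lo k<N lo+k≡t) (divides lo)
        where
        lo+k≡t : lo + k ≡ t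
        lo+k≡t = suc-injective (trans (sym (+-suc lo k)) lo+1+k≡)
        lo≤t : lo ≤ t
        lo≤t = subst (lo ≤_) lo+k≡t (m≤m+n lo k)
      ... | s , η , bound , Ms≤ , η≤ | s′ , η′ , bound′ , Ms′≤ , η′≤ = s + s′ , η + η′
          , (begin
              p ^ (e lo + S) * (τ * τ ^ k)                    ≡⟨ cong (_* (τ * τ ^ k)) (^-distribˡ-+-* p (e lo) S) ⟩
              p ^ e lo * p ^ S * (τ * τ ^ k)                  ≡⟨ interchange (p ^ e lo) (p ^ S) τ (τ ^ k) ⟩
              p ^ e lo * τ * (p ^ S * τ ^ k)                  ≤⟨ *-mono-≤ bound′ bound ⟩
              t ^ G k * υ * x ^ (s′ + η′) * (t ^ A * υ ^ k * x ^ (s + η))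
                                                              ≡⟨ regroup (t ^ G k) υ (x ^ (s′ + η′)) (t ^ A) (υ ^ k) (x ^ (s + η)) ⟩
              t ^ A * t ^ G k * (υ * υ ^ k) * (x ^ (s + η) * x ^ (s′ + η′))
                                                              ≡⟨ cong₂ (λ a b → a * (υ * υ ^ k) * b) (sym (^-distribˡ-+-* t A (G k)))
                                                                   (trans (sym (^-distribˡ-+-* x (s + η) (s′ + η′))) (cong (x ^_) (shuffle s η s′ η′))) ⟩
              t ^ (A + G k) * (υ * υ ^ k) * x ^ (s + s′ + (η + η′)) ∎)
          , ≤-trans (≤-reflexive (*-distribˡ-+ M s s′)) (+-mono-≤ Ms≤ Ms′≤)
          , ≤-trans (≤-reflexive (spread t L η η′)) (+-mono-≤ η′≤ η≤)
        where
        S = sumFrom (suc lo) k e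
        A = ΣN k G
        τ = t ^ x
        υ = suc t ^ x
        interchange : ∀ a b c d → a * b * (c * d) ≡ a * c * (b * d)
        interchange = solve-∀
        regroup : ∀ a b c d e f → a * b * c * (d * e * f) ≡ d * a * (b * e) * (f * c)
        regroup = solve-∀
        shuffle : ∀ s η s′ η′ → s + η + (s′ + η′) ≡ s + s′ + (η + η′)
        shuffle = solve-∀
        spread : ∀ t L η η′ → t * (L * (η + η′)) ≡ t * (L * η′) + t * (L * η)
        spread = solve-∀

      -- Because 2N ≤ t, the factors (1 + 1/t)ˣ multiply to at most 2ˣ. Because N ≤ t, the total η
      -- satisfies Lη ≤ Kx, so x^η ≤ 2^(Kx).
      total-bound : ∀ lo → lo + N ≡ suc t →
        ∃ λ A → ∃ λ s → p ^ sumFrom lo N e ≤ t ^ A * x ^ s * 2 ^ (suc K * x) × M * s ≤ A × 2 * A ≤ proj₁ width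
      total-bound lo lo+N≡ with sum-bound lo N ≤-refl lo+N≡
      ... | s , η , bound , Ms≤ , η≤ = A , s , *-cancelʳ-≤ _ _ ((t ^ x) ^ N) {{m^n≢0 _ N {{m^n≢0 t x}}}} (begin
          p ^ sumFrom lo N e * (t ^ x) ^ N                        ≤⟨ bound ⟩
          t ^ A * (suc t ^ x) ^ N * x ^ (s + η)                   ≤⟨ *-mono-≤ (*-monoʳ-≤ (t ^ A) power≤) x^≤ ⟩
          t ^ A * (2 ^ x * (t ^ x) ^ N) * (x ^ s * 2 ^ (K * x))   ≡⟨ regroup (t ^ A) (2 ^ x) ((t ^ x) ^ N) (x ^ s) (2 ^ (K * x)) ⟩
          t ^ A * x ^ s * (2 ^ x * 2 ^ (K * x)) * (t ^ x) ^ N     ≡⟨ cong (λ z → t ^ A * x ^ s * z * (t ^ x) ^ N) (^-distribˡ-+-* 2 x (K * x)) ⟨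
          t ^ A * x ^ s * 2 ^ (suc K * x) * (t ^ x) ^ N           ∎)
        , Ms≤ , proj₂ (proj₂ width)
        where
        A = ΣN N G
        regroup : ∀ a b c d e → a * (b * c) * (d * e) ≡ a * d * (b * e) * c
        regroup = solve-∀
        2N≤t : 2 * N ≤ t
        2N≤t = ≤-trans (≤-trans (m≤n+m (2 * N) (M * H)) (n≤1+n _)) enough
        swap-exponents : ∀ y → (y ^ x) ^ N ≡ (y ^ N) ^ x
        swap-exponents y = trans (^-*-assoc y x N) (trans (cong (y ^_) (*-comm x N)) (sym (^-*-assoc y N x)))
        power≤ : (suc t ^ x) ^ N ≤ 2 ^ x * (t ^ x) ^ N
        power≤ = begin
          (suc t ^ x) ^ N          ≡⟨ swap-exponents (suc t) ⟩
          (suc t ^ N) ^ x          ≤⟨ ^-monoˡ-≤ x (suc^≤2*^ t N 2N≤t) ⟩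
          (2 * t ^ N) ^ x          ≡⟨ ^-distribʳ-* x 2 (t ^ N) ⟩
          2 ^ x * (t ^ N) ^ x      ≡⟨ cong (2 ^ x *_) (swap-exponents t) ⟨
          2 ^ x * (t ^ x) ^ N      ∎
        Lη≤Kx : L * η ≤ K * x
        Lη≤Kx = *-cancelˡ-≤ t (≤-trans η≤ (*-monoˡ-≤ (K * x) (≤-trans (m≤m+n N (N + 0)) 2N≤t)))
        x^≤ : x ^ (s + η) ≤ x ^ s * 2 ^ (K * x)
        x^≤ = begin
          x ^ (s + η)              ≡⟨ ^-distribˡ-+-* x s η ⟩
          x ^ s * x ^ η            ≤⟨ *-monoʳ-≤ (x ^ s) (≤-trans (x^≤2^ L η x<2^L) (^-monoʳ-≤ 2 Lη≤Kx)) ⟩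
          x ^ s * 2 ^ (K * x)      ∎

  polylog-bound : ∀ c m → ∃ λ a → ∃ λ k → ∀ L → 1 ≤ L → polylogarithm c m L ≤ a * L ^ k
  polylog-bound c m = u ^ m * u ^ m * (2 * v) , m + m + 4 , λ L 1≤L → begin
    suc (2 * L + L * c) ^ m * suc (2 * L + L * c) ^ m * (L * L) * (2 * suc (L * (suc (2 * L + L * c) + c)))
      ≤⟨ *-mono-≤ (*-monoˡ-≤ (L * L) (*-mono-≤ (^-monoˡ-≤ m (h≤ L 1≤L)) (^-monoˡ-≤ m (h≤ L 1≤L)))) (*-monoʳ-≤ 2 (last≤ L 1≤L)) ⟩
    (u * L) ^ m * (u * L) ^ m * (L * L) * (2 * (v * (L * L)))
      ≡⟨ cong (λ z → z * z * (L * L) * (2 * (v * (L * L)))) (^-distribʳ-* m u L) ⟩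
    u ^ m * L ^ m * (u ^ m * L ^ m) * (L * L) * (2 * (v * (L * L)))
      ≡⟨ regroup (u ^ m) (L ^ m) v L ⟩
    u ^ m * u ^ m * (2 * v) * (L ^ m * L ^ m * (L * (L * (L * (L * 1)))))
      ≡⟨ cong (u ^ m * u ^ m * (2 * v) *_) (trans (cong (_* L ^ 4) (sym (^-distribˡ-+-* L m m))) (sym (^-distribˡ-+-* L (m + m) 4))) ⟩
    u ^ m * u ^ m * (2 * v) * L ^ (m + m + 4) ∎
    where
    open ≤-Reasoning
    u = 3 + c
    v = 4 + 2 * c
    regroup : ∀ p q v L → p * q * (p * q) * (L * L) * (2 * (v * (L * L))) ≡ p * p * (2 * v) * (q * q * (L * (L * (L * (L * 1)))))
    regroup = solve-∀
    h≤ : ∀ L → 1 ≤ L → suc (2 * L + L * c) ≤ u * L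
    h≤ L 1≤L = ≤-trans (+-monoˡ-≤ (2 * L + L * c) 1≤L) (≤-reflexive (collect L c))
      where
      collect : ∀ L c → L + (2 * L + L * c) ≡ (3 + c) * L
      collect = solve-∀
    last≤ : ∀ L → 1 ≤ L → suc (L * (suc (2 * L + L * c) + c)) ≤ v * (L * L)
    last≤ L 1≤L = begin
      suc (L * (suc (2 * L + L * c) + c))      ≤⟨ +-mono-≤ 1≤LL (*-monoʳ-≤ L (+-mono-≤ (h≤ L 1≤L) (m≤n*m c L {{>-nonZero 1≤L}}))) ⟩
      L * L + L * ((3 + c) * L + L * c)        ≡⟨ collect L c ⟩
      v * (L * L)                              ∎
      where
      1≤LL = *-mono-≤ 1≤L 1≤L
      collect : ∀ L c → L * L + L * ((3 + c) * L + L * c) ≡ (4 + 2 * c) * (L * L)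
      collect = solve-∀

  -- The exponential of the claim. The exponent of t is at most half the distance W of two points of
  -- J, that of x is at most A/M, and `M-large` reads 2M ≥ t^(r/(r+1)), which is t^0.98 for r = 49.
  record MultiplicativeBound (r K x p t T : ℕ) (n : ℕ → ℕ) (e : ℕ → ℕ) : Set where
    field
      {A s M W} : ℕ
      {u v}     : ℕ
      bound     : p ^ sumFrom T (suc t ∸ T) e ≤ t ^ A * x ^ s * 2 ^ (K * x)
      M*s≤A     : M * s ≤ A
      2*A≤W     : 2 * A ≤ W
      1≤u       : 1 ≤ u
      u≤t       : u ≤ t
      1≤v       : 1 ≤ v
      v≤t       : v ≤ t
      W-width   : n v ≡ n u + W
      M-large   : t ^ r ≤ (2 * M) ^ suc r

  -- Here the real parameters are replaced by integers: 1/ε₀ by E, the bound C₀x^(2/3) by t³ ≤ Bx²,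
  -- and ε₀t by R = 2T - t, which for j = 49 must be at least about 9 t^0.99.
  BoundedBeyond : (j : ℕ) (f : ℤ[X]) (E B x₀ K : ℕ) → Set
  BoundedBeyond j f E B x₀ K =
    ∀ x → x₀ ≤ x → ∀ p → Prime p → ∀ t .{{_ : NonZero t}} → t ^ 3 ≤ B * x ^ 2 →
    (n : ℕ → ℕ) →
    (∀ i → 1 ≤ i → i ≤ t → n i < x) →
    (∀ i → 1 ≤ i → i ≤ t → n i < p) →
    (∀ i → 1 ≤ i → i ≤ t → x ≤ E * n i) →
    (∀ u v → 1 ≤ u → u ≤ t → 1 ≤ v → v ≤ t → n u ≡ n v → u ≡ v) →
    ∀ T R → T ≤ t → t + R ≡ 2 * T → 9 ^ (suc j * 2) * t ^ suc (j * 2) ≤ suc R ^ (suc j * 2) →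
    (e : ℕ → ℕ) → (∀ t′ i → 1 ≤ i → i ≤ t′ → p ^ e t′ ∣ ∣ shiftedFactorial f (n i) ∣) →
    MultiplicativeBound j (suc K) x p t T n e

  bounded-beyond : ∀ j f → NonZeroPoly f → ∀ E .{{_ : NonZero E}} B → ∃ λ x₀ → ∃ λ K → BoundedBeyond j f E B x₀ K
  bounded-beyond j f f≢0 E B = x₀ , K , prove
    where
    g = growth f f≢0
    open Growth g using () renaming (degree to D; scale to Q; threshold to N₀)
    c = 2 * D + 1
    κ = 2 * (E * (Q * Q) * (E ^ D * Q * (E ^ D * Q)))
    K = B * (κ + c) + 1
    b₁ = E * N₀
    b₂ = 2 * (Q * Q)
    b₃ = E * (Q * (E ^ D * Q))
    logs = polylog-bound c (suc j * 2)
    a₁ = proj₁ logs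
    k₁ = proj₁ (proj₂ logs)
    -- `first` will bound the polylogarithm by x and `second` will bound L³ by x. The factors 2
    -- compensate for 2ᴸ ≤ 2x.
    first  = polynomial≤2^ k₁ (2 * a₁)
    second = polynomial≤2^ 3 2
    N₁ = proj₁ first
    N₂ = proj₁ second
    x₀ = b₁ + (b₂ + (b₃ + (2 ^ N₁ + 2 ^ N₂)))

    module _ {x : ℕ} (x₀≤x : x₀ ≤ x) where
      open ≤-Reasoning

      tail₁ : b₂ + (b₃ + (2 ^ N₁ + 2 ^ N₂)) ≤ x
      tail₁ = ≤-trans (m≤n+m _ b₁) x₀≤x
      tail₂ : b₃ + (2 ^ N₁ + 2 ^ N₂) ≤ x
      tail₂ = ≤-trans (m≤n+m _ b₂) tail₁
      tail₃ : 2 ^ N₁ + 2 ^ N₂ ≤ x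
      tail₃ = ≤-trans (m≤n+m _ b₃) tail₂
      x-large : b₁ ≤ x
      x-large = ≤-trans (m≤m+n _ _) x₀≤x
      x-large′ : b₂ ≤ x
      x-large′ = ≤-trans (m≤m+n _ _) tail₁
      x-large″ : b₃ ≤ x
      x-large″ = ≤-trans (m≤m+n _ _) tail₂
      2^N₁≤x : 2 ^ N₁ ≤ x
      2^N₁≤x = ≤-trans (m≤m+n _ _) tail₃
      2^N₂≤x : 2 ^ N₂ ≤ x
      2^N₂≤x = ≤-trans (m≤n+m _ _) tail₃
      1≤x : 1 ≤ x
      1≤x = ≤-trans (m^n>0 2 N₁) 2^N₁≤x

      bits = bit-length x {{>-nonZero 1≤x}}
      L = proj₁ bits
      x<2^L : x < 2 ^ L
      x<2^L = proj₁ (proj₂ bits)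

      exponent≤L : ∀ {N} → 2 ^ N ≤ x → N ≤ L
      exponent≤L 2^N≤x = ≮⇒≥ λ L<N → <⇒≱ (≤-<-trans 2^N≤x x<2^L) (^-monoʳ-≤ 2 (<⇒≤ L<N))

      1≤L : 1 ≤ L
      1≤L = n≢0⇒n>0 λ L≡0 → <⇒≱ x<2^L (subst (λ l → 2 ^ l ≤ x) (sym L≡0) 1≤x)

      below-x : ∀ {y} → 2 * y ≤ 2 ^ L → y ≤ x
      below-x l = *-cancelˡ-≤ 2 (≤-trans l (proj₂ (proj₂ bits)))

      L³≤x : L ^ 3 ≤ x
      L³≤x = below-x (proj₂ second L (exponent≤L 2^N₂≤x))

      H₀ : ℕ
      H₀ = windowLength c L

      polylog≤x : polylogarithm c (suc j * 2) L ≤ x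
      polylog≤x = ≤-trans (proj₂ (proj₂ logs) L 1≤L)
        (below-x (subst (_≤ 2 ^ L) (*-assoc 2 a₁ (L ^ k₁)) (proj₂ first L (exponent≤L 2^N₁≤x))))

      -- The place where t ≪ x^(2/3) enters: since L³ ≤ x, the number of terms times log x is O(x).
      tL≤Bx : ∀ {t} → t ^ 3 ≤ B * x ^ 2 → t * L ≤ B * x
      tL≤Bx {t} t³≤ = ^-cancelˡ-≤ 3 (begin
        (t * L) ^ 3            ≡⟨ ^-distribʳ-* 3 t L ⟩
        t ^ 3 * L ^ 3          ≤⟨ *-mono-≤ t³≤ L³≤x ⟩
        B * x ^ 2 * x          ≡⟨ regroup B x ⟩
        B * x ^ 3              ≤⟨ *-monoˡ-≤ (x ^ 3) (cube B) ⟩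
        B ^ 3 * x ^ 3          ≡⟨ ^-distribʳ-* 3 B x ⟨
        (B * x) ^ 3            ∎)
        where
        regroup : ∀ B x → B * (x * (x * 1)) * x ≡ B * (x * (x * (x * 1)))
        regroup = solve-∀
        cube : ∀ B → B ≤ B ^ 3
        cube zero      = z≤n
        cube B@(suc _) = m≤m*n B (B ^ 2) {{m^n≢0 B 2}}

    prove : BoundedBeyond j f E B x₀ K
    prove x x₀≤x p p-prime t t³≤ n <x <p ≤E* injective T R T≤t t+R≡2T large e divides = choose (H₀ x₀≤x ^ (suc j * 2) ≤? t)
      where
      open Estimate g E B x (L x₀≤x) p {{>-nonZero (1≤x x₀≤x)}} (x<2^L x₀≤x) p-prime
             (x-large x₀≤x) (x-large′ x₀≤x) (x-large″ x₀≤x) (suc j * 2) (polylog≤x x₀≤x) t (tL≤Bx x₀≤x {t} t³≤) n <x <p ≤E*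
        using (Scale; total-bound)
      N = suc t ∸ T
      T+N≡ : T + N ≡ suc t
      T+N≡ = m+[n∸m]≡n (≤-trans T≤t (n≤1+n t))
      2+t≡ : 2 * N + R ≡ 2 + t
      2+t≡ = +-cancelˡ-≡ (t + 2 * T) _ _ (begin-equality
        t + 2 * T + (2 * N + R)      ≡⟨ gather t T N R ⟩
        2 * (T + N) + (t + R)        ≡⟨ cong₂ (λ a b → 2 * a + b) T+N≡ t+R≡2T ⟩
        2 * suc t + 2 * T            ≡⟨ spread t T ⟩
        t + 2 * T + (2 + t)          ∎)
        where
        open ≤-Reasoning
        gather : ∀ t T N R → t + 2 * T + (2 * N + R) ≡ 2 * (T + N) + (t + R)
        gather = solve-∀
        spread : ∀ t T → 2 * (1 + t) + 2 * T ≡ t + 2 * T + (2 + t)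
        spread = solve-∀
      finish : ∀ H → 1 ≤ H → Scale H → H ^ (suc j * 2) ≤ t → MultiplicativeBound j (suc K) x p t T n e
      finish H 1≤H scale H≤t = record
        { A       = proj₁ total
        ; s       = proj₁ (proj₂ total)
        ; M       = M
        ; bound   = proj₁ (proj₂ (proj₂ total))
        ; M*s≤A   = proj₁ (proj₂ (proj₂ (proj₂ total)))
        ; 2*A≤W   = proj₂ (proj₂ (proj₂ (proj₂ total)))
        ; 1≤u     = proj₁ ends
        ; u≤t     = proj₁ (proj₂ ends)
        ; 1≤v     = proj₁ (proj₂ (proj₂ ends))
        ; v≤t     = proj₁ (proj₂ (proj₂ (proj₂ ends)))
        ; W-width = proj₂ (proj₂ (proj₂ (proj₂ ends)))
        ; M-large = proj₂ (proj₂ (proj₂ count))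
        }
        where
        count = window-count t H R j {{it}} {{>-nonZero 1≤H}} (halve-exponents j H t (suc R) H≤t large)
        M = proj₁ count
        1≤M = proj₁ (proj₂ count)
        enough : suc (M * H + 2 * N) ≤ t
        enough = +-cancelˡ-≤ 2 _ _ (begin
          2 + suc (M * H + 2 * N)      ≡⟨ permute (M * H) (2 * N) ⟩
          2 * N + (M * H + 3)          ≤⟨ +-monoʳ-≤ (2 * N) (proj₁ (proj₂ (proj₂ count))) ⟩
          2 * N + R                    ≡⟨ 2+t≡ ⟩
          2 + t                        ∎)
          where
          open ≤-Reasoning
          permute : ∀ a b → 2 + (1 + (a + b)) ≡ b + (a + 3)
          permute = solve-∀
        total = total-bound M H N 1≤M 1≤H scale enough injective e divides T T+N≡
        ends  = proj₂ (proj₂ (proj₁ (proj₂ (Selection.width n t M H N 1≤M 1≤H enough injective))))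
      choose : Dec (H₀ x₀≤x ^ (suc j * 2) ≤ t) → MultiplicativeBound j (suc K) x p t T n e
      choose (yes H₀≤t) = finish (H₀ x₀≤x) (s≤s z≤n) (inj₁ refl) H₀≤t
      choose (no  H₀≰t) = finish 1 ≤-refl (inj₂ (≰⇒> H₀≰t)) (≤-trans (≤-reflexive (^-zeroˡ (suc j * 2))) (>-nonZero⁻¹ t))

  -- Abstract, since unfolding x₀ would evaluate an astronomically large number.
  abstract
    multiplicative-bound : ∀ j f → NonZeroPoly f → ∀ E .{{_ : NonZero E}} B → ∃ λ x₀ → ∃ λ K → BoundedBeyond j f E B x₀ K
    multiplicative-bound j f f≢0 E B = bounded-beyond j f f≢0 E B

-- Passage to real numbers and logarithms

open import Defs
open import Data.Nat.Base as ℕ using (ℕ; zero; suc; NonZero; s≤s; z≤n)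
import Data.Nat.Properties as ℕ
open import Data.Nat.Tactic.RingSolver using (solve-∀)
open import Data.Integer.Base as ℤ using (ℤ; +_)
open import Data.Rational.Base as ℚ using (ℚ; 0ℚ; 1ℚ; ½; ↥_; _/_)
import Data.Rational.Properties as ℚ
open import Data.Rational.Solver using (module +-*-Solver)
open +-*-Solver using (solve; _:+_; _:*_; _:=_; con)
open import Data.Product.Base using (∃; _×_; _,_; proj₁; proj₂)
open import Data.Sum.Base using (_⊎_; inj₁; inj₂)
open import Function.Base using (it)
open import Relation.Binary.PropositionalEquality
open import Data.Nat.Divisibility using (_∣_; _∣?_; divides; ∣-trans; 1∣_)
open import Data.Nat.Primality using (Prime; prime⇒nonZero)
open import Data.Unit.Base using (tt)
open import Relation.Nullary using (Dec; yes; no)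
open Arithmetic using (^-distribʳ-*)
open Multiplicative using (MultiplicativeBound; BoundedBeyond; multiplicative-bound)

ι : ℕ → ℚ
ι a = frac a 0

ι-+ : ∀ a b → ι (a ℕ.+ b) ≡ ι a ℚ.+ ι b
ι-+ zero    b = sym (ℚ.+-identityˡ (ι b))
ι-+ (suc a) b = begin
  ι (suc (a ℕ.+ b))           ≡⟨ frac-suc (a ℕ.+ b) 0 ⟩
  ι (a ℕ.+ b) ℚ.+ 1ℚ          ≡⟨ cong (ℚ._+ 1ℚ) (ι-+ a b) ⟩
  ι a ℚ.+ ι b ℚ.+ 1ℚ          ≡⟨ solve 3 (λ a b c → a :+ b :+ c := a :+ c :+ b) refl (ι a) (ι b) 1ℚ ⟩
  ι a ℚ.+ 1ℚ ℚ.+ ι b          ≡⟨ cong (ℚ._+ ι b) (frac-suc a 0) ⟨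
  ι (suc a) ℚ.+ ι b           ∎
  where open ≡-Reasoning

ι-suc : ∀ a → ι (suc a) ≡ 1ℚ ℚ.+ ι a
ι-suc a = ι-+ 1 a

ι-* : ∀ a b → ι (a ℕ.* b) ≡ ι a ℚ.* ι b
ι-* zero    b = sym (ℚ.*-zeroˡ (ι b))
ι-* (suc a) b = begin
  ι (b ℕ.+ a ℕ.* b)           ≡⟨ ι-+ b (a ℕ.* b) ⟩
  ι b ℚ.+ ι (a ℕ.* b)         ≡⟨ cong (ι b ℚ.+_) (ι-* a b) ⟩
  ι b ℚ.+ ι a ℚ.* ι b         ≡⟨ solve 2 (λ a b → b :+ a :* b := (con 1ℚ :+ a) :* b) refl (ι a) (ι b) ⟩
  (1ℚ ℚ.+ ι a) ℚ.* ι b        ≡⟨ cong (ℚ._* ι b) (ι-suc a) ⟨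
  ι (suc a) ℚ.* ι b           ∎
  where open ≡-Reasoning

ι-^ : ∀ a k → ι (a ℕ.^ k) ≡ ι a ^ℚ k
ι-^ a zero    = refl
ι-^ a (suc k) = trans (ι-* a (a ℕ.^ k)) (cong (ι a ℚ.*_) (ι-^ a k))

ι-mono : ∀ {a b} → a ℕ.≤ b → ι a ℚ.≤ ι b
ι-mono {a} {b} a≤b = frac-mono a 0 b 0 (ℕ.*-monoˡ-≤ 1 a≤b)

ι-nonneg : ∀ a → 0ℚ ℚ.≤ ι a
ι-nonneg a = frac-nonneg a 0

+-cancelˡ-≤ : ∀ c {a b} → c ℚ.+ a ℚ.≤ c ℚ.+ b → a ℚ.≤ b
+-cancelˡ-≤ c {a} {b} h = +-cancelʳ-≤ c (subst₂ ℚ._≤_ (ℚ.+-comm c a) (ℚ.+-comm c b) h)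

½<1 : ½ ℚ.< 1ℚ
½<1 = ℚ.*<* (ℤ.+<+ (s≤s (s≤s z≤n)))

-- An error of ½ is invisible between integers. Thus a real inequality, which holds up to any ε from
-- some index on, yields an exact one when read at a single late index.
ι-cancel-≤ : ∀ {a b} → ι a ℚ.≤ ι b ℚ.+ ½ → a ℕ.≤ b
ι-cancel-≤ {a} {b} h = ℕ.≮⇒≥ λ b<a → ℚ.<-irrefl refl (ℚ.<-≤-trans ½<1
  (+-cancelˡ-≤ (ι b) (ℚ.≤-trans (ℚ.≤-reflexive (sym (frac-suc b 0))) (ℚ.≤-trans (ι-mono b<a) h))))

ι-cancel-≤₀ : ∀ {a b} → ι a ℚ.≤ ι b → a ℕ.≤ b
ι-cancel-≤₀ h = ι-cancel-≤ (ℚ.≤-trans h (≤-+ʳ (ℚ.<⇒≤ 0<½)))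

multiple≡* : ∀ c q → multiple c q ≡ ι c ℚ.* q
multiple≡* zero    q = sym (ℚ.*-zeroˡ q)
multiple≡* (suc c) q = begin
  multiple c q ℚ.+ q       ≡⟨ cong (ℚ._+ q) (multiple≡* c q) ⟩
  ι c ℚ.* q ℚ.+ q          ≡⟨ solve 2 (λ c q → c :* q :+ q := (con 1ℚ :+ c) :* q) refl (ι c) q ⟩
  (1ℚ ℚ.+ ι c) ℚ.* q       ≡⟨ cong (ℚ._* q) (ι-suc c) ⟨
  ι (suc c) ℚ.* q          ∎
  where open ≡-Reasoning

ι*frac : ∀ d → ι (suc d) ℚ.* frac 1 d ≡ 1ℚ
ι*frac d = begin
  ι (suc d) ℚ.* frac 1 d         ≡⟨ multiple≡* (suc d) (frac 1 d) ⟨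
  multiple (suc d) (frac 1 d)    ≡⟨ multiple-frac (suc d) d ⟩
  frac (suc d) d                 ≡⟨ ℚ.≤-antisym (frac-mono (suc d) d 1 0 (ℕ.≤-reflexive (ℕ.*-comm (suc d) 1)))
                                                (frac-mono 1 0 (suc d) d (ℕ.≤-reflexive (ℕ.*-comm 1 (suc d)))) ⟩
  1ℚ                             ∎
  where open ≡-Reasoning

^ℚ-distrib-* : ∀ k a b → (a ℚ.* b) ^ℚ k ≡ a ^ℚ k ℚ.* b ^ℚ k
^ℚ-distrib-* zero    a b = refl
^ℚ-distrib-* (suc k) a b = trans (cong (a ℚ.* b ℚ.*_) (^ℚ-distrib-* k a b))
  (solve 4 (λ a b c d → a :* b :* (c :* d) := a :* c :* (b :* d)) refl a b (a ^ℚ k) (b ^ℚ k))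

^ℚ-mono-< : ∀ k .{{_ : NonZero k}} {a b} → 0ℚ ℚ.≤ a → a ℚ.< b → a ^ℚ k ℚ.< b ^ℚ k
^ℚ-mono-< 1 {a} {b} 0≤a a<b = subst₂ ℚ._<_ (sym (ℚ.*-identityʳ a)) (sym (ℚ.*-identityʳ b)) a<b
^ℚ-mono-< (suc k@(suc _)) {a} {b} 0≤a a<b = ℚ.≤-<-trans
  (ℚ.*-monoʳ-≤-nonNeg (a ^ℚ k) {{ℚ.nonNegative (^ℚ-nonneg k 0≤a)}} (ℚ.<⇒≤ a<b))
  (ℚ.*-monoʳ-<-pos b {{ℚ.positive (ℚ.≤-<-trans 0≤a a<b)}} (^ℚ-mono-< k 0≤a a<b))

^ℚ-cancel-≤ : ∀ k .{{_ : NonZero k}} {a b} → 0ℚ ℚ.≤ b → a ^ℚ k ℚ.≤ b ^ℚ k → a ℚ.≤ b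
^ℚ-cancel-≤ k 0≤b h = ℚ.≮⇒≥ λ b<a → ℚ.<-irrefl refl (ℚ.<-≤-trans (^ℚ-mono-< k 0≤b b<a) h)

seq-^ : ∀ y k n → seq (y ^ k) n ≡ seq y n ^ℚ k
seq-^ y zero    n = refl
seq-^ y (suc k) n = cong (seq y n ℚ.*_) (seq-^ y k n)

-- Asked of every approximant and not only in the limit, so that inequalities can be multiplied
-- termwise. The logarithms and roots used here have this property.
Nonneg : ℝ → Set
Nonneg x = ∀ n → 0ℚ ℚ.≤ seq x n

pointwise-≤ : ∀ {x y} → (∀ n → seq x n ℚ.≤ seq y n) → x ≤ y
pointwise-≤ h ε 0<ε = 0 , λ n _ → ℚ.≤-trans (h n) (≤-+ʳ (ℚ.<⇒≤ 0<ε))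

pointwise-≡ : ∀ {x y} → (∀ n → seq x n ≡ seq y n) → x ≤ y
pointwise-≡ {x} {y} h = pointwise-≤ {x} {y} λ n → ℚ.≤-reflexive (h n)

≤-trans : ∀ {x y z} → x ≤ y → y ≤ z → x ≤ z
≤-trans {x} {y} {z} x≤y y≤z ε 0<ε =
  let N , h = x≤y (½ ℚ.* ε) (half-pos 0<ε)
      M , k = y≤z (½ ℚ.* ε) (half-pos 0<ε)
  in N ℕ.⊔ M , λ n l → begin
    seq x n                                   ≤⟨ h n (ℕ.m⊔n≤o⇒m≤o N M l) ⟩
    seq y n ℚ.+ ½ ℚ.* ε                       ≤⟨ ℚ.+-monoˡ-≤ (½ ℚ.* ε) (k n (ℕ.m⊔n≤o⇒n≤o N M l)) ⟩
    seq z n ℚ.+ ½ ℚ.* ε ℚ.+ ½ ℚ.* ε           ≡⟨ ℚ.+-assoc (seq z n) _ _ ⟩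
    seq z n ℚ.+ (½ ℚ.* ε ℚ.+ ½ ℚ.* ε)         ≡⟨ cong (seq z n ℚ.+_) (half-sum ε) ⟩
    seq z n ℚ.+ ε                             ∎
  where open ℚ.≤-Reasoning

<⇒≤ : ∀ {x y} → x < y → x ≤ y
<⇒≤ {x} {y} (δ , 0<δ , N , h) ε 0<ε = N , λ n l →
  ℚ.≤-trans (≤-+ʳ (ℚ.<⇒≤ 0<δ)) (ℚ.≤-trans (h n l) (≤-+ʳ (ℚ.<⇒≤ 0<ε)))

+-mono-≤ : ∀ {a b c d} → a ≤ b → c ≤ d → a + c ≤ b + d
+-mono-≤ {a} {b} {c} {d} a≤b c≤d ε 0<ε =
  let N , h = a≤b (½ ℚ.* ε) (half-pos 0<ε)
      M , k = c≤d (½ ℚ.* ε) (half-pos 0<ε)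
  in N ℕ.⊔ M , λ n l → begin
    seq a n ℚ.+ seq c n                                     ≤⟨ ℚ.+-mono-≤ (h n (ℕ.m⊔n≤o⇒m≤o N M l)) (k n (ℕ.m⊔n≤o⇒n≤o N M l)) ⟩
    seq b n ℚ.+ ½ ℚ.* ε ℚ.+ (seq d n ℚ.+ ½ ℚ.* ε)           ≡⟨ solve 3 (λ b d e → b :+ e :+ (d :+ e) := b :+ d :+ (e :+ e)) refl (seq b n) (seq d n) (½ ℚ.* ε) ⟩
    seq b n ℚ.+ seq d n ℚ.+ (½ ℚ.* ε ℚ.+ ½ ℚ.* ε)           ≡⟨ cong (seq b n ℚ.+ seq d n ℚ.+_) (half-sum ε) ⟩
    seq b n ℚ.+ seq d n ℚ.+ ε                               ∎
  where open ℚ.≤-Reasoning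

*-monoˡ-≤ : ∀ c {a b} → Nonneg c → a ≤ b → a * c ≤ b * c
*-monoˡ-≤ c {a} {b} 0≤c a≤b ε 0<ε =
  let C , 0<C , M , c≤C = bounded c
      η = ε ℚ.* 1/pos C 0<C
      0<η = *-pos 0<ε (1/pos-pos C 0<C)
      N , h = a≤b η 0<η
  in N ℕ.⊔ M , λ n l → begin
    seq a n ℚ.* seq c n                              ≤⟨ ℚ.*-monoʳ-≤-nonNeg (seq c n) {{ℚ.nonNegative (0≤c n)}} (h n (ℕ.m⊔n≤o⇒m≤o N M l)) ⟩
    (seq b n ℚ.+ η) ℚ.* seq c n                      ≡⟨ ℚ.*-distribʳ-+ (seq c n) (seq b n) η ⟩
    seq b n ℚ.* seq c n ℚ.+ η ℚ.* seq c n            ≤⟨ ℚ.+-monoʳ-≤ (seq b n ℚ.* seq c n) (ℚ.*-monoˡ-≤-nonNeg η {{ℚ.nonNegative (ℚ.<⇒≤ 0<η)}}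
                                                          (ℚ.≤-trans (p≤∣p∣ (seq c n)) (c≤C n (ℕ.m⊔n≤o⇒n≤o N M l)))) ⟩
    seq b n ℚ.* seq c n ℚ.+ η ℚ.* C                  ≡⟨ cong (seq b n ℚ.* seq c n ℚ.+_) (trans (ℚ.*-comm η C) (*-1/pos-cancel C 0<C ε)) ⟩
    seq b n ℚ.* seq c n ℚ.+ ε                        ∎
  where open ℚ.≤-Reasoning

fromℕ-cancel-≤ : ∀ {a b} → fromℕ a ≤ fromℕ b → a ℕ.≤ b
fromℕ-cancel-≤ {a} {b} h = let N , k = h ½ 0<½ in ι-cancel-≤ {a} {b} (k N ℕ.≤-refl)

fromℕ-cancel-< : ∀ {a b} → fromℕ a < fromℕ b → a ℕ.< b
fromℕ-cancel-< {a} {b} (δ , 0<δ , N , h) = ℕ.≰⇒> λ b≤a → ℚ.<-irrefl refl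
  (ℚ.<-≤-trans 0<δ (+-cancelˡ-≤ (ι a) (ℚ.≤-trans (h N ℕ.≤-refl) (ℚ.≤-trans (ι-mono b≤a) (ℚ.≤-reflexive (sym (ℚ.+-identityʳ (ι a))))))))

harmonic-nonneg : ∀ a c → 0ℚ ℚ.≤ harmonic a c
harmonic-nonneg a zero    = ℚ.≤-refl
harmonic-nonneg a (suc c) = ℚ.≤-trans (harmonic-nonneg a c) (≤-+ʳ (frac-nonneg 1 (a ℕ.+ c)))

harmonic-mono : ∀ a {c d} → c ℕ.≤ d → harmonic a c ℚ.≤ harmonic a d
harmonic-mono a {c} {d} c≤d = subst (λ k → harmonic a c ℚ.≤ harmonic a k) (ℕ.m+[n∸m]≡n c≤d)
  (ℚ.≤-trans (≤-+ʳ (harmonic-nonneg (a ℕ.+ c) (d ℕ.∸ c))) (ℚ.≤-reflexive (sym (harmonic-++ a c (d ℕ.∸ c)))))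

log-nonneg : ∀ m → Nonneg (log m)
log-nonneg m n = harmonic-nonneg (suc n) ((m ℕ.∸ 1) ℕ.* suc n)

log-mono : ∀ {a b} → a ℕ.≤ b → log a ≤ log b
log-mono {a} {b} a≤b = pointwise-≤ {log a} {log b} λ n →
  harmonic-mono (suc n) (ℕ.*-monoˡ-≤ (suc n) (ℕ.∸-monoˡ-≤ 1 a≤b))

-- The additivity of the integral is exact for Riemann sums if the mesh is adapted: for factors m
-- and m′, the sum over N < k ≤ mm′N splits at mN, and its second part is the approximant of log m′
-- of mesh 1/(mN).
seq-log-* : ∀ a b n → seq (log (suc a ℕ.* suc b)) n ≡ seq (log (suc a)) n ℚ.+ seq (log (suc b)) (n ℕ.+ a ℕ.* suc n)
seq-log-* a b n = trans (cong (harmonic (suc n)) (split a b n)) (harmonic-++ (suc n) (a ℕ.* suc n) _)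
  where
  split : ∀ a b n → (b ℕ.+ a ℕ.* (1 ℕ.+ b)) ℕ.* (1 ℕ.+ n) ≡ a ℕ.* (1 ℕ.+ n) ℕ.+ b ℕ.* (1 ℕ.+ (n ℕ.+ a ℕ.* (1 ℕ.+ n)))
  split = solve-∀

log-*-≤ : ∀ a b .{{_ : NonZero a}} .{{_ : NonZero b}} → log (a ℕ.* b) ≤ log a + log b
log-*-≤ (suc a) (suc b) ε 0<ε =
  let N , h = cauchy (log (suc b)) ε 0<ε
  in N , λ n l → ℚ.≤-trans (ℚ.≤-reflexive (seq-log-* a b n))
       (ℚ.≤-trans (ℚ.+-monoʳ-≤ (seq (log (suc a)) n)
                    (abs-elim {seq (log (suc b)) (n ℕ.+ a ℕ.* suc n)} {seq (log (suc b)) n}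
                      (h (n ℕ.+ a ℕ.* suc n) n (ℕ.≤-trans l (ℕ.m≤m+n n _)) l)))
                  (ℚ.≤-reflexive (sym (ℚ.+-assoc (seq (log (suc a)) n) (seq (log (suc b)) n) ε))))

log-*-≥ : ∀ a b .{{_ : NonZero a}} .{{_ : NonZero b}} → log a + log b ≤ log (a ℕ.* b)
log-*-≥ (suc a) (suc b) ε 0<ε =
  let N , h = cauchy (log (suc b)) ε 0<ε
  in N , λ n l → ℚ.≤-trans (ℚ.+-monoʳ-≤ (seq (log (suc a)) n)
                    (abs-elim {seq (log (suc b)) n} {seq (log (suc b)) (n ℕ.+ a ℕ.* suc n)}
                      (h n (n ℕ.+ a ℕ.* suc n) l (ℕ.≤-trans l (ℕ.m≤m+n n _)))))
       (ℚ.≤-reflexive (trans (sym (ℚ.+-assoc (seq (log (suc a)) n) _ ε)) (cong (ℚ._+ ε) (sym (seq-log-* a b n)))))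

suc-multiple : ∀ k q → ι (suc k) ℚ.* q ≡ q ℚ.+ ι k ℚ.* q
suc-multiple k q = trans (cong (ℚ._* q) (ι-suc k)) (solve 2 (λ k q → (con 1ℚ :+ k) :* q := q :+ k :* q) refl (ι k) q)

log-^-≤ : ∀ m .{{_ : NonZero m}} k → log (m ℕ.^ k) ≤ fromℕ k * log m
log-^-≤ m zero    = pointwise-≡ {log 1} {fromℕ 0 * log m} λ n → sym (ℚ.*-zeroˡ (seq (log m) n))
log-^-≤ m (suc k) = ≤-trans {log (m ℕ.* m ℕ.^ k)} {log m + log (m ℕ.^ k)} {fromℕ (suc k) * log m}
  (log-*-≤ m (m ℕ.^ k) {{it}} {{ℕ.m^n≢0 m k}})
  (≤-trans {log m + log (m ℕ.^ k)} {log m + fromℕ k * log m} {fromℕ (suc k) * log m}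
    (+-mono-≤ {log m} {log m} {log (m ℕ.^ k)} {fromℕ k * log m} (pointwise-≡ {log m} {log m} λ _ → refl) (log-^-≤ m k))
    (pointwise-≡ {log m + fromℕ k * log m} {fromℕ (suc k) * log m} λ n → sym (suc-multiple k (seq (log m) n))))

log-^-≥ : ∀ m .{{_ : NonZero m}} k → fromℕ k * log m ≤ log (m ℕ.^ k)
log-^-≥ m zero    = pointwise-≡ {fromℕ 0 * log m} {log 1} λ n → ℚ.*-zeroˡ (seq (log m) n)
log-^-≥ m (suc k) = ≤-trans {fromℕ (suc k) * log m} {log m + log (m ℕ.^ k)} {log (m ℕ.* m ℕ.^ k)}
  (≤-trans {fromℕ (suc k) * log m} {log m + fromℕ k * log m} {log m + log (m ℕ.^ k)}
    (pointwise-≡ {fromℕ (suc k) * log m} {log m + fromℕ k * log m} λ n → suc-multiple k (seq (log m) n))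
    (+-mono-≤ {log m} {log m} {fromℕ k * log m} {log (m ℕ.^ k)} (pointwise-≡ {log m} {log m} λ _ → refl) (log-^-≥ m k)))
  (log-*-≥ m (m ℕ.^ k) {{it}} {{ℕ.m^n≢0 m k}})

log2≤1 : ∀ n → seq (log 2) n ℚ.≤ 1ℚ
log2≤1 n = begin
  harmonic (suc n) (1 ℕ.* suc n)          ≤⟨ harmonic-≤ (suc n) (1 ℕ.* suc n) (frac 1 n) (λ i _ → unit-antitone (ℕ.≤-trans (ℕ.n≤1+n n) (ℕ.m≤m+n (suc n) i))) ⟩
  multiple (1 ℕ.* suc n) (frac 1 n)       ≡⟨ cong (λ c → multiple c (frac 1 n)) (ℕ.*-identityˡ (suc n)) ⟩
  multiple (suc n) (frac 1 n)             ≡⟨ multiple≡* (suc n) (frac 1 n) ⟩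
  ι (suc n) ℚ.* frac 1 n                  ≡⟨ ι*frac n ⟩
  1ℚ                                      ∎
  where open ℚ.≤-Reasoning

abstract
  -- Some 1/(d + 1) is at most ε₀ by the Archimedean property. The tolerance ½/(d + 1) becomes ½
  -- after multiplication by d + 1 and disappears between integers.
  positive⇒proportional : ∀ {ε₀} → 0ℝ < ε₀ → ∃ λ d → ∀ x m → ε₀ * fromℕ x ≤ fromℕ m → x ℕ.≤ suc d ℕ.* m
  positive⇒proportional {ε₀} (δ , 0<δ , N , h) with archimedean 0<δ
  ... | d , k = d , λ x m εx≤m →
    let M , b = εx≤m (½ ℚ.* frac 1 d) (half-pos 0<u)
        n = N ℕ.⊔ M
        u≤ε : frac 1 d ℚ.≤ seq ε₀ n
        u≤ε = ℚ.≤-trans (k d ℕ.≤-refl) (ℚ.≤-trans (ℚ.≤-reflexive (sym (ℚ.+-identityˡ δ))) (h n (ℕ.m≤m⊔n N M)))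
    in ι-cancel-≤ {x} {suc d ℕ.* m} (begin
      ι x                                                ≡⟨ trans (sym (ℚ.*-identityˡ (ι x))) (trans (cong (ℚ._* ι x) (sym (ι*frac d))) (ℚ.*-assoc (ι (suc d)) (frac 1 d) (ι x))) ⟩
      ι (suc d) ℚ.* (frac 1 d ℚ.* ι x)                   ≤⟨ scale (ℚ.≤-trans (ℚ.*-monoʳ-≤-nonNeg (ι x) {{ℚ.nonNegative (ι-nonneg x)}} u≤ε) (b n (ℕ.m≤n⊔m N M))) ⟩
      ι (suc d) ℚ.* (ι m ℚ.+ ½ ℚ.* frac 1 d)             ≡⟨ solve 4 (λ a m h u → a :* (m :+ h :* u) := a :* m :+ h :* (a :* u)) refl (ι (suc d)) (ι m) ½ (frac 1 d) ⟩
      ι (suc d) ℚ.* ι m ℚ.+ ½ ℚ.* (ι (suc d) ℚ.* frac 1 d) ≡⟨ cong₂ (λ a b → a ℚ.+ ½ ℚ.* b) (sym (ι-* (suc d) m)) (ι*frac d) ⟩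
      ι (suc d ℕ.* m) ℚ.+ ½ ℚ.* 1ℚ                       ≡⟨ cong (ι (suc d ℕ.* m) ℚ.+_) (ℚ.*-identityʳ ½) ⟩
      ι (suc d ℕ.* m) ℚ.+ ½                              ∎)
    where
    open ℚ.≤-Reasoning
    0<u : 0ℚ ℚ.< frac 1 d
    0<u = ℚ.*-cancelˡ-<-nonNeg (ι (suc d)) {{ℚ.nonNegative (ι-nonneg (suc d))}}
      (subst₂ ℚ._<_ (sym (ℚ.*-zeroʳ (ι (suc d)))) (sym (ι*frac d)) 0<1ℚ)
    scale : ∀ {a b} → a ℚ.≤ b → ι (suc d) ℚ.* a ℚ.≤ ι (suc d) ℚ.* b
    scale = ℚ.*-monoˡ-≤-nonNeg (ι (suc d)) {{ℚ.nonNegative (ι-nonneg (suc d))}}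

rootApprox^≤ : ∀ b .{{_ : NonZero b}} {q} n → 0ℚ ℚ.≤ q → rootApprox b q n ^ℚ b ℚ.≤ q
rootApprox^≤ (suc b) {q} n 0≤q = decide (rootApprox-lower (suc b) q n)
  where
  decide : ∀ {r} → r ≡ 0ℚ ⊎ r ^ℚ suc b ℚ.≤ q → r ^ℚ suc b ℚ.≤ q
  decide (inj₁ refl) = subst (ℚ._≤ q) (sym (ℚ.*-zeroˡ (0ℚ ^ℚ b))) 0≤q
  decide (inj₂ h)    = h

seq-fromℕ-^ : ∀ m k n → seq (fromℕ m ^ k) n ≡ ι (m ℕ.^ k)
seq-fromℕ-^ m k n = trans (seq-^ (fromℕ m) k n) (sym (ι-^ m k))

seq-^⟨/⟩^≤ : ∀ m a b .{{_ : NonZero b}} n → seq (fromℕ m ^⟨ a / b ⟩) n ^ℚ b ℚ.≤ ι (m ℕ.^ a)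
seq-^⟨/⟩^≤ m a b n = ℚ.≤-trans
  (rootApprox^≤ b {seq (fromℕ m ^ a) n} n (ℚ.≤-trans (ι-nonneg (m ℕ.^ a)) (ℚ.≤-reflexive (sym (seq-fromℕ-^ m a n)))))
  (ℚ.≤-reflexive (seq-fromℕ-^ m a n))

seq-^⟨/⟩≤ : ∀ m a b .{{_ : NonZero b}} {B} → m ℕ.^ a ℕ.≤ B ℕ.^ b → ∀ n → seq (fromℕ m ^⟨ a / b ⟩) n ℚ.≤ ι B
seq-^⟨/⟩≤ m a b {B} h n = ^ℚ-cancel-≤ b {seq (fromℕ m ^⟨ a / b ⟩) n} {ι B} (ι-nonneg B)
  (ℚ.≤-trans (seq-^⟨/⟩^≤ m a b n) (ℚ.≤-trans (ι-mono {m ℕ.^ a} {B ℕ.^ b} h) (ℚ.≤-reflexive (ι-^ B b))))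

-- Reading t ≤ C₀x^(2/3) with tolerance 1 bounds only the predecessor of t. Returning to t costs a
-- factor 8, by (t + 1)³ ≤ 4(1 + t³).
cube-double : ∀ {B x} t → 1 ℕ.≤ B → 1 ℕ.≤ x → t ℕ.^ 3 ℕ.≤ B ℕ.^ 3 ℕ.* x ℕ.^ 2 → suc t ℕ.^ 3 ℕ.≤ 8 ℕ.* B ℕ.^ 3 ℕ.* x ℕ.^ 2
cube-double {B} {x} t 1≤B 1≤x l = begin
  suc t ℕ.^ 3                                   ≤⟨ expand t ⟩
  4 ℕ.* (1 ℕ.+ t ℕ.^ 3)                         ≤⟨ ℕ.*-monoʳ-≤ 4 (ℕ.+-mono-≤ 1≤B³x² l) ⟩
  4 ℕ.* (B ℕ.^ 3 ℕ.* x ℕ.^ 2 ℕ.+ B ℕ.^ 3 ℕ.* x ℕ.^ 2)  ≡⟨ collect (B ℕ.^ 3) (x ℕ.^ 2) ⟩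
  8 ℕ.* B ℕ.^ 3 ℕ.* x ℕ.^ 2                     ∎
  where
  open ℕ.≤-Reasoning
  1≤B³x² : 1 ℕ.≤ B ℕ.^ 3 ℕ.* x ℕ.^ 2
  1≤B³x² = ℕ.*-mono-≤ (ℕ.m^n>0 B {{ℕ.>-nonZero 1≤B}} 3) (ℕ.m^n>0 x {{ℕ.>-nonZero 1≤x}} 2)
  collect : ∀ b y → 4 ℕ.* (b ℕ.* y ℕ.+ b ℕ.* y) ≡ 8 ℕ.* b ℕ.* y
  collect = solve-∀
  expand : ∀ t → suc t ℕ.^ 3 ℕ.≤ 4 ℕ.* (1 ℕ.+ t ℕ.^ 3)
  expand zero    = s≤s z≤n
  expand (suc u) = ℕ.≤-trans (ℕ.m≤m+n _ (6 ℕ.* (u ℕ.* u) ℕ.+ 3 ℕ.* (u ℕ.* (u ℕ.* u)))) (ℕ.≤-reflexive (identity u))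
    where
    identity : ∀ u → (2 ℕ.+ u) ℕ.* ((2 ℕ.+ u) ℕ.* ((2 ℕ.+ u) ℕ.* 1)) ℕ.+ (6 ℕ.* (u ℕ.* u) ℕ.+ 3 ℕ.* (u ℕ.* (u ℕ.* u)))
               ≡ 4 ℕ.* (1 ℕ.+ (1 ℕ.+ u) ℕ.* ((1 ℕ.+ u) ℕ.* ((1 ℕ.+ u) ℕ.* 1)))
    identity = solve-∀

cube-from-root : ∀ {c r} B x t → c ℚ.≤ ι B → 0ℚ ℚ.≤ r → r ^ℚ 3 ℚ.≤ ι (x ℕ.^ 2) → ι (suc t) ℚ.≤ c ℚ.* r ℚ.+ 1ℚ →
                 t ℕ.^ 3 ℕ.≤ B ℕ.^ 3 ℕ.* x ℕ.^ 2
cube-from-root {c} {r} B x t c≤B 0≤r r³≤ 1+t≤ = ι-cancel-≤₀ {t ℕ.^ 3} {B ℕ.^ 3 ℕ.* x ℕ.^ 2} (begin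
  ι (t ℕ.^ 3)                         ≡⟨ ι-^ t 3 ⟩
  ι t ^ℚ 3                            ≤⟨ ^ℚ-mono 3 (ι-nonneg t) t≤Br ⟩
  (ι B ℚ.* r) ^ℚ 3                    ≡⟨ ^ℚ-distrib-* 3 (ι B) r ⟩
  ι B ^ℚ 3 ℚ.* r ^ℚ 3                 ≤⟨ ℚ.*-monoˡ-≤-nonNeg (ι B ^ℚ 3) {{ℚ.nonNegative (^ℚ-nonneg 3 (ι-nonneg B))}} r³≤ ⟩
  ι B ^ℚ 3 ℚ.* ι (x ℕ.^ 2)            ≡⟨ cong (ℚ._* ι (x ℕ.^ 2)) (ι-^ B 3) ⟨
  ι (B ℕ.^ 3) ℚ.* ι (x ℕ.^ 2)         ≡⟨ ι-* (B ℕ.^ 3) (x ℕ.^ 2) ⟨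
  ι (B ℕ.^ 3 ℕ.* x ℕ.^ 2)             ∎)
  where
  open ℚ.≤-Reasoning
  t≤Br : ι t ℚ.≤ ι B ℚ.* r
  t≤Br = +-cancelʳ-≤ 1ℚ {ι t} {ι B ℚ.* r} (begin
    ι t ℚ.+ 1ℚ            ≡⟨ frac-suc t 0 ⟨
    ι (suc t)             ≤⟨ 1+t≤ ⟩
    c ℚ.* r ℚ.+ 1ℚ        ≤⟨ ℚ.+-monoˡ-≤ 1ℚ (ℚ.*-monoʳ-≤-nonNeg r {{ℚ.nonNegative 0≤r}} c≤B) ⟩
    ι B ℚ.* r ℚ.+ 1ℚ      ∎)

^⟨/⟩-nonneg : ∀ m a b .{{_ : NonZero b}} → Nonneg (fromℕ m ^⟨ a / b ⟩)
^⟨/⟩-nonneg m a b n = frac-nonneg (rootNumerator b (seq (fromℕ m ^ a) n) n) n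

≤ι : ∀ q → ∃ λ B → 1 ℕ.≤ B × q ℚ.≤ ι B
≤ι q = suc ℤ.∣ ↥ q ∣ , s≤s z≤n , ℚ.<⇒≤ (q<suc∣↥q∣ q)

cube-step : ∀ {c r} B x t → 1 ℕ.≤ B → 1 ℕ.≤ x → c ℚ.≤ ι B → 0ℚ ℚ.≤ r → r ^ℚ 3 ℚ.≤ ι (x ℕ.^ 2) → ι t ℚ.≤ c ℚ.* r ℚ.+ 1ℚ →
            t ℕ.^ 3 ℕ.≤ 8 ℕ.* B ℕ.^ 3 ℕ.* x ℕ.^ 2
cube-step         B x zero    _   _   _   _   _   _  = z≤n
cube-step {c} {r} B x (suc t) 1≤B 1≤x c≤B 0≤r r³≤ t≤ = cube-double {B} {x} t 1≤B 1≤x (cube-from-root {c} {r} B x t c≤B 0≤r r³≤ t≤)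

abstract
  eventually≤ι : ∀ x → ∃ λ B → 1 ℕ.≤ B × ∃ λ N → ∀ n → N ℕ.≤ n → seq x n ℚ.≤ ι B
  eventually≤ι x =
    let C , _ , N , b = bounded x
        B , 1≤B , C≤B = ≤ι C
    in B , 1≤B , N , λ n l → ℚ.≤-trans (p≤∣p∣ (seq x n)) (ℚ.≤-trans (b n l) C≤B)

cube-bound : ∀ {C₀ B N} → 1 ℕ.≤ B → (∀ n → N ℕ.≤ n → seq C₀ n ℚ.≤ ι B) → ∀ x t Y → 1 ℕ.≤ x → Nonneg Y →
             (∀ n → seq Y n ^ℚ 3 ℚ.≤ ι (x ℕ.^ 2)) → fromℕ t ≤ C₀ * Y → t ℕ.^ 3 ℕ.≤ 8 ℕ.* B ℕ.^ 3 ℕ.* x ℕ.^ 2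
cube-bound {C₀} {B} {N} 1≤B C₀≤B x t Y 1≤x 0≤Y Y³≤ t≤ =
  let M , h = t≤ 1ℚ 0<1ℚ
      n = N ℕ.⊔ M
  in cube-step {seq C₀ n} {seq Y n} B x t 1≤B 1≤x (C₀≤B n (ℕ.m≤m⊔n N M)) (0≤Y n) (Y³≤ n) (h n (ℕ.m≤n⊔m N M))

-- With R = 2T - t the lower bound for T gives R ≥ ε₀t, whence (10t)ᵏ = (10/ε₀)ᵏ (ε₀t)ᵏ ≤ t Rᵏ. Both
-- real inequalities are read at one common index; the tolerance ½ for T, doubled, yields R + 1, and
-- the tolerance 1 for t yields t + 1.
remaining-terms : ∀ {ε₀} (ε₀>0 : 0ℝ < ε₀) k t T .{{_ : NonZero t}} →
  (1ℝ + ε₀) * fromℚ ½ * fromℕ t ≤ fromℕ T → (fromℕ 10 * inv ε₀ ε₀>0) ^ k ≤ fromℕ t →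
  ∃ λ R → t ℕ.+ R ≡ 2 ℕ.* T × (10 ℕ.* t) ℕ.^ k ℕ.≤ suc t ℕ.* suc R ℕ.^ k
remaining-terms {ε₀} ε₀>0@(δ , 0<δ , N , h) k t T ceiling large =
  R , t+R≡2T , ι-cancel-≤₀ {(10 ℕ.* t) ℕ.^ k} {suc t ℕ.* suc R ℕ.^ k} (begin
    ι ((10 ℕ.* t) ℕ.^ k)                              ≡⟨ ι-^ (10 ℕ.* t) k ⟩
    ι (10 ℕ.* t) ^ℚ k                                 ≡⟨ cong (_^ℚ k) factor ⟩
    (ι 10 ℚ.* i ℚ.* (e ℚ.* ι t)) ^ℚ k                 ≡⟨ ^ℚ-distrib-* k (ι 10 ℚ.* i) (e ℚ.* ι t) ⟩
    (ι 10 ℚ.* i) ^ℚ k ℚ.* (e ℚ.* ι t) ^ℚ k            ≤⟨ *-mono (^ℚ-nonneg k (*-nonneg (ι-nonneg 10) 0≤i)) 10i≤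
                                                               (^ℚ-nonneg k 0≤et) (^ℚ-mono k 0≤et et≤) ⟩
    ι (suc t) ℚ.* ι (suc R) ^ℚ k                      ≡⟨ cong (ι (suc t) ℚ.*_) (ι-^ (suc R) k) ⟨
    ι (suc t) ℚ.* ι (suc R ℕ.^ k)                     ≡⟨ ι-* (suc t) (suc R ℕ.^ k) ⟨
    ι (suc t ℕ.* suc R ℕ.^ k)                         ∎)
  where
  open ℚ.≤-Reasoning
  N₁ = proj₁ (ceiling ½ 0<½)
  N₂ = proj₁ (large 1ℚ 0<1ℚ)
  n = N ℕ.⊔ (N₁ ℕ.⊔ N₂)
  e = seq ε₀ n
  i = seq (inv ε₀ ε₀>0) n
  δ≤e : δ ℚ.≤ e
  δ≤e = ℚ.≤-trans (ℚ.≤-reflexive (sym (ℚ.+-identityˡ δ))) (h n (ℕ.m≤m⊔n N _))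
  0<e : 0ℚ ℚ.< e
  0<e = ℚ.<-≤-trans 0<δ δ≤e
  0<δ⊔e : 0ℚ ℚ.< δ ℚ.⊔ e
  0<δ⊔e = ℚ.<-≤-trans 0<δ (ℚ.p≤p⊔q δ e)
  e*i≡1 : e ℚ.* i ≡ 1ℚ
  e*i≡1 = trans (cong (ℚ._* i) (sym (ℚ.p≤q⇒p⊔q≡q δ≤e))) (1/pos-inv (δ ℚ.⊔ e) 0<δ⊔e)
  0≤i : 0ℚ ℚ.≤ i
  0≤i = ℚ.<⇒≤ (1/pos-pos (δ ℚ.⊔ e) 0<δ⊔e)
  0<et : 0ℚ ℚ.< e ℚ.* ι t
  0<et = *-pos 0<e (ℚ.<-≤-trans 0<1ℚ (ι-mono {1} {t} (ℕ.>-nonZero⁻¹ t)))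
  0≤et = ℚ.<⇒≤ 0<et
  t+et≤ : ι t ℚ.+ e ℚ.* ι t ℚ.≤ ι (2 ℕ.* T) ℚ.+ 1ℚ
  t+et≤ = begin
    ι t ℚ.+ e ℚ.* ι t                          ≡⟨ solve 2 (λ t e → t :+ e :* t := (con 1ℚ :+ e) :* con ½ :* t :+ (con 1ℚ :+ e) :* con ½ :* t) refl (ι t) e ⟩
    (1ℚ ℚ.+ e) ℚ.* ½ ℚ.* ι t ℚ.+ (1ℚ ℚ.+ e) ℚ.* ½ ℚ.* ι t ≤⟨ ℚ.+-mono-≤ half half ⟩
    ι T ℚ.+ ½ ℚ.+ (ι T ℚ.+ ½)                  ≡⟨ solve 1 (λ t → t :+ con ½ :+ (t :+ con ½) := t :+ (t :+ con 0ℚ) :+ con 1ℚ) refl (ι T) ⟩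
    ι T ℚ.+ (ι T ℚ.+ 0ℚ) ℚ.+ 1ℚ                ≡⟨ cong (ℚ._+ 1ℚ) (trans (ι-+ T (T ℕ.+ 0)) (cong (ι T ℚ.+_) (ι-+ T 0))) ⟨
    ι (2 ℕ.* T) ℚ.+ 1ℚ                         ∎
    where
    half = proj₂ (ceiling ½ 0<½) n (ℕ.≤-trans (ℕ.m≤m⊔n N₁ N₂) (ℕ.m≤n⊔m N _))
  t≤2T : t ℕ.≤ 2 ℕ.* T
  t≤2T = ℕ.≮⇒≥ λ 2T<t → ℚ.<-irrefl refl (begin-strict
    ι t                            <⟨ subst (ℚ._< ι t ℚ.+ e ℚ.* ι t) (ℚ.+-identityʳ (ι t)) (ℚ.+-monoʳ-< (ι t) 0<et) ⟩
    ι t ℚ.+ e ℚ.* ι t              ≤⟨ t+et≤ ⟩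
    ι (2 ℕ.* T) ℚ.+ 1ℚ             ≡⟨ frac-suc (2 ℕ.* T) 0 ⟨
    ι (suc (2 ℕ.* T))              ≤⟨ ι-mono {suc (2 ℕ.* T)} {t} 2T<t ⟩
    ι t                            ∎)
  R = 2 ℕ.* T ℕ.∸ t
  t+R≡2T : t ℕ.+ R ≡ 2 ℕ.* T
  t+R≡2T = ℕ.m+[n∸m]≡n t≤2T
  et≤ : e ℚ.* ι t ℚ.≤ ι (suc R)
  et≤ = +-cancelˡ-≤ (ι t) (begin
    ι t ℚ.+ e ℚ.* ι t              ≤⟨ t+et≤ ⟩
    ι (2 ℕ.* T) ℚ.+ 1ℚ             ≡⟨ cong (λ z → ι z ℚ.+ 1ℚ) t+R≡2T ⟨
    ι (t ℕ.+ R) ℚ.+ 1ℚ             ≡⟨ frac-suc (t ℕ.+ R) 0 ⟨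
    ι (suc (t ℕ.+ R))              ≡⟨ cong ι (ℕ.+-suc t R) ⟨
    ι (t ℕ.+ suc R)                ≡⟨ ι-+ t (suc R) ⟩
    ι t ℚ.+ ι (suc R)              ∎)
  10i≤ : (ι 10 ℚ.* i) ^ℚ k ℚ.≤ ι (suc t)
  10i≤ = subst₂ ℚ._≤_ (seq-^ (fromℕ 10 * inv ε₀ ε₀>0) k n) (sym (frac-suc t 0))
    (proj₂ (large 1ℚ 0<1ℚ) n (ℕ.≤-trans (ℕ.m≤n⊔m N₁ N₂) (ℕ.m≤n⊔m N _)))
  factor : ι (10 ℕ.* t) ≡ ι 10 ℚ.* i ℚ.* (e ℚ.* ι t)
  factor = trans (ι-* 10 t) (trans (cong (λ z → ι 10 ℚ.* z) (trans (sym (ℚ.*-identityˡ (ι t))) (cong (ℚ._* ι t) (sym e*i≡1))))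
    (solve 4 (λ a i e t → a :* (e :* i :* t) := a :* i :* (e :* t)) refl (ι 10) i e (ι t)))

-- Passing from 10 to 9 absorbs the rounding errors in t + 1 and R + 1.
remaining-large : ∀ j {k t R} .{{_ : NonZero t}} → k ≡ suc j ℕ.* 2 → 2 ℕ.* 9 ℕ.^ k ℕ.≤ 10 ℕ.^ k →
  (10 ℕ.* t) ℕ.^ k ℕ.≤ suc t ℕ.* suc R ℕ.^ k →
  9 ℕ.^ (suc j ℕ.* 2) ℕ.* t ℕ.^ suc (j ℕ.* 2) ℕ.≤ suc R ℕ.^ (suc j ℕ.* 2)
remaining-large j {k} {t} {R} refl 2*9≤10 l = ℕ.*-cancelˡ-≤ (2 ℕ.* t) {{ℕ.m*n≢0 2 t}} (begin
  2 ℕ.* t ℕ.* (9 ℕ.^ k ℕ.* t ℕ.^ suc (j ℕ.* 2))     ≡⟨ regroup t (9 ℕ.^ k) (t ℕ.^ suc (j ℕ.* 2)) ⟩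
  2 ℕ.* 9 ℕ.^ k ℕ.* t ℕ.^ k                         ≤⟨ ℕ.*-monoˡ-≤ (t ℕ.^ k) 2*9≤10 ⟩
  10 ℕ.^ k ℕ.* t ℕ.^ k                              ≡⟨ ^-distribʳ-* k 10 t ⟨
  (10 ℕ.* t) ℕ.^ k                                  ≤⟨ l ⟩
  suc t ℕ.* suc R ℕ.^ k                             ≤⟨ ℕ.*-monoˡ-≤ (suc R ℕ.^ k) (ℕ.+-mono-≤ (ℕ.>-nonZero⁻¹ t) (ℕ.m≤m+n t 0)) ⟩
  2 ℕ.* t ℕ.* suc R ℕ.^ k                           ∎)
  where
  open ℕ.≤-Reasoning
  regroup : ∀ t a b → 2 ℕ.* t ℕ.* (a ℕ.* b) ≡ 2 ℕ.* a ℕ.* (t ℕ.* b)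
  regroup = solve-∀

below⇒≤ : ∀ b {x y} → below b x y → x ≤ y
below⇒≤ open-end   {x} {y} x<y = <⇒≤ {x} {y} x<y
below⇒≤ closed-end         x≤y = x≤y

width≤length : ∀ (J : Interval) {u v w} → fromℕ u ∈ J → fromℕ v ∈ J → v ≡ u ℕ.+ w → fromℕ w ≤ ∣ J ∣
width≤length J {u} {v} {w} u∈J v∈J refl ε 0<ε =
  let N , h = below⇒≤ (leftBoundary J) {left J} {fromℕ u} (proj₁ u∈J) (½ ℚ.* ε) (half-pos 0<ε)
      M , k = below⇒≤ (rightBoundary J) {fromℕ (u ℕ.+ w)} {right J} (proj₂ v∈J) (½ ℚ.* ε) (half-pos 0<ε)
  in N ℕ.⊔ M , λ n l → let a = seq (left J) n ; b = seq (right J) n ; η = ½ ℚ.* ε in +-cancelˡ-≤ (ι u ℚ.+ a) (begin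
    ι u ℚ.+ a ℚ.+ ι w                   ≡⟨ solve 3 (λ u a w → u :+ a :+ w := a :+ (u :+ w)) refl (ι u) a (ι w) ⟩
    a ℚ.+ (ι u ℚ.+ ι w)                 ≡⟨ cong (a ℚ.+_) (ι-+ u w) ⟨
    a ℚ.+ ι (u ℕ.+ w)                   ≤⟨ ℚ.+-mono-≤ (h n (ℕ.m⊔n≤o⇒m≤o N M l)) (k n (ℕ.m⊔n≤o⇒n≤o N M l)) ⟩
    ι u ℚ.+ η ℚ.+ (b ℚ.+ η)             ≡⟨ solve 4 (λ u a b η → u :+ η :+ (b :+ η) := u :+ a :+ (b :+ :- a :+ (η :+ η))) refl (ι u) a b η ⟩
    ι u ℚ.+ a ℚ.+ (b ℚ.- a ℚ.+ (η ℚ.+ η)) ≡⟨ cong (λ z → ι u ℚ.+ a ℚ.+ (b ℚ.- a ℚ.+ z)) (half-sum ε) ⟩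
    ι u ℚ.+ a ℚ.+ (b ℚ.- a ℚ.+ ε)       ∎)
  where
  open ℚ.≤-Reasoning
  open +-*-Solver using (:-_)

half≤ : ∀ {a w y} → 2 ℕ.* a ℕ.≤ w → fromℕ w ≤ y → fromℕ a ≤ y * fromℚ ½
half≤ {a} {w} {y} 2a≤w w≤y = ≤-trans {fromℕ a} {fromℕ w * fromℚ ½} {y * fromℚ ½}
  (pointwise-≤ {fromℕ a} {fromℕ w * fromℚ ½} λ _ → begin
    ι a                           ≡⟨ solve 1 (λ a → a := (a :+ (a :+ con 0ℚ)) :* con ½) refl (ι a) ⟩
    (ι a ℚ.+ (ι a ℚ.+ 0ℚ)) ℚ.* ½  ≡⟨ cong (ℚ._* ½) (trans (ι-+ a (a ℕ.+ 0)) (cong (ι a ℚ.+_) (ι-+ a 0))) ⟨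
    ι (2 ℕ.* a) ℚ.* ½             ≤⟨ ℚ.*-monoʳ-≤-nonNeg ½ (ι-mono {2 ℕ.* a} {w} 2a≤w) ⟩
    ι w ℚ.* ½                     ∎)
  (*-monoˡ-≤ (fromℚ ½) {fromℕ w} {y} (λ _ → ℚ.<⇒≤ 0<½) w≤y)
  where open ℚ.≤-Reasoning

≤*inv : ∀ {y} (y>0 : 0ℝ < y) {B s x} → (∀ n → seq y n ℚ.≤ ι B) → s ℕ.* B ℕ.≤ x → fromℕ s ≤ fromℕ x * inv y y>0
≤*inv {y} y>0@(δ , 0<δ , N , h) {B} {s} {x} y≤B sB≤x ε 0<ε = N , λ n l →
  let i = seq (inv y y>0) n
      δ≤y = ℚ.≤-trans (ℚ.≤-reflexive (sym (ℚ.+-identityˡ δ))) (h n l)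
      0≤i = ℚ.<⇒≤ (1/pos-pos (δ ℚ.⊔ seq y n) (0<g n))
  in begin
    ι s                             ≡⟨ trans (sym (ℚ.*-identityʳ (ι s))) (cong (ι s ℚ.*_) (sym (1/pos-inv (δ ℚ.⊔ seq y n) (0<g n)))) ⟩
    ι s ℚ.* ((δ ℚ.⊔ seq y n) ℚ.* i) ≡⟨ ℚ.*-assoc (ι s) (δ ℚ.⊔ seq y n) i ⟨
    ι s ℚ.* (δ ℚ.⊔ seq y n) ℚ.* i   ≤⟨ ℚ.*-monoʳ-≤-nonNeg i {{ℚ.nonNegative 0≤i}} (begin
        ι s ℚ.* (δ ℚ.⊔ seq y n)       ≤⟨ ℚ.*-monoˡ-≤-nonNeg (ι s) {{ℚ.nonNegative (ι-nonneg s)}} (ℚ.⊔-lub (ℚ.≤-trans δ≤y (y≤B n)) (y≤B n)) ⟩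
        ι s ℚ.* ι B                   ≡⟨ ι-* s B ⟨
        ι (s ℕ.* B)                   ≤⟨ ι-mono {s ℕ.* B} {x} sB≤x ⟩
        ι x                           ∎) ⟩
    ι x ℚ.* i                       ≤⟨ ≤-+ʳ (ℚ.<⇒≤ 0<ε) ⟩
    ι x ℚ.* i ℚ.+ ε                 ∎
  where
  open ℚ.≤-Reasoning
  0<g : ∀ n → 0ℚ ℚ.< δ ℚ.⊔ seq y n
  0<g n = ℚ.<-≤-trans 0<δ (ℚ.p≤p⊔q δ (seq y n))

*≤**inv : ∀ {y} (y>0 : 0ℝ < y) {B s x} l → Nonneg l → (∀ n → seq y n ℚ.≤ ι B) → s ℕ.* B ℕ.≤ x →
          fromℕ s * l ≤ fromℕ x * l * inv y y>0
*≤**inv {y} y>0 {B} {s} {x} l 0≤l y≤B sB≤x =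
  ≤-trans {fromℕ s * l} {fromℕ x * inv y y>0 * l} {fromℕ x * l * inv y y>0}
    (*-monoˡ-≤ l {fromℕ s} {fromℕ x * inv y y>0} 0≤l (≤*inv {y} y>0 {B} {s} {x} y≤B sB≤x))
    (pointwise-≡ {fromℕ x * inv y y>0 * l} {fromℕ x * l * inv y y>0} λ n →
      solve 3 (λ x i l → x :* i :* l := x :* l :* i) refl (ι x) (seq (inv y y>0) n) (seq l n))

min-last : ∀ k a → min[1‥ suc k ] a ℕ.≤ a (suc k)
min-last zero    a = ℕ.≤-refl
min-last (suc k) a = ℕ.m⊓n≤n (min[1‥ suc k ] a) (a (suc (suc k)))

min-init : ∀ k a → 1 ℕ.≤ k → min[1‥ suc k ] a ℕ.≤ min[1‥ k ] a
min-init (suc k) a _ = ℕ.m⊓n≤m (min[1‥ suc k ] a) (a (suc (suc k)))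

min≤ : ∀ k a i → 1 ℕ.≤ i → i ℕ.≤ k → min[1‥ k ] a ℕ.≤ a i
min≤ zero    a (suc _) _   ()
min≤ (suc k) a i       1≤i i≤1+k with ℕ.m≤n⇒m<n∨m≡n i≤1+k
... | inj₁ i<1+k = ℕ.≤-trans (min-init k a (ℕ.≤-trans 1≤i (ℕ.≤-pred i<1+k))) (min≤ k a i 1≤i (ℕ.≤-pred i<1+k))
... | inj₂ refl  = min-last k a

p^ord∣ : ∀ p z → p ℕ.^ ord p z ∣ ℤ.∣ z ∣
p^ord∣ p z = decide (greatest-sat (λ k → p ℕ.^ k ∣? ℤ.∣ z ∣) ℤ.∣ z ∣)
  where
  decide : ∀ {k} → k ≡ 0 ⊎ p ℕ.^ k ∣ ℤ.∣ z ∣ → p ℕ.^ k ∣ ℤ.∣ z ∣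
  -- The default value 0 of the search is harmless, since p⁰ divides everything.
  decide (inj₁ refl) = 1∣ ℤ.∣ z ∣
  decide (inj₂ h)    = h

p^-mono-∣ : ∀ p {a b} → a ℕ.≤ b → p ℕ.^ a ∣ p ℕ.^ b
p^-mono-∣ p {a} {b} a≤b = divides (p ℕ.^ (b ℕ.∸ a))
  (trans (cong (p ℕ.^_) (sym (ℕ.m∸n+n≡m a≤b))) (ℕ.^-distribˡ-+-* p (b ℕ.∸ a) a))

log-bound : ∀ {p t x S A s c} .{{_ : NonZero p}} .{{_ : NonZero t}} .{{_ : NonZero x}} →
  p ℕ.^ S ℕ.≤ t ℕ.^ A ℕ.* x ℕ.^ s ℕ.* 2 ℕ.^ c →
  log p * fromℕ S ≤ fromℕ A * log t + fromℕ s * log x + fromℕ c * log 2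
log-bound {p} {t} {x} {S} {A} {s} {c} bound =
  chain (log p * fromℕ S) (fromℕ S * log p) rhs (pointwise-≡ {log p * fromℕ S} {fromℕ S * log p} λ n → ℚ.*-comm (seq (log p) n) (ι S))
  (chain (fromℕ S * log p) (log (p ℕ.^ S)) rhs (log-^-≥ p S)
  (chain (log (p ℕ.^ S)) (log (t ℕ.^ A ℕ.* x ℕ.^ s ℕ.* 2 ℕ.^ c)) rhs (log-mono bound)
  (chain (log (t ℕ.^ A ℕ.* x ℕ.^ s ℕ.* 2 ℕ.^ c)) (log (t ℕ.^ A ℕ.* x ℕ.^ s) + log (2 ℕ.^ c)) rhs (log-*-≤ (t ℕ.^ A ℕ.* x ℕ.^ s) (2 ℕ.^ c))
  (+-mono-≤ {log (t ℕ.^ A ℕ.* x ℕ.^ s)} {fromℕ A * log t + fromℕ s * log x} {log (2 ℕ.^ c)} {fromℕ c * log 2}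
    (chain (log (t ℕ.^ A ℕ.* x ℕ.^ s)) (log (t ℕ.^ A) + log (x ℕ.^ s)) (fromℕ A * log t + fromℕ s * log x) (log-*-≤ (t ℕ.^ A) (x ℕ.^ s))
      (+-mono-≤ {log (t ℕ.^ A)} {fromℕ A * log t} {log (x ℕ.^ s)} {fromℕ s * log x} (log-^-≤ t A) (log-^-≤ x s)))
    (log-^-≤ 2 c)))))
  where
  rhs = fromℕ A * log t + fromℕ s * log x + fromℕ c * log 2
  chain : ∀ a b c → a ≤ b → b ≤ c → a ≤ c
  chain a b c = ≤-trans {a} {b} {c}
  instance
    _ = ℕ.m^n≢0 t A
    _ = ℕ.m^n≢0 x s
    _ = ℕ.m^n≢0 2 c
    _ = ℕ.m*n≢0 (t ℕ.^ A) (x ℕ.^ s)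

-- The three terms come from A ≤ W/2 ≤ ∣J∣/2, from s · 2M ≤ 2A ≤ W ≤ x together with y ≤ 2M, and
-- from log 2 ≤ 1.
additive-bound : ∀ {r K x p t T n e} .{{_ : NonZero p}} .{{_ : NonZero t}} .{{_ : NonZero x}} (J : Interval) →
  (∀ i → 1 ℕ.≤ i → i ℕ.≤ t → fromℕ (n i) ∈ J) → (∀ i → 1 ℕ.≤ i → i ℕ.≤ t → n i ℕ.< x) →
  (y : ℝ) (y>0 : 0ℝ < y) → (mb : MultiplicativeBound r K x p t T n e) →
  (∀ n → seq y n ℚ.≤ ι (2 ℕ.* MultiplicativeBound.M mb)) →
  log p * fromℕ (∑[ T ‥ t ] e) ≤ ∣ J ∣ * fromℚ ½ * log t + fromℕ x * log x * inv y y>0 + fromℕ K * fromℕ x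
additive-bound {r} {K} {x} {p} {t} {T} {n} {e} J ∈J <x y y>0 mb y≤2M =
  ≤-trans {log p * fromℕ (∑[ T ‥ t ] e)} {fromℕ A * log t + fromℕ s * log x + fromℕ (K ℕ.* x) * log 2} {first + second + fromℕ K * fromℕ x}
    (log-bound {p} {t} {x} {∑[ T ‥ t ] e} {A} {s} {K ℕ.* x} bound)
    (+-mono-≤ {fromℕ A * log t + fromℕ s * log x} {first + second} {fromℕ (K ℕ.* x) * log 2} {fromℕ K * fromℕ x}
      (+-mono-≤ {fromℕ A * log t} {first} {fromℕ s * log x} {second}
        (*-monoˡ-≤ (log t) {fromℕ A} {∣ J ∣ * fromℚ ½} (log-nonneg t) (half≤ {A} {W} {∣ J ∣} 2*A≤W (width≤length J {n u} {n v} {W} (∈J u 1≤u u≤t) (∈J v 1≤v v≤t) W-width)))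
        (*≤**inv {y} y>0 {2 ℕ.* M} {s} {x} (log x) (log-nonneg x) y≤2M s2M≤x))
      (pointwise-≤ {fromℕ (K ℕ.* x) * log 2} {fromℕ K * fromℕ x} λ n → begin
        ι (K ℕ.* x) ℚ.* seq (log 2) n     ≤⟨ ℚ.*-monoˡ-≤-nonNeg (ι (K ℕ.* x)) {{ℚ.nonNegative (ι-nonneg (K ℕ.* x))}} (log2≤1 n) ⟩
        ι (K ℕ.* x) ℚ.* 1ℚ                ≡⟨ ℚ.*-identityʳ (ι (K ℕ.* x)) ⟩
        ι (K ℕ.* x)                       ≡⟨ ι-* K x ⟩
        ι K ℚ.* ι x                       ∎))
  where
  open ℚ.≤-Reasoning
  open MultiplicativeBound mb
  first = ∣ J ∣ * fromℚ ½ * log t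
  second = fromℕ x * log x * inv y y>0
  W≤x : W ℕ.≤ x
  W≤x = ℕ.≤-trans (ℕ.≤-trans (ℕ.m≤n+m W (n u)) (ℕ.≤-reflexive (sym W-width))) (ℕ.<⇒≤ (<x v 1≤v v≤t))
  s2M≤x : s ℕ.* (2 ℕ.* M) ℕ.≤ x
  s2M≤x = ℕ.≤-trans (ℕ.≤-reflexive (permute s M)) (ℕ.≤-trans (ℕ.*-monoʳ-≤ 2 M*s≤A) (ℕ.≤-trans 2*A≤W W≤x))
    where
    permute : ∀ s M → s ℕ.* (2 ℕ.* M) ≡ 2 ℕ.* (M ℕ.* s)
    permute = solve-∀

-- For T > t the sum is empty and A = s = 0 suffices. M = t then satisfies the lower bound on 2M,
-- and the first point taken twice has width 0.
empty-bound : ∀ {r K x p t T n e} .{{_ : NonZero t}} → t ℕ.< T → MultiplicativeBound r K x p t T n e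
empty-bound {r} {K} {x} {p} {t} {T} {n} {e} t<T = record
  { A = 0 ; s = 0 ; M = t ; W = 0 ; u = 1 ; v = 1
  ; bound   = subst (λ c → p ℕ.^ sumFrom T c e ℕ.≤ 1 ℕ.* 2 ℕ.^ (K ℕ.* x)) (sym (ℕ.m≤n⇒m∸n≡0 t<T))
                (ℕ.≤-trans (ℕ.m^n>0 2 (K ℕ.* x)) (ℕ.≤-reflexive (sym (ℕ.*-identityˡ _))))
  ; M*s≤A   = ℕ.≤-reflexive (ℕ.*-zeroʳ t)
  ; 2*A≤W   = z≤n
  ; 1≤u     = s≤s z≤n
  ; u≤t     = 1≤t
  ; 1≤v     = s≤s z≤n
  ; v≤t     = 1≤t
  ; W-width = sym (ℕ.+-identityʳ (n 1))
  ; M-large = ℕ.≤-trans (ℕ.^-monoˡ-≤ r (ℕ.m≤m+n t _)) (ℕ.m≤n*m _ (2 ℕ.* t) {{ℕ.m*n≢0 2 t}})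
  }
  where
  1≤t = ℕ.>-nonZero⁻¹ t

p^min-ord∣ : ∀ p (z : ℕ → ℤ) t i → 1 ℕ.≤ i → i ℕ.≤ t → p ℕ.^ min[1‥ t ] (λ j → ord p (z j)) ∣ ℤ.∣ z i ∣
p^min-ord∣ p z t i 1≤i i≤t = ∣-trans (p^-mono-∣ p (min≤ t (λ j → ord p (z j)) i 1≤i i≤t)) (p^ord∣ p (z i))

-- Y and y stand for x^(2/3) and t^(49/50).
Estimate : (f : ℤ[X]) (C₀ ε₀ : ℝ) → 0ℝ < ε₀ → (x₀ K : ℕ) → Set
Estimate f C₀ ε₀ ε₀>0 x₀ K =
  ∀ x → fromℕ x₀ ≤ fromℕ x → ∀ p → Prime p → ∀ t .{{_ : NonZero t}} →
  (fromℕ 10 * inv ε₀ ε₀>0) ^ 100 ≤ fromℕ t →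
  ∀ (Y : ℝ) → Nonneg Y → (∀ n → seq Y n ^ℚ 3 ℚ.≤ ι (x ℕ.^ 2)) → fromℕ t ≤ C₀ * Y →
  ∀ y (y>0 : 0ℝ < y) → (∀ B → t ℕ.^ 49 ℕ.≤ B ℕ.^ 50 → ∀ n → seq y n ℚ.≤ ι B) →
  ∀ (J : Interval) → J ⊆[ ε₀ * fromℕ x , fromℕ (x ℕ.⊓ p) ⟩ →
  ∀ (n : ℕ → ℕ) → (∀ j → 1 ℕ.≤ j → j ℕ.≤ t → fromℕ (n j) ∈ J) →
  (∀ i j → 1 ℕ.≤ i → i ℕ.≤ t → 1 ℕ.≤ j → j ℕ.≤ t → n i ≡ n j → i ≡ j) →
  ∀ T → (1ℝ + ε₀) * fromℚ ½ * fromℕ t ≤ fromℕ T →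
  ∀ (e : ℕ → ℕ) → (∀ t′ i → 1 ℕ.≤ i → i ℕ.≤ t′ → p ℕ.^ e t′ ∣ ℤ.∣ shiftedFactorial f (n i) ∣) →
  log p * fromℕ (∑[ T ‥ t ] e)
    ≤ ∣ J ∣ * fromℚ ½ * log t + fromℕ x * log x * inv y y>0 + fromℕ K * fromℕ x

estimate : ∀ {f} {C₀ ε₀ : ℝ} (ε₀>0 : 0ℝ < ε₀) →
  ∀ {d} → (∀ x m → ε₀ * fromℕ x ≤ fromℕ m → x ℕ.≤ suc d ℕ.* m) →
  ∀ {B N} → 1 ℕ.≤ B → (∀ n → N ℕ.≤ n → seq C₀ n ℚ.≤ ι B) →
  ∀ {x₀ K} → BoundedBeyond 49 f (suc d) (8 ℕ.* B ℕ.^ 3) x₀ K →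
  Estimate f C₀ ε₀ ε₀>0 (suc x₀) (suc K)
estimate {f} {C₀} {ε₀} ε₀>0 {d} proportional {B} {N} 1≤B C₀≤B {x₀} {K} bounded x x₀≤x p p-prime t t-large Y 0≤Y Y³≤ t≤CY y y>0 y≤ J J⊆ n ∈J injective T ceiling e p^e∣ =
  finish (choose (T ℕ.≤? t) (remaining-terms {ε₀} ε₀>0 100 t T {{t≢0}} ceiling t-large))
  where
  t≢0 : NonZero t
  t≢0 = ℕ.>-nonZero (ℕ.>-nonZero⁻¹ t)
  1+x₀≤x : suc x₀ ℕ.≤ x
  1+x₀≤x = fromℕ-cancel-≤ {suc x₀} {x} x₀≤x
  1≤x : 1 ℕ.≤ x
  1≤x = ℕ.≤-trans (s≤s z≤n) 1+x₀≤x
  <x⊓p : ∀ i → 1 ℕ.≤ i → i ℕ.≤ t → n i ℕ.< x ℕ.⊓ p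
  <x⊓p i 1≤i i≤t = fromℕ-cancel-< {n i} {x ℕ.⊓ p} (proj₂ (J⊆ (fromℕ (n i)) (∈J i 1≤i i≤t)))
  <x : ∀ i → 1 ℕ.≤ i → i ℕ.≤ t → n i ℕ.< x
  <x i 1≤i i≤t = ℕ.<-≤-trans (<x⊓p i 1≤i i≤t) (ℕ.m⊓n≤m x p)
  <p : ∀ i → 1 ℕ.≤ i → i ℕ.≤ t → n i ℕ.< p
  <p i 1≤i i≤t = ℕ.<-≤-trans (<x⊓p i 1≤i i≤t) (ℕ.m⊓n≤n x p)
  ≤E* : ∀ i → 1 ℕ.≤ i → i ℕ.≤ t → x ℕ.≤ suc d ℕ.* n i
  ≤E* i 1≤i i≤t = proportional x (n i) (proj₁ (J⊆ (fromℕ (n i)) (∈J i 1≤i i≤t)))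
  t³≤ : t ℕ.^ 3 ℕ.≤ 8 ℕ.* B ℕ.^ 3 ℕ.* x ℕ.^ 2
  t³≤ = cube-bound {C₀} {B} {N} 1≤B C₀≤B x t Y 1≤x 0≤Y Y³≤ t≤CY
  2*9^100≤10^100 : 2 ℕ.* 9 ℕ.^ 100 ℕ.≤ 10 ℕ.^ 100
  2*9^100≤10^100 = ℕ.≤ᵇ⇒≤ (2 ℕ.* 9 ℕ.^ 100) (10 ℕ.^ 100) tt
  choose : Dec (T ℕ.≤ t) → (∃ λ R → t ℕ.+ R ≡ 2 ℕ.* T × (10 ℕ.* t) ℕ.^ 100 ℕ.≤ suc t ℕ.* suc R ℕ.^ 100) →
           MultiplicativeBound 49 (suc K) x p t T n e
  choose (yes T≤t) (R , t+R≡2T , l) = bounded x (ℕ.≤-trans (ℕ.n≤1+n x₀) 1+x₀≤x) p p-prime t {{t≢0}} t³≤ n <x <p ≤E* injective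
    T R T≤t t+R≡2T (remaining-large 49 {100} {t} {R} {{t≢0}} refl 2*9^100≤10^100 l) e p^e∣
  choose (no  T≰t) _ = empty-bound {49} {suc K} {x} {p} {t} {T} {n} {e} {{t≢0}} (ℕ.≰⇒> T≰t)
  finish : MultiplicativeBound 49 (suc K) x p t T n e →
    log p * fromℕ (∑[ T ‥ t ] e) ≤ ∣ J ∣ * fromℚ ½ * log t + fromℕ x * log x * inv y y>0 + fromℕ (suc K) * fromℕ x
  -- `M-large` is t^49 ≤ (2M)^50, which gives t^0.98 ≤ 2M.
  finish mb = additive-bound {49} {suc K} {x} {p} {t} {T} {n} {e} {{prime⇒nonZero p-prime}} {{t≢0}} {{ℕ.>-nonZero 1≤x}}
    J ∈J <x y y>0 mb (y≤ (2 ℕ.* MultiplicativeBound.M mb) (MultiplicativeBound.M-large mb))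

lemma2p7 : (f : ℤ[X]) → NonZeroPoly f →
    (C₀ : ℝ) → 0ℝ < C₀ → CountBound f C₀ →
    (ε₀ : ℝ) (ε₀>0 : 0ℝ < ε₀) → ε₀ < fromℚ (+ 1 / 100) →
    ∃ λ (x₀ : ℝ) → ∃ λ (K : ℝ) → 0ℝ < x₀ × 0ℝ < K ×
    ((x : ℕ) → x₀ ≤ fromℕ x →
    (p : ℕ) → Prime p →
    (t : ℕ) .{{t≢0 : NonZero t}} →
    (fromℕ 10 * inv ε₀ ε₀>0) ^ 100 ≤ fromℕ t →
    fromℕ t ≤ C₀ * fromℕ x ^⟨ 2 / 3 ⟩ →
    (J : Interval) → J ⊆[ ε₀ * fromℕ x , fromℕ (x ℕ.⊓ p) ⟩ →
    (n : ℕ → ℕ) →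
    (∀ j → 1 ℕ.≤ j → j ℕ.≤ t → fromℕ (n j) ∈ J) →
    (∀ i j → 1 ℕ.≤ i → i ℕ.≤ t → 1 ℕ.≤ j → j ℕ.≤ t → n i ≡ n j → i ≡ j) →
    (T : ℕ) → IsCeiling ((1ℝ + ε₀) * fromℚ ½ * fromℕ t) T →
    log p * fromℕ (∑[ T ‥ t ] (λ t' → min[1‥ t' ] (λ j → ord p (shiftedFactorial f (n j)))))
    ≤ ∣ J ∣ * fromℚ ½ * log t
    + fromℕ x * log x * inv (fromℕ t ^⟨ 49 / 50 ⟩) (^⟨/⟩-pos {fromℕ t} 49 50 (fromℕ-pos t))
    + K * fromℕ x)
lemma2p7 f f≢0 C₀ _ _ ε₀ ε₀>0 _ =
  let d , proportional     = positive⇒proportional {ε₀} ε₀>0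
      B , 1≤B , N , C₀≤B   = eventually≤ι C₀
      -- 49 encodes the exponent 49/50 = 0.98, and d + 1 serves as 1/ε₀. In 8B³ the integer B is an
      -- eventual bound for C₀, cubed because t is compared with x^(2/3) in the form t³ ≪ x².
      x₀ , K , bounded     = multiplicative-bound 49 f f≢0 (suc d) (8 ℕ.* B ℕ.^ 3)
  in fromℕ (suc x₀) , fromℕ (suc K) , fromℕ-pos (suc x₀) , fromℕ-pos (suc K) ,
     λ x x₀≤x p p-prime t t-large t≤ J J⊆ n ∈J injective T ceiling →
       estimate {f} {C₀} {ε₀} ε₀>0 {d} proportional {B} {N} 1≤B C₀≤B {x₀} {K} bounded x x₀≤x p p-prime t t-large
         (fromℕ x ^⟨ 2 / 3 ⟩) (^⟨/⟩-nonneg x 2 3) (seq-^⟨/⟩^≤ x 2 3) t≤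
         (fromℕ t ^⟨ 49 / 50 ⟩) (^⟨/⟩-pos {fromℕ t} 49 50 (fromℕ-pos t)) (λ B → seq-^⟨/⟩≤ t 49 50 {B})
         J J⊆ n ∈J injective T (proj₁ ceiling)
         (λ t' → min[1‥ t' ] (λ j → ord p (shiftedFactorial f (n j)))) (p^min-ord∣ p (λ j → shiftedFactorial f (n j)))
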